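{- Let $\bar Q$ be a gentle bound quiver whose reduced non-kissing complex $\widetilde{\mathcal K}(\bar Q)$ is finite. Then the non-kissing oriented flip graph $\vec G(\bar Q)$ is the Hasse diagram of a congruence-uniform lattice.
   Context: A gentle bound quiver is a pair $\bar Q=(Q,I)$, $Q$ a finite quiver (paths composed left to right), $I$ an admissible ideal of $kQ$ generated by paths of length two, such that each vertex has at most two incoming and two outgoing arrows, and for each arrow $\beta$ there is at most one arrow $\alpha$ with $t(\alpha)=s(\beta)$, $\alpha\beta\notin I$, at most one with $\alpha\beta\in I$, at most one $\gamma$ with $s(\gamma)=t(\beta)$, $\beta\gamma\notin I$, and at most one with $\beta\gamma\in I$. Strings: words $\alpha_1^{\pm1}\cdots\alpha_\ell^{\pm1}$ of composable arrows and inverse arrows, reduced, with no factor $\pi^{\pm1}$ for a path $\pi\in I$, or length-zero words $\varepsilon_v$; identified with their inverses. Blossoming quiver $\bar Q^{\circledast}$: add at each $v\in Q_0$ $2-\mathrm{indeg}(v)$ new incoming and $2-\mathrm{outdeg}(v)$ new outgoing arrows, each to its own new blossom vertex, with length-two relations through $v$ making the result gentle. A walk is a maximal string of $\bar Q^\circledast$ (joining two blossom vertices), up to inversion. A substring of a walk is an occurrence of a factor (possibly a vertex) all of whose vertices are in $Q_0$; it is top (resp. bottom) if the two adjacent arrows of the walk point away from (resp. towards) it. $\omega$ kisses $\omega'$ if some string is a top substring of $\omega$ and a bottom substring of $\omega'$. Straight walks are walks which (or whose inverse) are paths; others are bending. The non-kissing complex has faces the sets of pairwise non-kissing, non-self-kissing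 walks; the reduced one $\widetilde{\mathcal K}(\bar Q)$ deletes straight walks. Distinguished arrows: for a facet $F$ (straight walks included) and an arrow $\alpha$ of $Q^\circledast$, among walks of $F$ through $\alpha$ (marked at an occurrence of $\alpha^{\pm1}$, oriented so it reads $\alpha$), $\mu\prec_\alpha\nu$ if at the ends of their maximal common factor containing the mark where they separate, $\mu$ uses an arrow read forward and $\nu$ one read backward; the maximum is the distinguished walk at $\alpha$, and $\alpha$ is one of its distinguished arrows. Each bending walk of a facet has two distinguished arrows; the substring between them is its distinguished string. Facets $F,F'$ of $\widetilde{\mathcal K}(\bar Q)$ with $F\setminus\{\omega\}=F'\setminus\{\omega'\}$ are related by a flip, supported by the common distinguished string $\sigma$ of $\omega$ in $F$ and $\omega'$ in $F'$; it is increasing $F\to F'$ if $\sigma$ is a top substring of $\omega$ and a bottom substring of $\omega'$. $\vec G(\bar Q)$ is the oriented graph on facets of $\widetilde{\mathcal K}(\bar Q)$ with these increasing flips. A finite lattice $L$ is congruence-uniform if the maps $x\mapsto\mathrm{con}(x_\star,x)$ from join-irreducibles of $L$ to join-irreducibles of its congruence lattice, and $x\mapsto\mathrm{con}(x,x^\star)$ from meet-irreducibles to meet-irreducibles, are bijections; here $x_\star$ ($x^\star$) is the unique element covered by (covering) $x$ and $\mathrm{con}(x,y)$ is the finest lattice congruence identifying $x$ and $y$.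
   Formalization: In the definition of congruence-uniform, the map x ↦ con(x, x^⋆) is taken as a bijection from meet-irreducibles of L to join-irreducibles (not meet-irreducibles) of the congruence lattice; the literal version already fails for one vertex without arrows. -}

module Defs where

open import Level using (Level; 0ℓ; _⊔_) renaming (suc to lsuc)
open import Data.Nat.Base using (ℕ; _∸_; _≤_)
open import Data.Fin.Base using (Fin)
open import Data.Fin.Properties using (_≟_)
open import Data.List.Base using (List; []; _∷_; _++_; map; reverse; length; filter; allFin)
open import Data.List.Properties using (map-id; map-∘; map-cong; reverse-map; reverse-involutive)
open import Data.List.Relation.Unary.All using (All)
open import Data.List.Relation.Unary.Linked using (Linked)
open import Data.List.Relation.Unary.Enumerates.Setoid using (IsEnumeration)
open import Data.List.Relation.Binary.Infix.Heterogeneous using (Infix)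
import Data.List.Membership.Setoid as Membership
import Data.List.Relation.Binary.Subset.Setoid as Subset
open import Data.Product.Base using (Σ; Σ-syntax; ∃; ∃₂; ∃-syntax; _×_; _,_; proj₁; proj₂)
open import Data.Sum.Base using (_⊎_; inj₁; inj₂)
open import Function.Base using (_on_; id; _∘_)
open import Function.Bundles using (_⇔_)
open import Function.Definitions using (Bijective)
open import Algebra.Core using (Op₂)
open import Algebra.Definitions using (Congruent₂)
open import Relation.Nullary using (¬_)
open import Relation.Unary using (Pred; _∪_)
open import Relation.Binary.Core using (Rel; _⇒_)
open import Relation.Binary.Definitions using (Decidable)
open import Relation.Binary.Structures using (IsEquivalence)
open import Relation.Binary.Bundles using (Setoid; Poset)
import Relation.Binary.Construct.On as On
open import Relation.Binary.Lattice.Structures using (IsLattice)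
open import Relation.Binary.Lattice.Bundles using (Lattice)
open import Relation.Binary.PropositionalEquality
  using (_≡_; refl; sym; trans; cong; cong₂; subst)

Finite : ∀ {a ℓ} → Setoid a ℓ → Set (a ⊔ ℓ)
Finite S = ∃[ xs ] IsEnumeration S xs

-- An ideal generated by paths of length two is encoded by the set R of its
-- generators: R α β says that αβ (first α, then β) is one of them.
record BoundQuiver : Set₁ where
  field
    V A          : Set
    s t          : A → V
    R            : Rel A 0ℓ
    R?           : Decidable R
    R-composable : ∀ {α β} → R α β → t α ≡ s β

module Strings (B : BoundQuiver) where
  open BoundQuiver B

  Path : Pred (List A) 0ℓ
  Path = Linked (λ α β → t α ≡ s β)

  -- The ideal generated by R is spanned by the paths it contains, which are
  -- the paths having a generator as a factor; hence no field k is needed.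
  _∈I : Pred (List A) 0ℓ
  π ∈I = Path π × ∃₂ λ α β → R α β × Infix _≡_ (α ∷ β ∷ []) π

  record IsGentle : Set where
    field
      -- I contains all sufficiently long paths; being generated in length
      -- two, it is contained in the square of the arrow ideal.
      admissible : ∃[ N ] ∀ {π} → Path π → N ≤ length π → π ∈I
      in≤2       : ∀ {α β γ} → t α ≡ t β → t β ≡ t γ → α ≡ β ⊎ β ≡ γ ⊎ α ≡ γ
      out≤2      : ∀ {α β γ} → s α ≡ s β → s β ≡ s γ → α ≡ β ⊎ β ≡ γ ⊎ α ≡ γ
      before-∉   : ∀ {β α α′} → t α ≡ s β → t α′ ≡ s β →
                   ¬ (α ∷ β ∷ []) ∈I → ¬ (α′ ∷ β ∷ []) ∈I → α ≡ α′
      before-∈   : ∀ {β α α′} → (α ∷ β ∷ []) ∈I → (α′ ∷ β ∷ []) ∈I → α ≡ α′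
      after-∉    : ∀ {β γ γ′} → t β ≡ s γ → t β ≡ s γ′ →
                   ¬ (β ∷ γ ∷ []) ∈I → ¬ (β ∷ γ′ ∷ []) ∈I → γ ≡ γ′
      after-∈    : ∀ {β γ γ′} → (β ∷ γ ∷ []) ∈I → (β ∷ γ′ ∷ []) ∈I → γ ≡ γ′

  infix 9 _⁺ _⁻
  data Letter : Set where
    _⁺ _⁻ : A → Letter

  src tgt : Letter → V
  src (α ⁺) = s α
  src (α ⁻) = t α
  tgt (α ⁺) = t α
  tgt (α ⁻) = s α

  flip : Letter → Letter
  flip (α ⁺) = α ⁻
  flip (α ⁻) = α ⁺

  inv : List Letter → List Letter
  inv = reverse ∘ map flip

  flip-involutive : ∀ l → flip (flip l) ≡ l
  flip-involutive (α ⁺) = refl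
  flip-involutive (α ⁻) = refl

  inv-involutive : ∀ w → inv (inv w) ≡ w
  inv-involutive w =
    trans (sym (reverse-map flip (reverse (map flip w))))
    (trans (cong (map flip) (reverse-involutive (map flip w)))
    (trans (sym (map-∘ w))
    (trans (map-cong flip-involutive w) (map-id w))))

  -- The endpoints are recorded so that the words of length zero at distinct
  -- vertices are distinct.
  record Word : Set where
    constructor word
    field
      source  : V
      letters : List Letter
      target  : V
  open Word public

  infix 9 _⁻¹
  _⁻¹ : Word → Word
  word u w v ⁻¹ = word v (inv w) u

  ⁻¹-involutive : ∀ σ → σ ⁻¹ ⁻¹ ≡ σ
  ⁻¹-involutive (word u w v) = cong (λ w′ → word u w′ v) (inv-involutive w)

  infix 4 _≈_
  _≈_ : Rel Word 0ℓ
  σ ≈ τ = σ ≡ τ ⊎ σ ⁻¹ ≡ τ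

  ≈-isEquivalence : IsEquivalence _≈_
  ≈-isEquivalence = record
    { refl  = inj₁ refl
    ; sym   = λ where
        (inj₁ refl) → inj₁ refl
        (inj₂ refl) → inj₂ (⁻¹-involutive _)
    ; trans = λ where
        (inj₁ refl) q           → q
        (inj₂ refl) (inj₁ refl) → inj₂ refl
        (inj₂ refl) (inj₂ refl) → inj₁ (sym (⁻¹-involutive _))
    }

  Joins : V → List Letter → V → Set
  Joins u []      v = u ≡ v
  Joins u (l ∷ w) v = u ≡ src l × Joins (tgt l) w v

  record IsString (σ : Word) : Set where
    field
      composable : Joins (source σ) (letters σ) (target σ)
      reduced    : ∀ l → ¬ Infix _≡_ (l ∷ flip l ∷ []) (letters σ)
      avoids     : ∀ {π} → π ∈I → ¬ Infix _≡_ (map _⁺ π) (letters σ)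
                                 × ¬ Infix _≡_ (inv (map _⁺ π)) (letters σ)

  -- Factors of strings are strings, so it is enough to forbid extensions by
  -- one letter.
  record IsMaximalString (σ : Word) : Set where
    field
      isString : IsString σ
      maximalˡ : ∀ l → tgt l ≡ source σ →
                 ¬ IsString (word (src l) (l ∷ letters σ) (target σ))
      maximalʳ : ∀ l → src l ≡ target σ →
                 ¬ IsString (word (source σ) (letters σ ++ l ∷ []) (tgt l))

record GentleBoundQuiver : Set₁ where
  field
    #V #A        : ℕ
    s t          : Fin #A → Fin #V
    R            : Rel (Fin #A) 0ℓ
    R?           : Decidable R
    R-composable : ∀ {α β} → R α β → t α ≡ s β

  boundQuiver : BoundQuiver
  boundQuiver = record { R? = R? ; R-composable = R-composable }

  field
    gentle : Strings.IsGentle boundQuiver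

  indeg outdeg : Fin #V → ℕ
  indeg  v = length (filter (λ α → t α ≟ v) (allFin #A))
  outdeg v = length (filter (λ α → s α ≟ v) (allFin #A))

module _ (Q : GentleBoundQuiver) where
  open GentleBoundQuiver Q

  data V⊛ : Set where
    vertex     : Fin #V → V⊛
    inBlossom  : (v : Fin #V) → Fin (2 ∸ indeg v)  → V⊛
    outBlossom : (v : Fin #V) → Fin (2 ∸ outdeg v) → V⊛

  data A⊛ : Set where
    arrow    : Fin #A → A⊛
    inArrow  : (v : Fin #V) → Fin (2 ∸ indeg v)  → A⊛
    outArrow : (v : Fin #V) → Fin (2 ∸ outdeg v) → A⊛

  s⊛ t⊛ : A⊛ → V⊛
  s⊛ (arrow α)      = vertex (s α)
  s⊛ (inArrow v i)  = inBlossom v i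
  s⊛ (outArrow v i) = vertex v
  t⊛ (arrow α)      = vertex (t α)
  t⊛ (inArrow v i)  = vertex v
  t⊛ (outArrow v i) = outBlossom v i

  -- The relations involving blossom arrows are unique only up to renaming
  -- the blossoms, so any choice of them is allowed.
  record Blossoming : Set₁ where
    field
      R⊛            : Rel A⊛ 0ℓ
      R⊛?           : Decidable R⊛
      R⊛-composable : ∀ {α β} → R⊛ α β → t⊛ α ≡ s⊛ β
      extends       : ∀ {α β} → R⊛ (arrow α) (arrow β) ⇔ R α β

    boundQuiver⊛ : BoundQuiver
    boundQuiver⊛ = record { R? = R⊛? ; R-composable = R⊛-composable }

    field
      gentle⊛ : Strings.IsGentle boundQuiver⊛

module NonKissing (Q : GentleBoundQuiver) (B : Blossoming Q) where
  open Blossoming B using (boundQuiver⊛)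
  open Strings boundQuiver⊛ public

  record Walk : Set where
    constructor walk
    field
      toWord          : Word
      isMaximalString : IsMaximalString toWord
  open Walk public

  walkSetoid : Setoid 0ℓ 0ℓ
  walkSetoid = record { isEquivalence = On.isEquivalence toWord ≈-isEquivalence }

  open Setoid walkSetoid public using () renaming (_≈_ to _≈ʷ_)
  open Membership walkSetoid public using (_∈_)
  open Subset walkSetoid public using (_⊆_)

  lettersʷ : Walk → List Letter
  lettersʷ = letters ∘ toWord

  Straight Bending : Pred Walk 0ℓ
  Straight ω = ∃[ π ] (lettersʷ ω ≡ map _⁺ π ⊎ lettersʷ ω ≡ inv (map _⁺ π))
  Bending ω  = ¬ Straight ω

  InQ₀ : Pred Word 0ℓ
  InQ₀ σ = All (λ u → ∃[ v ] u ≡ vertex v) (source σ ∷ map tgt (letters σ))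

  -- ω reads x, l, σ, l′, y: an occurrence in ω of the substring σ, with
  -- adjacent letters l and l′.
  record Occurs (ω : Walk) (x : List Letter) (l : Letter)
                (σ : Word) (l′ : Letter) (y : List Letter) : Set where
    field
      factors : lettersʷ ω ≡ x ++ l ∷ letters σ ++ l′ ∷ y
      starts  : source σ ≡ tgt l
      ends    : target σ ≡ src l′
      inQ₀    : InQ₀ σ

  UpToInversion : Pred Word 0ℓ → Pred Word 0ℓ
  UpToInversion P σ = ∃[ τ ] (τ ≈ σ × P τ)

  TopSubstring BottomSubstring : Walk → Pred Word 0ℓ
  TopSubstring ω = UpToInversion λ σ →
    ∃₂ λ x y → ∃₂ λ α β → Occurs ω x (α ⁻) σ (β ⁺) y
  BottomSubstring ω = UpToInversion λ σ →
    ∃₂ λ x y → ∃₂ λ α β → Occurs ω x (α ⁺) σ (β ⁻) y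

  Kisses : Rel Walk 0ℓ
  Kisses ω ω′ = ∃[ σ ] (TopSubstring ω σ × BottomSubstring ω′ σ)

  -- Taking ω and ω′ equal excludes self-kissing walks.
  IsFace : Pred (List Walk) 0ℓ
  IsFace F = ∀ {ω ω′} → ω ∈ F → ω′ ∈ F → ¬ Kisses ω ω′

  IsReducedFace : Pred (List Walk) 0ℓ
  IsReducedFace F = IsFace F × (∀ {ω} → ω ∈ F → Bending ω)

  IsReducedFacet : Pred (List Walk) 0ℓ
  IsReducedFacet F = IsReducedFace F × (∀ G → IsReducedFace G → F ⊆ G → G ⊆ F)

  infix 4 _≋_
  _≋_ : Rel (List Walk) 0ℓ
  F ≋ G = F ⊆ G × G ⊆ F

  ≋-isEquivalence : IsEquivalence _≋_
  ≋-isEquivalence = record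
    { refl  = (λ p → p) , (λ p → p)
    ; sym   = λ (p , q) → (λ {ω} → q {ω}) , (λ {ω} → p {ω})
    ; trans = λ (p , q) (p′ , q′) →
        (λ {ω} i → p′ {ω} (p {ω} i)) , (λ {ω} i → q {ω} (q′ {ω} i))
    }

  ReducedFace Facet : Set
  ReducedFace = Σ (List Walk) IsReducedFace
  Facet       = Σ (List Walk) IsReducedFacet

  reducedFaceSetoid facetSetoid : Setoid 0ℓ 0ℓ
  reducedFaceSetoid = record
    { Carrier = ReducedFace ; isEquivalence = On.isEquivalence proj₁ ≋-isEquivalence }
  facetSetoid = record
    { Carrier = Facet ; isEquivalence = On.isEquivalence proj₁ ≋-isEquivalence }

  -- A walk marked at an arrow α and oriented so that it reads α is given by
  -- the letters before and after the mark.
  Marked : Set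
  Marked = List Letter × List Letter

  Separateˡ Separateʳ : Rel (List Letter) 0ℓ
  Separateˡ x x′ = ∃[ c ] ∃₂ λ β γ → ∃₂ λ r r′ →
    x ≡ r ++ β ⁺ ∷ c × x′ ≡ r′ ++ γ ⁻ ∷ c
  Separateʳ y y′ = ∃[ c ] ∃₂ λ β γ → ∃₂ λ r r′ →
    y ≡ c ++ β ⁺ ∷ r × y′ ≡ c ++ γ ⁻ ∷ r′

  infix 4 _≺_
  _≺_ : Rel Marked 0ℓ
  (x , y) ≺ (x′ , y′) = (Separateˡ x x′ × y ≡ y′)
                      ⊎ (x ≡ x′ × Separateʳ y y′)
                      ⊎ (Separateˡ x x′ × Separateʳ y y′)

  -- Straight walks kiss no walk, so the corresponding facet of the
  -- unreduced complex is obtained by adding all of them.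
  withStraight : Facet → Pred Walk 0ℓ
  withStraight (F , _) = (_∈ F) ∪ Straight

  IsMaximum : Facet → BoundQuiver.A boundQuiver⊛ → Pred Marked 0ℓ
  IsMaximum F α μ = ∀ ω → withStraight F ω → ∀ x y → lettersʷ ω ≡ x ++ α ⁺ ∷ y →
    (x , y) ≡ μ ⊎ (x , y) ≺ μ

  -- The occurrence of the letter l between x and y is distinguished.
  Distinguished : Facet → List Letter → Letter → List Letter → Set
  Distinguished F x (α ⁺) y = IsMaximum F α (x , y)
  Distinguished F x (α ⁻) y = IsMaximum F α (inv y , inv x)

  DistinguishedString : Facet → Walk → Pred Word 0ℓ
  DistinguishedString F ω = UpToInversion λ σ →
    ∃₂ λ x y → ∃₂ λ l l′ →
      Occurs ω x l σ l′ y
      × Distinguished F x l (letters σ ++ l′ ∷ y)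
      × Distinguished F (x ++ l ∷ letters σ) l′ y

  infix 4 _⟶_
  _⟶_ : Rel Facet 0ℓ
  F ⟶ F′ = ∃₂ λ ω ω′ →
      ω ∈ proj₁ F × ω′ ∈ proj₁ F′ × ¬ (ω ≈ʷ ω′)
    × (∀ μ → (μ ∈ proj₁ F × ¬ (μ ≈ʷ ω)) ⇔ (μ ∈ proj₁ F′ × ¬ (μ ≈ʷ ω′)))
    × ∃[ σ ] ( DistinguishedString F ω σ × DistinguishedString F′ ω′ σ
             × TopSubstring ω σ × BottomSubstring ω′ σ )

module _ {c ℓ₁ ℓ₂} (P : Poset c ℓ₁ ℓ₂) where
  open Poset P renaming (_≤_ to _⊑_)

  -- y covers x
  Covers : Carrier → Carrier → Set (c ⊔ ℓ₁ ⊔ ℓ₂)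
  Covers y x = x ⊑ y × ¬ (x ≈ y) × (∀ z → x ⊑ z → z ⊑ y → z ≈ x ⊎ z ≈ y)

  -- In a finite lattice, x is join-irreducible iff it covers exactly one
  -- element, and meet-irreducible iff it is covered by exactly one.
  record IsJoinIrreducible (x : Carrier) : Set (c ⊔ ℓ₁ ⊔ ℓ₂) where
    field
      x⋆     : Carrier
      covers : Covers x x⋆
      unique : ∀ y → Covers x y → y ≈ x⋆

  record IsMeetIrreducible (x : Carrier) : Set (c ⊔ ℓ₁ ⊔ ℓ₂) where
    field
      x⋆      : Carrier
      covered : Covers x⋆ x
      unique  : ∀ y → Covers y x → y ≈ x⋆

  JoinIrreducible MeetIrreducible : Set (c ⊔ ℓ₁ ⊔ ℓ₂)
  JoinIrreducible = Σ Carrier IsJoinIrreducible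
  MeetIrreducible = Σ Carrier IsMeetIrreducible

module _ (L : Lattice 0ℓ 0ℓ 0ℓ) where
  open Lattice L

  -- Congruences of a finite lattice are finite objects, hence decidable.
  record Congruence : Set₁ where
    field
      _∼_           : Rel Carrier 0ℓ
      _∼?_          : Decidable _∼_
      isEquivalence : IsEquivalence _∼_
      reflexive     : _≈_ ⇒ _∼_
      ∨-cong        : Congruent₂ _∼_ _∨_
      ∧-cong        : Congruent₂ _∼_ _∧_
  open Congruence

  congruencePoset : Poset (lsuc 0ℓ) 0ℓ 0ℓ
  congruencePoset = record
    { Carrier        = Congruence
    ; _≈_            = λ Θ Ψ → (_∼_ Θ ⇒ _∼_ Ψ) × (_∼_ Ψ ⇒ _∼_ Θ)
    ; _≤_            = λ Θ Ψ → _∼_ Θ ⇒ _∼_ Ψ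
    ; isPartialOrder = record
      { isPreorder = record
        { isEquivalence = record
          { refl  = id , id
          ; sym   = λ (p , q) → q , p
          ; trans = λ (p , q) (p′ , q′) → (λ i → p′ (p i)) , (λ i → q (q′ i))
          }
        ; reflexive = proj₁
        ; trans     = λ p q i → q (p i)
        }
      ; antisym = _,_
      }
    }

  open Poset congruencePoset using () renaming (_≈_ to _≈ᶜ_)

  IsFinestIdentifying : Carrier → Carrier → Congruence → Set₁
  IsFinestIdentifying x y Θ = _∼_ Θ x y × (∀ Ψ → _∼_ Ψ x y → _∼_ Θ ⇒ _∼_ Ψ)

  -- A congruence con(x, y) with y covering x is join-irreducible, also when
  -- x is meet-irreducible (it is in general not a meet-irreducible
  -- congruence), so both maps take values in the join-irreducibles.
  record CongruenceUniform : Set₁ where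
    field
      finite     : Finite (record { isEquivalence = Lattice.isEquivalence L })
      con        : Carrier → Carrier → Congruence
      con-finest : ∀ x y → IsFinestIdentifying x y (con x y)

    con⋆ : JoinIrreducible poset → Congruence
    con⋆ (x , p) = con (IsJoinIrreducible.x⋆ p) x

    con^⋆ : MeetIrreducible poset → Congruence
    con^⋆ (x , p) = con x (IsMeetIrreducible.x⋆ p)

    field
      con⋆-irreducible  : ∀ j → IsJoinIrreducible congruencePoset (con⋆ j)
      con^⋆-irreducible : ∀ m → IsJoinIrreducible congruencePoset (con^⋆ m)

    fromJoinIrreducible : JoinIrreducible poset → JoinIrreducible congruencePoset
    fromJoinIrreducible j = con⋆ j , con⋆-irreducible j

    fromMeetIrreducible : MeetIrreducible poset → JoinIrreducible congruencePoset
    fromMeetIrreducible m = con^⋆ m , con^⋆-irreducible m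

    field
      bijectiveˡ : Bijective (_≈_ on proj₁) (_≈ᶜ_ on proj₁) fromJoinIrreducible
      bijectiveʳ : Bijective (_≈_ on proj₁) (_≈ᶜ_ on proj₁) fromMeetIrreducible

record LatticeOn (S : Setoid 0ℓ 0ℓ) : Set₁ where
  open Setoid S using (Carrier; _≈_)
  field
    _⊑_       : Rel Carrier 0ℓ
    _∨_ _∧_   : Op₂ Carrier
    isLattice : IsLattice _≈_ _⊑_ _∨_ _∧_

  lattice : Lattice 0ℓ 0ℓ 0ℓ
  lattice = record { isLattice = isLattice }

-- E x y is an arrow from x to y; Hasse diagrams are oriented upwards.
IsHasseDiagramOf : {S : Setoid 0ℓ 0ℓ} → Rel (Setoid.Carrier S) 0ℓ → LatticeOn S → Set
IsHasseDiagramOf E L = ∀ x y → E x y ⇔ Covers (Lattice.poset (LatticeOn.lattice L)) y x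

{-# OPTIONS --safe #-}

-- A facet F is encoded by its torsion class T_F, the set of strings without a quotient
-- among the bottom substrings of the walks of F; "quotient" means that the adjacent
-- arrows point away.  Torsion classes are the sets T of strings closed under quotients
-- and concatenation.  A walk is compatible with T if its top substrings lie in T and its
-- bottom substrings do not.  The greedy walk of T through a letter l is the one which,
-- having read the string p from l, leaves p by an outgoing arrow iff p ∈ T, on both
-- sides of l.  Closure makes it compatible with T, compatible walks do not kiss, and a
-- string outside (inside) T has a quotient (substring) at the bottom (top) of a greedy
-- walk.  So if all greedy walks are finite, then the compatible bending walks form a
-- facet F with T_F = T.
--
-- A letter of a compatible walk is distinguished iff the walk is greedy from it.  Let
-- x α⁻ σ β⁺ y be compatible with T, with α and β distinguished.  The strings of T
-- without quotient σ form a torsion class T′, whose greedy walks are finite if those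
-- of T are, and F(T′) arises from F(T) by the increasing flip at σ.  Every torsion class
-- strictly below T lies below such a T′; as there are finitely many non-kissing walks,
-- all torsion classes are reached from the largest one by flips.  Hence G is the
-- Hasse diagram of the lattice of torsion classes, ordered by reverse inclusion.
--
-- Membership of a string in a meet or a join is decided by the memberships of its
-- factors, so that agreement on the factors of a string ρ is a congruence Θ ρ.  A
-- join-irreducible j is generated by any string of j ∖ j⋆.  If j and k generate the
-- same congruence and ρ ∈ k ∖ k⋆ has no proper factor there, then Θ ρ does not collapse
-- k, hence not j either, which yields a factor of ρ in j ∖ j⋆ and then, reversing the
-- roles, ρ ∈ j ∖ j⋆ and j = k.  Here the elements of the lattice stand for torsion-free
-- classes; the meet-irreducibles are treated dually, with torsion classes.
module Submission where

open import Level using (0ℓ)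
open import Data.Bool.Base using (Bool; true; false; not) renaming (_∧_ to _&&_)
open import Data.Bool.Properties using (not-involutive; ¬-not)
import Data.Bool.Properties as Bool
open import Data.Nat.Base using (ℕ; zero; suc; _+_; _∸_; _≤_; _<_; z≤n; s≤s)
import Data.Nat.Properties as ℕ
open import Data.Nat.Induction using (<-wellFounded)
open import Data.Nat.ListAction using (sum)
open import Data.Fin.Base using (Fin) renaming (zero to fzero; suc to fsuc)
import Data.Fin.Properties as Fin
open import Data.List.Base
  using (List; []; _∷_; _++_; map; reverse; length; filter; concatMap; cartesianProduct; allFin)
open import Data.List.Properties
  using ( ++-assoc; ++-identityʳ; map-++; reverse-++; unfold-reverse; reverse-map; reverse-involutive; map-∘
        ; length-++; length-map; length-reverse; ≡-dec; ∷-injective)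
open import Data.List.Membership.Propositional using (find; lose) renaming (_∈_ to _∈ˡ_)
open import Data.List.Membership.Propositional.Properties
  using ( ∈-++⁺ˡ; ∈-++⁺ʳ; ∈-++⁻; ∈-map⁺; ∈-map⁻; ∈-concatMap⁺; ∈-concatMap⁻; ∈-filter⁺; ∈-filter⁻
        ; ∈-cartesianProduct⁺)
open import Data.List.Relation.Unary.All using (All; []; _∷_; all?)
import Data.List.Relation.Unary.All as All
import Data.List.Relation.Unary.All.Properties as All
open import Data.List.Relation.Unary.Any using (Any; here; there; any?)
import Data.List.Relation.Unary.Any as Any
import Data.List.Relation.Unary.Any.Properties as Any
open import Data.List.Relation.Unary.AllPairs using (_∷_)
open import Data.List.Relation.Unary.Linked using ([]; [-]; _∷_)
open import Data.List.Relation.Unary.Unique.Propositional using (Unique)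
import Data.List.Relation.Unary.Unique.Propositional.Properties as Unique
open import Data.List.Relation.Binary.Infix.Heterogeneous using (Infix; here; there)
open import Data.List.Relation.Binary.Prefix.Heterogeneous using (Prefix; []; _∷_)
open import Data.Product.Base using (Σ-syntax; ∃; ∃₂; _×_; _,_; proj₁; proj₂)
open import Data.Sum.Base using (_⊎_; inj₁; inj₂) renaming (swap to ⊎-swap)
open import Data.Unit.Base using (⊤; tt)
open import Data.Empty using (⊥; ⊥-elim)
open import Function.Base using (_∘_; id)
open import Function.Bundles using (mk⇔; Equivalence)
open import Induction.WellFounded using (Acc; acc; WellFounded)
open import Relation.Nullary using (¬_; Dec; yes; no; does; contradiction; _×-dec_; _⊎-dec_; _→-dec_; ¬?)
open import Relation.Nullary.Decidable using (map′; decidable-stable)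
open import Relation.Binary.Core using (Rel)
open import Relation.Binary.Definitions using (Decidable; DecidableEquality)
open import Relation.Binary.Structures using (IsEquivalence)
open import Relation.Binary.Bundles using (Poset; Setoid)
open import Relation.Binary.Lattice.Bundles using (Lattice)
import Relation.Binary.Lattice.Properties.JoinSemilattice as JoinSemilattice
import Relation.Binary.Lattice.Properties.MeetSemilattice as MeetSemilattice
import Relation.Binary.Lattice.Properties.Lattice as LatticeProperties
open import Relation.Binary.PropositionalEquality
  using (_≡_; _≢_; refl; sym; trans; cong; cong₂; subst; subst₂; module ≡-Reasoning)
open import Defs

-- The hypothesis bounds the non-kissing walks, not the strings: nothing says beforehand that greedy
-- reading cannot run round a cycle of the quiver for ever. Finiteness of greedy rays (`Good`) is
-- therefore an invariant carried along the flips that lead from the largest class down to a given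
-- one; only `all-good` detaches it from that path. At the largest class it is admissibility, since
-- greedy rays then read arrows forwards only. Across a flip at σ the danger is a ray that is sent
-- on from σ to its inverse and back again without end; a comparison of the lengths of the two arms
-- (`ray-δ`) excludes this. The descent ends because each flip removes σ, and because the strings
-- between two letters of the finitely many listed walks suffice to tell classes apart. A class is a
-- Boolean function on all words. This makes membership decidable and lets closure under quotients
-- and concatenation be used without checking that the words involved are strings; only the values
-- on strings are compared.

module _ {a p q} {A : Set a} {P : A → Set p} {Q : A → Set q}
  (P? : ∀ x → Dec (P x)) (Q? : ∀ x → Dec (Q x)) (P⇒Q : ∀ {x} → P x → Q x) where

  count-≤ : ∀ xs → length (filter P? xs) ≤ length (filter Q? xs)
  count-≤ [] = z≤n
  count-≤ (x ∷ xs) with P? x | Q? x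
  ... | yes _ | yes _ = s≤s (count-≤ xs)
  ... | yes h | no ¬k = contradiction (P⇒Q h) ¬k
  ... | no _  | yes _ = ℕ.m≤n⇒m≤1+n (count-≤ xs)
  ... | no _  | no _  = count-≤ xs

  count-< : ∀ {xs} → Any (λ x → Q x × ¬ P x) xs → length (filter P? xs) < length (filter Q? xs)
  count-< {x ∷ xs} (here (k , ¬h)) with P? x | Q? x
  ... | yes h | _     = contradiction h ¬h
  ... | no _  | yes _ = s≤s (count-≤ xs)
  ... | no _  | no ¬k = contradiction k ¬k
  count-< {x ∷ xs} (there e) with P? x | Q? x
  ... | yes _ | yes _ = s≤s (count-< e)
  ... | yes h | no ¬k = contradiction (P⇒Q h) ¬k
  ... | no _  | yes _ = ℕ.m≤n⇒m≤1+n (count-< e)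
  ... | no _  | no _  = count-< e

subsets : ∀ {a} {A : Set a} → List A → List (List A)
subsets [] = [] ∷ []
subsets (x ∷ xs) = map (x ∷_) (subsets xs) ++ subsets xs

filter-∈-subsets : ∀ {a p} {A : Set a} {P : A → Set p} (P? : ∀ x → Dec (P x)) xs → filter P? xs ∈ˡ subsets xs
filter-∈-subsets P? [] = here refl
filter-∈-subsets P? (x ∷ xs) with P? x
... | yes _ = ∈-++⁺ˡ (∈-map⁺ (x ∷_) (filter-∈-subsets P? xs))
... | no _ = ∈-++⁺ʳ (map (x ∷_) (subsets xs)) (filter-∈-subsets P? xs)

-- Finite lattices

module FinitePoset {c ℓ₁ ℓ₂} (P : Poset c ℓ₁ ℓ₂) (_⊑?_ : Decidable (Poset._≤_ P))
  (xs : List (Poset.Carrier P)) (complete : ∀ x → Any (Poset._≈_ P x) xs) where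

  open Poset P renaming (_≤_ to _⊑_; refl to ⊑-refl; trans to ⊑-trans)

  infix 4 _⊏_
  _⊏_ : Rel Carrier ℓ₂
  x ⊏ y = x ⊑ y × ¬ (y ⊑ x)

  -- The number of listed elements below an element drops along `⊏`, because the larger element is
  -- itself listed and is not below the smaller one.
  ⊏-wellFounded : WellFounded _⊏_
  ⊏-wellFounded x = go x (<-wellFounded _)
    where
    size : Carrier → ℕ
    size y = length (filter (_⊑? y) xs)
    go : ∀ x → Acc _<_ (size x) → Acc _⊏_ x
    go x (acc rs) = acc λ {y} (y⊑x , x⋢y) → go y (rs (count-< (_⊑? y) (_⊑? x) (λ z⊑y → ⊑-trans z⊑y y⊑x)
      (Any.map (λ e → reflexive (Eq.sym e) , λ h → x⋢y (⊑-trans (reflexive e) h)) (complete x))))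

  ⊐-wellFounded : WellFounded (λ x y → y ⊏ x)
  ⊐-wellFounded x = go x (<-wellFounded _)
    where
    size : Carrier → ℕ
    size y = length (filter (y ⊑?_) xs)
    go : ∀ x → Acc _<_ (size x) → Acc (λ x y → y ⊏ x) x
    go x (acc rs) = acc λ {y} (x⊑y , y⋢x) → go y (rs (count-< (y ⊑?_) (x ⊑?_) (λ h → ⊑-trans x⊑y h)
      (Any.map (λ e → reflexive e , λ h → y⋢x (⊑-trans h (reflexive (Eq.sym e)))) (complete x))))

  search : ∀ {p} {R : Carrier → Set p} → (∀ x → Dec (R x)) → (∀ {x y} → x ≈ y → R x → R y) → Dec (∃ R)
  search {R = R} R? resp with any? R? xs
  ... | yes h = yes (Any.satisfied h)
  ... | no ¬h = no λ (x , r) → ¬h (Any.map (λ e → resp e r) (complete x))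

  _⊏?_ : Decidable _⊏_
  x ⊏? y = (x ⊑? y) ×-dec ¬? (y ⊑? x)

  lower-cover : ∀ {x y} → x ⊏ y → ∃ λ z → x ⊑ z × Covers P y z
  lower-cover {x} {y} h = go x (⊐-wellFounded x) ⊑-refl h
    where
    go : ∀ z → Acc (λ x y → y ⊏ x) z → x ⊑ z → z ⊏ y → ∃ λ z → x ⊑ z × Covers P y z
    go z (acc rs) x⊑z z⊏y with search (λ w → (z ⊏? w) ×-dec (w ⊏? y))
           (λ e ((a , b) , (c , d)) → (⊑-trans a (reflexive e) , λ h → b (⊑-trans (reflexive e) h)) ,
                                       (⊑-trans (reflexive (Eq.sym e)) c , λ h → d (⊑-trans h (reflexive (Eq.sym e)))))
    ... | yes (w , z⊏w , w⊏y) = go w (rs z⊏w) (⊑-trans x⊑z (proj₁ z⊏w)) w⊏y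
    ... | no none = z , x⊑z , proj₁ z⊏y , (λ e → proj₂ z⊏y (reflexive (Eq.sym e))) , between
      where
      between : ∀ w → z ⊑ w → w ⊑ y → w ≈ z ⊎ w ≈ y
      between w z⊑w w⊑y with w ⊑? z | y ⊑? w
      ... | yes h | _ = inj₁ (antisym h z⊑w)
      ... | no _ | yes h = inj₂ (antisym w⊑y h)
      ... | no w⋢z | no y⋢w = ⊥-elim (none (w , (z⊑w , w⋢z) , (w⊑y , y⋢w)))

  minimal : ∀ {p} {R : Carrier → Set p} → (∀ x → Dec (R x)) → (∀ {x y} → x ≈ y → R x → R y) →
            ∀ {x} → R x → ∃ λ m → R m × (∀ {y} → y ⊏ m → ¬ R y)
  minimal {R = R} R? resp {x} = go x (⊏-wellFounded x)
    where
    go : ∀ x → Acc _⊏_ x → R x → ∃ λ m → R m × (∀ {y} → y ⊏ m → ¬ R y)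
    go x (acc rs) r with search (λ y → (y ⊏? x) ×-dec R? y)
         (λ e ((a , b) , r) → (⊑-trans (reflexive (Eq.sym e)) a , λ h → b (⊑-trans h (reflexive (Eq.sym e)))) , resp e r)
    ... | yes (y , y⊏x , r′) = go y (rs y⊏x) r′
    ... | no none = x , r , λ y⊏x r′ → none (_ , y⊏x , r′)

  -- Anything strictly below k lies below some lower cover of k, and there is only one.
  below-irreducible : ∀ {k x} (j : IsJoinIrreducible P k) → x ⊏ k → x ⊑ IsJoinIrreducible.x⋆ j
  below-irreducible j x⊏k with lower-cover x⊏k
  ... | z , x⊑z , cov = ⊑-trans x⊑z (reflexive (IsJoinIrreducible.unique j z cov))

module FiniteLattice (L : Lattice 0ℓ 0ℓ 0ℓ) (_⊑?_ : Decidable (Lattice._≤_ L))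
  (xs : List (Lattice.Carrier L)) (complete : ∀ x → Any (Lattice._≈_ L x) xs) where

  open Lattice L renaming (_≤_ to _⊑_; refl to ⊑-refl; trans to ⊑-trans; reflexive to ⊑-reflexive) hiding (isEquivalence)
  open FinitePoset poset _⊑?_ xs complete public
  open Congruence

  _≈?_ : Decidable _≈_
  x ≈? y = map′ (λ (a , b) → antisym a b) (λ e → ⊑-reflexive e , ⊑-reflexive (Eq.sym e)) ((x ⊑? y) ×-dec (y ⊑? x))

  infix 4 _≤ᶜ_
  _≤ᶜ_ : Rel (Congruence L) 0ℓ
  _≤ᶜ_ = Poset._≤_ (congruencePoset L)

  module C (Θ : Congruence L) = IsEquivalence (isEquivalence Θ)

  ∼-∧ʳ : ∀ Θ {x y} z → _∼_ Θ x y → _∼_ Θ (x ∧ z) (y ∧ z)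
  ∼-∧ʳ Θ z h = ∧-cong Θ h (C.refl Θ)

  ∼-∨ʳ : ∀ Θ {x y} z → _∼_ Θ x y → _∼_ Θ (x ∨ z) (y ∨ z)
  ∼-∨ʳ Θ z h = ∨-cong Θ h (C.refl Θ)

  ∨-absorb : ∀ {x y} → x ⊑ y → x ∨ y ≈ y
  ∨-absorb {x} {y} h = antisym (∨-least h ⊑-refl) (y≤x∨y x y)

  ∧-absorb : ∀ {x y} → x ⊑ y → x ∧ y ≈ x
  ∧-absorb {x} {y} h = antisym (x∧y≤x x y) (∧-greatest ⊑-refl h)

  ≈-∼ : ∀ Θ {x y z} → _∼_ Θ x y → y ≈ z → _∼_ Θ x z
  ≈-∼ Θ h e = C.trans Θ h (reflexive Θ e)

  Collapses : Congruence L → JoinIrreducible poset → Set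
  Collapses Θ (k , j) = _∼_ Θ (IsJoinIrreducible.x⋆ j) k

  module _ (k′ : JoinIrreducible poset) where
    private
      k = proj₁ k′
      j = proj₂ k′

    lower : Carrier
    lower = IsJoinIrreducible.x⋆ j

    lower-⊏ : lower ⊏ k
    lower-⊏ with IsJoinIrreducible.covers j
    ... | a , b , _ = a , λ h → b (antisym a h)

    -- Meeting with k relates k to `z ∧ k`, which is strictly below k and so below `lower`. Joining
    -- with `lower` then relates `lower` to k.
    collapse : ∀ Θ {z} → _∼_ Θ z k → ¬ (k ⊑ z) → Collapses Θ k′
    collapse Θ {z} h k⋢z =
      C.trans Θ (reflexive Θ (Eq.sym (∨-absorb below))) (≈-∼ Θ (∼-∨ʳ Θ lower meet) (Eq.trans (∨-comm k lower) (∨-absorb (proj₁ lower-⊏))))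
      where
      open JoinSemilattice joinSemilattice using () renaming (∨-comm to ∨-comm)
      meet : _∼_ Θ (z ∧ k) k
      meet = C.trans Θ (∼-∧ʳ Θ k h) (reflexive Θ (∧-absorb ⊑-refl))
      below : z ∧ k ⊑ lower
      below = below-irreducible j (x∧y≤y z k , λ h → k⋢z (⊑-trans h (x∧y≤x z k)))

  collapses-resp : ∀ Θ {k l} → proj₁ k ≈ proj₁ l → Collapses Θ k → Collapses Θ l
  collapses-resp Θ {k} {l} e c = collapse l Θ (≈-∼ Θ c e)
    (λ h → proj₂ (lower-⊏ k) (⊑-trans (⊑-reflexive e) h))

  -- A minimal k below y but not below x is join-irreducible, with lower cover k ∧ x.
  step : ∀ {x y} → ¬ (y ⊑ x) → ∃ λ (k : JoinIrreducible poset) → proj₁ k ⊑ y × ¬ (proj₁ k ⊑ x) × lower k ⊑ x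
  step {x} {y} y⋢x with minimal {R = λ k → k ⊑ y × ¬ (k ⊑ x)} (λ k → (k ⊑? y) ×-dec ¬? (k ⊑? x))
       (λ e (a , b) → ⊑-trans (⊑-reflexive (Eq.sym e)) a , λ h → b (⊑-trans (⊑-reflexive e) h)) {y} (⊑-refl , y⋢x)
  ... | k , (k⊑y , k⋢x) , min = (k , record { x⋆ = k ∧ x ; covers = cover ; unique = unique }) , k⊑y , k⋢x , x∧y≤y k x
    where
    below : ∀ {z} → z ⊏ k → z ⊑ k ∧ x
    below {z} h with z ⊑? x
    ... | yes z⊑x = ∧-greatest (proj₁ h) z⊑x
    ... | no z⋢x = ⊥-elim (min h (⊑-trans (proj₁ h) k⊑y , z⋢x))
    cover : Covers poset k (k ∧ x)
    cover = x∧y≤x k x , (λ e → k⋢x (⊑-trans (⊑-reflexive (Eq.sym e)) (x∧y≤y k x))) , between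
      where
      between : ∀ z → k ∧ x ⊑ z → z ⊑ k → z ≈ k ∧ x ⊎ z ≈ k
      between z a b with k ⊑? z
      ... | yes h = inj₂ (antisym b h)
      ... | no ¬h = inj₁ (antisym (below (b , ¬h)) a)
    unique : ∀ z → Covers poset k z → z ≈ k ∧ x
    unique z (a , b , c) with c (k ∧ x) (below (a , λ h → b (antisym a h))) (x∧y≤x k x)
    ... | inj₁ e = Eq.sym e
    ... | inj₂ e = ⊥-elim (k⋢x (⊑-trans (⊑-reflexive (Eq.sym e)) (x∧y≤y k x)))

  -- This shows that a congruence is determined by the join-irreducibles it collapses. `step`
  -- supplies k below y, not below x, with lower cover below x, and Ψ collapses it. If Φ does too,
  -- then Φ relates x to `k ∨ x`, and the search goes on from this strictly larger element.
  climb : ∀ Ψ Φ {x y} → x ⊑ y → _∼_ Ψ x y → ¬ _∼_ Φ x y → ∃ λ k → Collapses Ψ k × ¬ Collapses Φ k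
  climb Ψ Φ {x} {y} = go x (⊐-wellFounded x)
    where
    go : ∀ x → Acc (λ x y → y ⊏ x) x → x ⊑ y → _∼_ Ψ x y → ¬ _∼_ Φ x y → ∃ λ k → Collapses Ψ k × ¬ Collapses Φ k
    go x (acc rs) x⊑y h ¬h with y ⊑? x
    ... | yes y⊑x = ⊥-elim (¬h (reflexive Φ (antisym x⊑y y⊑x)))
    ... | no y⋢x with step y⋢x
    ... | k , k⊑y , k⋢x , low with _∼?_ Φ (lower k) (proj₁ k)
    ... | no ¬c = k , collapse k Ψ (≈-∼ Ψ (∼-∧ʳ Ψ (proj₁ k) h) (Eq.trans (∧-comm y (proj₁ k)) (∧-absorb k⊑y)))
                      (λ e → k⋢x (⊑-trans e (x∧y≤x x (proj₁ k)))) , ¬c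
      where open MeetSemilattice meetSemilattice using (∧-comm)
    ... | yes c = go (proj₁ k ∨ x) (rs (y≤x∨y _ x , λ e → k⋢x (⊑-trans (x≤x∨y _ x) e))) (∨-least k⊑y x⊑y)
        (C.trans Ψ (C.sym Ψ up) h′) (λ e → ¬h (C.trans Φ low∼ e))
      where
      low∼ : _∼_ Φ x (proj₁ k ∨ x)
      low∼ = C.trans Φ (reflexive Φ (Eq.sym (∨-absorb low))) (∼-∨ʳ Φ x c)
      h′ : _∼_ Ψ (x ∨ (proj₁ k ∨ x)) y
      h′ = ≈-∼ Ψ (∼-∨ʳ Ψ (proj₁ k ∨ x) h) (antisym (∨-least ⊑-refl (∨-least k⊑y x⊑y)) (x≤x∨y y _))
      up : _∼_ Ψ (x ∨ (proj₁ k ∨ x)) (proj₁ k ∨ x)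
      up = reflexive Ψ (∨-absorb (y≤x∨y (proj₁ k) x))

  compare : ∀ Ψ Φ → Ψ ≤ᶜ Φ ⊎ ∃ λ k → Collapses Ψ k × ¬ Collapses Φ k
  compare Ψ Φ with search {R = λ x → ∃ λ y → _∼_ Ψ x y × ¬ _∼_ Φ x y}
      (λ x → search (λ y → (_∼?_ Ψ x y) ×-dec ¬? (_∼?_ Φ x y))
        (λ e (a , b) → ≈-∼ Ψ a e , λ h → b (≈-∼ Φ h (Eq.sym e))))
      (λ e (y , a , b) → y , C.trans Ψ (reflexive Ψ (Eq.sym e)) a , λ h → b (C.trans Φ (reflexive Φ e) h))
  ... | no none = inj₁ λ {x} {y} h → decided x y h
    where
    decided : ∀ x y → _∼_ Ψ x y → _∼_ Φ x y
    decided x y h with _∼?_ Φ x y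
    ... | yes k = k
    ... | no ¬k = ⊥-elim (none (x , y , h , ¬k))
  -- `climb` needs a comparable pair; a congruence relates x and y iff it relates their meet to
  -- their join.
  ... | yes (x , y , h , ¬h) = inj₂ (climb Ψ Φ (⊑-trans (x∧y≤x x y) (x≤x∨y x y))
        (C.trans Ψ (≈-∼ Ψ (∼-∧ʳ Ψ y h) (∧-absorb ⊑-refl)) (C.sym Ψ (≈-∼ Ψ (∼-∨ʳ Ψ y h) (∨-absorb ⊑-refl))))
        (λ e → ¬h (C.trans Φ (C.sym Φ (inside e (x∧y≤x x y) (x≤x∨y x y))) (inside e (x∧y≤y x y) (y≤x∨y x y)))))
    where
    inside : ∀ {m n z} → _∼_ Φ m n → m ⊑ z → z ⊑ n → _∼_ Φ m z
    inside {z = z} e m⊑z z⊑n = C.trans Φ (reflexive Φ (Eq.sym (∧-absorb m⊑z)))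
      (≈-∼ Φ (∼-∧ʳ Φ z e) (Eq.trans (∧-comm _ z) (∧-absorb z⊑n)))
      where open MeetSemilattice meetSemilattice using (∧-comm)

  _≤ᶜ?_ : Decidable _≤ᶜ_
  Ψ ≤ᶜ? Φ with compare Ψ Φ
  ... | inj₁ h = yes h
  ... | inj₂ (k , c , ¬c) = no λ h → ¬c (h c)

  -- Enumeration of the congruences of a finite lattice.

  ⊤ᶜ : Congruence L
  ⊤ᶜ = record
    { _∼_ = λ _ _ → ⊤ ; _∼?_ = λ _ _ → yes tt
    ; isEquivalence = record { refl = tt ; sym = λ _ → tt ; trans = λ _ _ → tt }
    ; reflexive = λ _ → tt ; ∨-cong = λ _ _ → tt ; ∧-cong = λ _ _ → tt }

  infixr 7 _∧ᶜ_
  _∧ᶜ_ : Congruence L → Congruence L → Congruence L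
  Ψ ∧ᶜ Φ = record
    { _∼_ = λ x y → _∼_ Ψ x y × _∼_ Φ x y
    ; _∼?_ = λ x y → (_∼?_ Ψ x y) ×-dec (_∼?_ Φ x y)
    ; isEquivalence = record
      { refl = C.refl Ψ , C.refl Φ
      ; sym = λ (a , b) → C.sym Ψ a , C.sym Φ b
      ; trans = λ (a , b) (c , d) → C.trans Ψ a c , C.trans Φ b d }
    ; reflexive = λ e → reflexive Ψ e , reflexive Φ e
    ; ∨-cong = λ (a , b) (c , d) → ∨-cong Ψ a c , ∨-cong Φ b d
    ; ∧-cong = λ (a , b) (c , d) → ∧-cong Ψ a c , ∧-cong Φ b d }

  private
    pairs : List (Carrier × Carrier)
    pairs = cartesianProduct xs xs

    Related : List (Carrier × Carrier) → Rel Carrier 0ℓ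
    Related S x y = Any (λ (a , b) → x ≈ a × y ≈ b) S

    related? : ∀ S → Decidable (Related S)
    related? S x y = any? (λ (a , b) → (x ≈? a) ×-dec (y ≈? b)) S

    related-resp : ∀ S {x x′ y y′} → x ≈ x′ → y ≈ y′ → Related S x y → Related S x′ y′
    related-resp S e f = Any.map λ (g , h) → Eq.trans (Eq.sym e) g , Eq.trans (Eq.sym f) h

    representative : ∀ x → ∃ λ x′ → x′ ∈ˡ xs × x ≈ x′
    representative x = find (complete x)

    -- Quantifying over listed elements makes this decidable. Compatibility in the left argument is
    -- enough, by commutativity and transitivity.
    record CongruenceOn (S : List (Carrier × Carrier)) : Set where
      field
        r : All (λ x → Related S x x) xs
        s : All (λ x → All (λ y → Related S x y → Related S y x) xs) xs
        t : All (λ x → All (λ y → All (λ z → Related S x y → Related S y z → Related S x z) xs) xs) xs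
        j : All (λ x → All (λ y → All (λ z → Related S x y → Related S (x ∨ z) (y ∨ z)) xs) xs) xs
        m : All (λ x → All (λ y → All (λ z → Related S x y → Related S (x ∧ z) (y ∧ z)) xs) xs) xs

    congruenceOn? : ∀ S → Dec (CongruenceOn S)
    congruenceOn? S = map′ (λ (r , s , t , j , m) → record { r = r ; s = s ; t = t ; j = j ; m = m })
      (λ c → let open CongruenceOn c in r , s , t , j , m)
      (all? (λ x → R x x) xs
       ×-dec all? (λ x → all? (λ y → R x y →-dec R y x) xs) xs
       ×-dec all? (λ x → all? (λ y → all? (λ z → R x y →-dec (R y z →-dec R x z)) xs) xs) xs
       ×-dec all? (λ x → all? (λ y → all? (λ z → R x y →-dec R (x ∨ z) (y ∨ z)) xs) xs) xs
       ×-dec all? (λ x → all? (λ y → all? (λ z → R x y →-dec R (x ∧ z) (y ∧ z)) xs) xs) xs)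
      where R = related? S

    toCongruence : ∀ S → CongruenceOn S → Congruence L
    toCongruence S c = record
      { _∼_ = R ; _∼?_ = related? S
      ; isEquivalence = record { refl = refl′ ; sym = sym′ ; trans = trans′ }
      ; reflexive = λ e → related-resp S Eq.refl e refl′
      ; ∨-cong = λ {x} {y} {u} {v} h k → trans′ (join h u)
          (related-resp S (∨-comm u y) (∨-comm v y) (join k y))
      ; ∧-cong = λ {x} {y} {u} {v} h k → trans′ (meet h u)
          (related-resp S (∧-comm u y) (∧-comm v y) (meet k y)) }
      where
      open CongruenceOn c
      open JoinSemilattice joinSemilattice using (∨-comm) renaming (∨-cong to ∨-≈)
      open MeetSemilattice meetSemilattice using (∧-comm) renaming (∧-cong to ∧-≈)
      R = Related S
      refl′ : ∀ {x} → R x x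
      refl′ {x} with representative x
      ... | x′ , i , e = related-resp S (Eq.sym e) (Eq.sym e) (All.lookup r i)
      sym′ : ∀ {x y} → R x y → R y x
      sym′ {x} {y} h with representative x | representative y
      ... | x′ , i , e | y′ , i′ , e′ = related-resp S (Eq.sym e′) (Eq.sym e)
        (All.lookup (All.lookup s i) i′ (related-resp S e e′ h))
      trans′ : ∀ {x y z} → R x y → R y z → R x z
      trans′ {x} {y} {z} h k with representative x | representative y | representative z
      ... | x′ , i , e | y′ , i′ , e′ | z′ , i″ , e″ = related-resp S (Eq.sym e) (Eq.sym e″)
        (All.lookup (All.lookup (All.lookup t i) i′) i″ (related-resp S e e′ h) (related-resp S e′ e″ k))
      join : ∀ {x y} → R x y → ∀ z → R (x ∨ z) (y ∨ z)
      join {x} {y} h z with representative x | representative y | representative z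
      ... | x′ , i , e | y′ , i′ , e′ | z′ , i″ , e″ = related-resp S (∨-≈ (Eq.sym e) (Eq.sym e″)) (∨-≈ (Eq.sym e′) (Eq.sym e″))
        (All.lookup (All.lookup (All.lookup j i) i′) i″ (related-resp S e e′ h))
      meet : ∀ {x y} → R x y → ∀ z → R (x ∧ z) (y ∧ z)
      meet {x} {y} h z with representative x | representative y | representative z
      ... | x′ , i , e | y′ , i′ , e′ | z′ , i″ , e″ = related-resp S (∧-≈ (Eq.sym e) (Eq.sym e″)) (∧-≈ (Eq.sym e′) (Eq.sym e″))
        (All.lookup (All.lookup (All.lookup m i) i′) i″ (related-resp S e e′ h))

    collect : List (List (Carrier × Carrier)) → List (Congruence L)
    collect [] = []
    collect (S ∷ Ss) with congruenceOn? S
    ... | yes c = toCongruence S c ∷ collect Ss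
    ... | no _ = collect Ss

  -- A congruence is determined by the pairs of listed elements that it relates, so running through
  -- all sublists of the list of pairs meets each congruence up to equivalence.
  congruences : List (Congruence L)
  congruences = collect (subsets pairs)

  congruences-complete : ∀ Ψ → Any (Poset._≈_ (congruencePoset L) Ψ) congruences
  congruences-complete Ψ = go (subsets pairs) (filter-∈-subsets _ pairs)
    where
    S : List (Carrier × Carrier)
    S = filter (λ (x , y) → _∼?_ Ψ x y) pairs
    to : ∀ {x y} → _∼_ Ψ x y → Related S x y
    to {x} {y} h with representative x | representative y
    ... | x′ , i , e | y′ , i′ , e′ = lose (∈-filter⁺ (λ (x , y) → _∼?_ Ψ x y) (∈-cartesianProduct⁺ i i′)
      (C.trans Ψ (reflexive Ψ (Eq.sym e)) (≈-∼ Ψ h e′))) (e , e′)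
    from : ∀ {x y} → Related S x y → _∼_ Ψ x y
    from h with find h
    ... | (a , b) , i , (e , f) = C.trans Ψ (reflexive Ψ e) (≈-∼ Ψ (proj₂ (∈-filter⁻ (λ (x , y) → _∼?_ Ψ x y) {xs = pairs} i)) (Eq.sym f))
    isCong : CongruenceOn S
    isCong = record
      { r = All.tabulate λ _ → to (C.refl Ψ)
      ; s = All.tabulate λ _ → All.tabulate λ _ h → to (C.sym Ψ (from h))
      ; t = All.tabulate λ _ → All.tabulate λ _ → All.tabulate λ _ h k → to (C.trans Ψ (from h) (from k))
      ; j = All.tabulate λ _ → All.tabulate λ _ → All.tabulate λ {z} _ h → to (∼-∨ʳ Ψ z (from h))
      ; m = All.tabulate λ _ → All.tabulate λ _ → All.tabulate λ {z} _ h → to (∼-∧ʳ Ψ z (from h)) }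
    go : ∀ Ss → S ∈ˡ Ss → Any (Poset._≈_ (congruencePoset L) Ψ) (collect Ss)
    go (S′ ∷ Ss) i with congruenceOn? S′
    go (S′ ∷ Ss) (here refl) | yes c = here (to , from)
    go (S′ ∷ Ss) (here refl) | no ¬c = ⊥-elim (¬c isCong)
    go (S′ ∷ Ss) (there i)   | yes c = there (go Ss i)
    go (S′ ∷ Ss) (there i)   | no ¬c = go Ss i

  private
    finest : List (Congruence L) → Carrier → Carrier → Congruence L
    finest [] x y = ⊤ᶜ
    finest (Φ ∷ Φs) x y with _∼?_ Φ x y
    ... | yes _ = Φ ∧ᶜ finest Φs x y
    ... | no _ = finest Φs x y

    finest-identifies : ∀ Φs x y → _∼_ (finest Φs x y) x y
    finest-identifies [] x y = tt
    finest-identifies (Φ ∷ Φs) x y with _∼?_ Φ x y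
    ... | yes h = h , finest-identifies Φs x y
    ... | no _ = finest-identifies Φs x y

    finest-≤ : ∀ Φs x y Ψ → _∼_ Ψ x y → Any (Poset._≈_ (congruencePoset L) Ψ) Φs → finest Φs x y ≤ᶜ Ψ
    finest-≤ (Φ ∷ Φs) x y Ψ h i with _∼?_ Φ x y
    finest-≤ (Φ ∷ Φs) x y Ψ h (here (a , b)) | yes _ = λ (k , _) → b k
    finest-≤ (Φ ∷ Φs) x y Ψ h (here (a , b)) | no ¬k = ⊥-elim (¬k (a h))
    finest-≤ (Φ ∷ Φs) x y Ψ h (there i)      | yes _ = λ (_ , k) → finest-≤ Φs x y Ψ h i k
    finest-≤ (Φ ∷ Φs) x y Ψ h (there i)      | no _ = finest-≤ Φs x y Ψ h i

  con : Carrier → Carrier → Congruence L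
  con = finest congruences

  con-finest : ∀ x y → IsFinestIdentifying L x y (con x y)
  con-finest x y = finest-identifies congruences x y , λ Ψ h → finest-≤ congruences x y Ψ h (congruences-complete Ψ)

  module CP = FinitePoset (congruencePoset L) _≤ᶜ?_ congruences congruences-complete

  Finest : JoinIrreducible poset → Congruence L → Set₁
  Finest k = IsFinestIdentifying L (lower k) (proj₁ k)

  -- The elements of K are thought of as strings, those of L as classes of strings, and Θ ρ
  -- as the congruence identifying two classes which contain the same factors of ρ.
  record Separation : Set₁ where
    infix 4 _∋_ _⊴_
    field
      K        : Set
      _∋_      : Carrier → K → Set
      ∋-mono   : ∀ {x y ρ} → x ⊑ y → x ∋ ρ → y ∋ ρ
      ∋-sep    : ∀ {x y} → ¬ (x ⊑ y) → ∃ λ ρ → x ∋ ρ × ¬ (y ∋ ρ)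
      ∋-∧      : ∀ {x y ρ} → x ∋ ρ → y ∋ ρ → x ∧ y ∋ ρ
      _⊴_      : K → K → Set
      ⊴-refl   : ∀ {ρ} → ρ ⊴ ρ
      ⊴-trans  : ∀ {ρ ρ′ ρ″} → ρ ⊴ ρ′ → ρ′ ⊴ ρ″ → ρ ⊴ ρ″
      ⊴-∋      : ∀ {x ρ ρ′} → ρ ⊴ ρ′ → ρ′ ⊴ ρ → x ∋ ρ → x ∋ ρ′
      ⊴-minimal : ∀ {x y ρ} → x ∋ ρ → ¬ (y ∋ ρ) →
                  ∃ λ σ → (x ∋ σ × ¬ (y ∋ σ)) × (∀ {τ} → τ ⊴ σ → x ∋ τ → ¬ (y ∋ τ) → σ ⊴ τ)
      Θ        : K → Congruence L
      Θ-∋      : ∀ {ρ ρ′ x y} → ρ′ ⊴ ρ → _∼_ (Θ ρ) x y → x ∋ ρ′ → y ∋ ρ′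
      Θ-sep    : ∀ {ρ x y} → x ⊑ y → ¬ _∼_ (Θ ρ) x y → ∃ λ ρ′ → ρ′ ⊴ ρ × y ∋ ρ′ × ¬ (x ∋ ρ′)

  -- Join-irreducibles and their congruences, told apart by strings.

  module Uniform (separation : Separation) where
    open Separation separation

    Detects : JoinIrreducible poset → K → Set
    Detects k ρ = proj₁ k ∋ ρ × ¬ (lower k ∋ ρ)

    -- Were k not below z, then `k ∧ z` would be strictly below k and hence below its lower cover;
    -- but ρ belongs to `k ∧ z` and not to the lower cover.
    detects-least : ∀ {k ρ z} → Detects k ρ → z ∋ ρ → proj₁ k ⊑ z
    detects-least {k} {ρ} {z} (h , ¬h) h′ with proj₁ k ⊑? z
    ... | yes e = e
    ... | no ¬e = ⊥-elim (¬h (∋-mono (below-irreducible (proj₂ k)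
            (x∧y≤x (proj₁ k) z , λ e → ¬e (⊑-trans e (x∧y≤y (proj₁ k) z)))) (∋-∧ h h′)))

    detects-unique : ∀ {k l ρ} → Detects k ρ → Detects l ρ → proj₁ k ≈ proj₁ l
    detects-unique {k} {l} h h′ = antisym (detects-least {k} h (proj₁ h′)) (detects-least {l} h′ (proj₁ h))

    detects-≈ : ∀ {k ρ ρ′} → ρ ⊴ ρ′ → ρ′ ⊴ ρ → Detects k ρ → Detects k ρ′
    detects-≈ a b (h , ¬h) = ⊴-∋ a b h , λ h′ → ¬h (⊴-∋ b a h′)

    detected : ∀ k → ∃ λ σ → Detects k σ × (∀ {ρ} → ρ ⊴ σ → Detects k ρ → σ ⊴ ρ)
    detected k with ∋-sep (proj₂ (lower-⊏ k))
    ... | ρ , h , ¬h with ⊴-minimal h ¬h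
    ... | σ , d , min = σ , d , λ a (g , ¬g) → min a g ¬g

    detects-part : ∀ {k ρ} → ¬ Collapses (Θ ρ) k → ∃ λ ρ′ → ρ′ ⊴ ρ × Detects k ρ′
    detects-part {k} ¬c with Θ-sep (proj₁ (lower-⊏ k)) ¬c
    ... | ρ′ , a , h = ρ′ , a , h

    not-collapsed : ∀ {k ρ ρ′} → ρ′ ⊴ ρ → Detects k ρ′ → ¬ Collapses (Θ ρ) k
    not-collapsed {k} {ρ} a (h , ¬h) c = ¬h (Θ-∋ a (C.sym (Θ ρ) c) h)

    -- For σ minimal among the strings detected by k, the only lower cover is the meet with `Θ σ`.
    -- Suppose that Ψ below Θₖ collapses some l which `Θ σ` keeps. Then l detects some ρ inside σ.
    -- Since `Θ ρ` keeps l, it is not above Θₖ and keeps k, so k detects a part of ρ. By minimality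
    -- this part is σ, hence so is ρ, and l is k. Thus whatever lies below Θₖ and keeps k lies below
    -- `Θ σ`.
    irreducible : ∀ k Θₖ → Finest k Θₖ → IsJoinIrreducible (congruencePoset L) Θₖ
    irreducible k Θₖ (kc , kf) = record { x⋆ = Θ⋆ ; covers = covers ; unique = unique }
      where
      σ = proj₁ (detected k)
      σ-detects = proj₁ (proj₂ (detected k))
      Θ⋆ : Congruence L
      Θ⋆ = Θₖ ∧ᶜ Θ σ
      k-kept : ¬ Collapses (Θ σ) k
      k-kept = not-collapsed {k} ⊴-refl σ-detects
      below : ∀ Ψ → Ψ ≤ᶜ Θₖ → ¬ Collapses Ψ k → Ψ ≤ᶜ Θ⋆
      below Ψ a ¬c with compare Ψ (Θ σ)
      ... | inj₁ h = λ r → a r , h r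
      ... | inj₂ (l , lc , ¬lc) with detects-part {l} ¬lc
      ... | ρ , ρ⊴σ , ld with _∼?_ (Θ ρ) (lower k) (proj₁ k)
      ... | yes c = ⊥-elim (not-collapsed {l} ⊴-refl ld (kf (Θ ρ) c (a lc)))
      ... | no ¬c′ with detects-part {k} ¬c′
      ... | ρ′ , ρ′⊴ρ , kd = ⊥-elim (¬c (collapses-resp Ψ {l} {k}
            (detects-unique {l} {k} ld (detects-≈ {k} (⊴-trans σ⊴ρ′ ρ′⊴ρ) ρ⊴σ σ-detects)) lc))
        where
        σ⊴ρ′ : σ ⊴ ρ′
        σ⊴ρ′ = proj₂ (proj₂ (detected k)) (⊴-trans ρ′⊴ρ ρ⊴σ) kd
      covers : Covers (congruencePoset L) Θₖ Θ⋆
      covers = proj₁ , (λ (_ , h) → k-kept (proj₂ (h kc))) , between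
        where
        between : ∀ Ψ → Θ⋆ ≤ᶜ Ψ → Ψ ≤ᶜ Θₖ → Poset._≈_ (congruencePoset L) Ψ Θ⋆ ⊎ Poset._≈_ (congruencePoset L) Ψ Θₖ
        between Ψ a b with _∼?_ Ψ (lower k) (proj₁ k)
        ... | yes c = inj₂ (b , kf Ψ c)
        ... | no ¬c = inj₁ (below Ψ b ¬c , a)
      unique : ∀ Ψ → Covers (congruencePoset L) Θₖ Ψ → Poset._≈_ (congruencePoset L) Ψ Θ⋆
      unique Ψ (a , ¬e , c) with c Θ⋆ (below Ψ a (λ h → ¬e (a , kf Ψ h))) proj₁
      ... | inj₁ (d , e) = e , d
      ... | inj₂ (_ , e) = ⊥-elim (k-kept (proj₂ (e kc)))

    injective : ∀ k l {Θₖ Θₗ} → Finest k Θₖ → Finest l Θₗ → Θₖ ≤ᶜ Θₗ → Θₗ ≤ᶜ Θₖ → proj₁ k ≈ proj₁ l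
    injective k l (kc , kf) (lc , lf) a b with detected l
    ... | σ , ld , min with _∼?_ (Θ σ) (lower k) (proj₁ k)
    ... | yes c = ⊥-elim (not-collapsed {l} ⊴-refl ld (kf (Θ σ) c (b lc)))
    ... | no ¬c with detects-part {k} ¬c
    ... | ρ , ρ⊴σ , kd with _∼?_ (Θ ρ) (lower l) (proj₁ l)
    ... | yes c = ⊥-elim (not-collapsed {k} ⊴-refl kd (lf (Θ ρ) c (a kc)))
    ... | no ¬c′ with detects-part {l} ¬c′
    ... | ρ′ , ρ′⊴ρ , ld′ =
      detects-unique {k} {l} kd (detects-≈ {l} (⊴-trans (min (⊴-trans ρ′⊴ρ ρ⊴σ) ld′) ρ′⊴ρ) ρ⊴σ ld)

    -- Take a join-irreducible k of the lattice that Ψ collapses and the lower cover of Ψ does not.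
    -- The congruence generated by k is below Ψ; were it strictly below, it would lie below that
    -- cover and the cover would collapse k.
    surjective : ∀ (J : JoinIrreducible (congruencePoset L)) →
                 ∃ λ k → ∀ {l Θₗ} → proj₁ l ≈ proj₁ k → Finest l Θₗ → Poset._≈_ (congruencePoset L) Θₗ (proj₁ J)
    surjective (Ψ , j) with compare Ψ (IsJoinIrreducible.x⋆ j)
    ... | inj₁ h = ⊥-elim (proj₁ (proj₂ (IsJoinIrreducible.covers j)) (proj₁ (IsJoinIrreducible.covers j) , h))
    ... | inj₂ (k , c , ¬c) = k , λ {l} {Θₗ} e (lc , lf) →
      let below = lf Ψ (collapses-resp Ψ {k} {l} (Eq.sym e) c)
      in below , (above l Θₗ e lc below)
      where
      above : ∀ l Θₗ → proj₁ l ≈ proj₁ k → Collapses Θₗ l → Θₗ ≤ᶜ Ψ → Ψ ≤ᶜ Θₗ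
      above l Θₗ e lc b with Ψ ≤ᶜ? Θₗ
      ... | yes h = h
      ... | no ¬h = ⊥-elim (¬c (CP.below-irreducible {Ψ} {Θₗ} j ((λ r → b r) , (λ h → ¬h (λ r → h r))) (collapses-resp Θₗ {l} {k} e lc)))

-- Duality, and congruence-uniformity from both sides.

module Dual (L : Lattice 0ℓ 0ℓ 0ℓ) where
  open Lattice L using (module Eq; poset)
  open LatticeProperties L public using () renaming (∧-∨-lattice to dualLattice)
  open Congruence

  toDual : Congruence L → Congruence dualLattice
  toDual Θ = record { _∼_ = _∼_ Θ ; _∼?_ = _∼?_ Θ ; isEquivalence = isEquivalence Θ ; reflexive = reflexive Θ
                    ; ∨-cong = ∧-cong Θ ; ∧-cong = ∨-cong Θ }

  fromDual : Congruence dualLattice → Congruence L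
  fromDual Θ = record { _∼_ = _∼_ Θ ; _∼?_ = _∼?_ Θ ; isEquivalence = isEquivalence Θ ; reflexive = reflexive Θ
                      ; ∨-cong = ∧-cong Θ ; ∧-cong = ∨-cong Θ }

  dualPoset : Poset 0ℓ 0ℓ 0ℓ
  dualPoset = Lattice.poset dualLattice

  covers-dual : ∀ {x y} → Covers poset y x → Covers dualPoset x y
  covers-dual (a , ¬e , f) = a , (λ e → ¬e (Eq.sym e)) , λ z b c → ⊎-swap (f z c b)

  covers-undual : ∀ {x y} → Covers dualPoset x y → Covers poset y x
  covers-undual (a , ¬e , f) = a , (λ e → ¬e (Eq.sym e)) , λ z b c → ⊎-swap (f z c b)

  meet→join : MeetIrreducible poset → JoinIrreducible dualPoset
  meet→join (x , m) = x , record
    { x⋆ = x⋆ ; covers = covers-dual covered ; unique = λ y c → unique y (covers-undual c) }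
    where open IsMeetIrreducible m

  join→meet : JoinIrreducible dualPoset → MeetIrreducible poset
  join→meet (x , j) = x , record
    { x⋆ = x⋆ ; covered = covers-undual covers ; unique = λ y c → unique y (covers-dual c) }
    where open IsJoinIrreducible j

  fromDual-irreducible : ∀ {Θ} → IsJoinIrreducible (congruencePoset dualLattice) (toDual Θ) → IsJoinIrreducible (congruencePoset L) Θ
  fromDual-irreducible j = record
    { x⋆ = fromDual x⋆
    ; covers = proj₁ covers , proj₁ (proj₂ covers) , λ Ψ → proj₂ (proj₂ covers) (toDual Ψ)
    ; unique = λ Ψ (a , b , c) → unique (toDual Ψ) (a , b , λ Φ → c (fromDual Φ)) }
    where open IsJoinIrreducible j

  toDual-irreducible : ∀ {Θ} → IsJoinIrreducible (congruencePoset L) Θ → IsJoinIrreducible (congruencePoset dualLattice) (toDual Θ)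
  toDual-irreducible j = record
    { x⋆ = toDual x⋆
    ; covers = proj₁ covers , proj₁ (proj₂ covers) , λ Ψ → proj₂ (proj₂ covers) (fromDual Ψ)
    ; unique = λ Ψ (a , b , c) → unique (fromDual Ψ) (a , b , λ Φ → c (toDual Φ)) }
    where open IsJoinIrreducible j

module _ (L : Lattice 0ℓ 0ℓ 0ℓ) (_⊑?_ : Decidable (Lattice._≤_ L)) (enumeration : Finite (Lattice.setoid L)) where

  open Lattice L using (poset)

  private
    module F = FiniteLattice L _⊑?_ (proj₁ enumeration) (proj₂ enumeration)
    open Dual L
    _⊒?_ : Decidable (Lattice._≤_ dualLattice)
    x ⊒? y = y ⊑? x
    module F⁻ = FiniteLattice dualLattice _⊒?_ (proj₁ enumeration) (proj₂ enumeration)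

    finest-dual : ∀ (m : MeetIrreducible poset) → let x , p = m in
      F⁻.Finest (meet→join m) (toDual (F.con x (IsMeetIrreducible.x⋆ p)))
    finest-dual (x , p) = F.C.sym (F.con x _) (proj₁ (F.con-finest x _)) ,
      λ Ψ h → proj₂ (F.con-finest x _) (fromDual Ψ) (F⁻.C.sym Ψ h)

  congruenceUniform : F.Separation → F⁻.Separation → CongruenceUniform L
  congruenceUniform sep sep⁻ = record
    { finite = enumeration
    ; con = F.con
    ; con-finest = F.con-finest
    ; con⋆-irreducible = λ k → U.irreducible k (F.con (F.lower k) (proj₁ k)) (fin k)
    ; con^⋆-irreducible = λ m → fromDual-irreducible (U⁻.irreducible (meet→join m) (toDual (conᵐ m)) (finest-dual m))
    ; bijectiveˡ = (λ {k} {l} ab → U.injective k l {F.con (F.lower k) (proj₁ k)} {F.con (F.lower l) (proj₁ l)} (fin k) (fin l) (proj₁ ab) (proj₂ ab)) ,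
        λ J → let (k , h) = U.surjective J in k , λ {l} e → h {l} {F.con (F.lower l) (proj₁ l)} e (fin l)
    ; bijectiveʳ = (λ {k} {l} ab → U⁻.injective (meet→join k) (meet→join l) {toDual (conᵐ k)} {toDual (conᵐ l)} (finest-dual k) (finest-dual l) (proj₁ ab) (proj₂ ab)) ,
        λ (Ψ , j) → let (k , h) = U⁻.surjective (toDual Ψ , toDual-irreducible j)
                    in join→meet k , λ {m} e → h {meet→join m} {toDual (conᵐ m)} e (finest-dual m)
    }
    where
    module U = F.Uniform sep
    module U⁻ = F⁻.Uniform sep⁻
    fin : ∀ k → F.Finest k (F.con (F.lower k) (proj₁ k))
    fin k = F.con-finest (F.lower k) (proj₁ k)
    conᵐ : MeetIrreducible poset → Congruence L
    conᵐ (x , p) = F.con x (IsMeetIrreducible.x⋆ p)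

-- Booleans, and marked positions in lists.

t≢f : ∀ {a} {A : Set a} {b : Bool} → b ≡ true → b ≡ false → A
t≢f refl ()

b≢notb : ∀ {A : Set} {b : Bool} → b ≡ not b → A
b≢notb {b = true} ()
b≢notb {b = false} ()

bool? : ∀ b → b ≡ true ⊎ b ≡ false
bool? true = inj₁ refl
bool? false = inj₂ refl

does-false : ∀ {a} {P : Set a} (d : Dec P) → does d ≡ false → ¬ P
does-false (no p) _ = p

false-does : ∀ {a} {P : Set a} (d : Dec P) → ¬ P → does d ≡ false
false-does (yes p) ¬p = contradiction p ¬p
false-does (no _) _ = refl

bool-ext : ∀ {a b} → (a ≡ true → b ≡ true) → (b ≡ true → a ≡ true) → a ≡ b
bool-ext {true} {b} f g = sym (f refl)
bool-ext {false} {true} f g = g refl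
bool-ext {false} {false} f g = refl

∧-true : ∀ {a b} → a && b ≡ true → a ≡ true × b ≡ true
∧-true {true} {true} _ = refl , refl

not-true : ∀ {a} → not a ≡ true → a ≡ false
not-true {false} _ = refl

module _ {A : Set} where

  snoc≢[] : ∀ {B : Set} (p : List A) {m s} → [] ≡ p ++ m ∷ s → B
  snoc≢[] [] ()
  snoc≢[] (_ ∷ _) ()

  data Cmp (p : List A) (m : A) (s p′ : List A) (m′ : A) (s′ : List A) : Set where
    same   : p ≡ p′ → m ≡ m′ → s ≡ s′ → Cmp p m s p′ m′ s′
    after  : ∀ c → p′ ≡ p ++ m ∷ c → s ≡ c ++ m′ ∷ s′ → Cmp p m s p′ m′ s′
    before : ∀ c → p ≡ p′ ++ m′ ∷ c → s′ ≡ c ++ m ∷ s → Cmp p m s p′ m′ s′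

  cmp : ∀ p {m s} p′ {m′ s′} → p ++ m ∷ s ≡ p′ ++ m′ ∷ s′ → Cmp p m s p′ m′ s′
  cmp []      []       refl = same refl refl refl
  cmp []      (x ∷ p′) refl = after p′ refl refl
  cmp (x ∷ p) []       refl = before p refl refl
  cmp (x ∷ p) (y ∷ p′) e with ∷-injective e
  ... | refl , e′ with cmp p p′ e′
  ... | same refl refl refl = same refl refl refl
  ... | after c refl refl = after c refl refl
  ... | before c refl refl = before c refl refl

  split? : ∀ {P : List A → A → List A → Set} w → (∀ p m s → w ≡ p ++ m ∷ s → Dec (P p m s)) →
           Dec (∃₂ λ p m → ∃ λ s → w ≡ p ++ m ∷ s × P p m s)
  split? [] P? = no λ (p , m , s , e , _) → snoc≢[] p e
  split? {P} (x ∷ w) P? with P? [] x w refl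
  ... | yes h = yes ([] , x , w , refl , h)
  ... | no ¬h with split? {λ p → P (x ∷ p)} w (λ p m s e → P? (x ∷ p) m s (cong (x ∷_) e))
  ... | yes (p , m , s , e , h) = yes (x ∷ p , m , s , cong (x ∷_) e , h)
  ... | no ¬k = no λ where
    ([] , _ , _ , refl , h) → ¬h h
    (_ ∷ p , m , s , refl , h) → ¬k (p , m , s , refl , h)

  length-cut : ∀ p {m : A} {s} → length (p ++ m ∷ s) ≡ suc (length p + length s)
  length-cut p {m} {s} = trans (length-++ p) (ℕ.+-suc (length p) (length s))

  cut-<ˡ : ∀ p {m : A} {s} → length p < length (p ++ m ∷ s)
  cut-<ˡ p {m} {s} = subst (length p <_) (sym (length-cut p {m} {s})) (s≤s (ℕ.m≤m+n (length p) (length s)))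

  cut-<ʳ : ∀ p {m : A} {s} → length s < length (p ++ m ∷ s)
  cut-<ʳ p {m} {s} = subst (length s <_) (sym (length-cut p {m} {s})) (s≤s (ℕ.m≤n+m (length s) (length p)))

  assoc∷ : ∀ p {m : A} q {n s} → (p ++ m ∷ q) ++ n ∷ s ≡ p ++ m ∷ q ++ n ∷ s
  assoc∷ p {m} q {n} {s} = ++-assoc p (m ∷ q) (n ∷ s)

  snoc-assoc : ∀ p {m : A} {s} → (p ++ m ∷ []) ++ s ≡ p ++ m ∷ s
  snoc-assoc p {m} {s} = ++-assoc p (m ∷ []) s

ChainOf : {A : Set} → Rel A 0ℓ → A → List A → Set
ChainOf _⇝_ l [] = ⊤
ChainOf _⇝_ l (m ∷ w) = l ⇝ m × ChainOf _⇝_ m w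

-- Strings and torsion classes

-- What is used of a gentle blossoming quiver: pos tells arrows from inverse arrows, and
-- l ⇝ m means that lm is a string.
record StringSystem : Set₁ where
  infix 4 _⇝_
  field
    Letter V : Set
    _≟_ : DecidableEquality Letter
    _≟ⱽ_ : DecidableEquality V
    flip : Letter → Letter
    flip-flip : ∀ l → flip (flip l) ≡ l
    tgt : Letter → V
    pos : Letter → Bool
    pos-flip : ∀ l → pos (flip l) ≡ not (pos l)
    _⇝_ : Rel Letter 0ℓ
    ⇝-flip : ∀ {l m} → l ⇝ m → flip m ⇝ flip l
    ⇝-tgt : ∀ {l m} → l ⇝ m → tgt l ≡ tgt (flip m)
    continues? : ∀ l → Dec (∃ λ m → l ⇝ m)
    succ : ∀ {l m} → l ⇝ m → ∀ b → ∃ λ n → l ⇝ n × pos n ≡ b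
    succ-unique : ∀ {l m n} → l ⇝ m → l ⇝ n → pos m ≡ pos n → m ≡ n
    -- Gentleness splits the four letters that enter a vertex of Q₀ into two pairs, the two sides of
    -- the vertex; a string entering from one side leaves through the other. Hence letters with a
    -- common successor have the same successors (`swap`), and letters from different sides may each
    -- be followed by the inverse of the other (`orient`).
    swap : ∀ {k l m n} → k ⇝ m → l ⇝ m → k ⇝ n → l ⇝ n
    orient : ∀ {k l m n} → k ⇝ m → l ⇝ n → tgt k ≡ tgt l → k ⇝ n ⊎ k ⇝ flip l

    bounded : ∃ λ N → ∀ {l} w → ChainOf _⇝_ l w → All (λ m → pos m ≡ true) w → length w ≤ N

module Combinatorics (S : StringSystem) where
  open StringSystem S public

  -- A string s within Q₀ is passed around as `Chain l (s ++ m ∷ [])`: neighbours l and m are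
  -- available just at the vertices of Q₀, and `tgt l` supplies the source that an empty s does not
  -- show.
  Chain : Letter → List Letter → Set
  Chain = ChainOf _⇝_

  inv : List Letter → List Letter
  inv = reverse ∘ map flip

  inv-++ : ∀ x y → inv (x ++ y) ≡ inv y ++ inv x
  inv-++ x y = trans (cong reverse (map-++ flip x y)) (reverse-++ (map flip x) (map flip y))

  inv-∷ : ∀ l y → inv (l ∷ y) ≡ inv y ++ flip l ∷ []
  inv-∷ l y = unfold-reverse (flip l) (map flip y)

  inv-cut : ∀ x {l} y → inv (x ++ l ∷ y) ≡ inv y ++ flip l ∷ inv x
  inv-cut x {l} y = begin
    inv (x ++ l ∷ y)                 ≡⟨ inv-++ x (l ∷ y) ⟩
    inv (l ∷ y) ++ inv x             ≡⟨ cong (_++ inv x) (inv-∷ l y) ⟩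
    (inv y ++ flip l ∷ []) ++ inv x  ≡⟨ ++-assoc (inv y) (flip l ∷ []) (inv x) ⟩
    inv y ++ flip l ∷ inv x          ∎
    where open ≡-Reasoning

  inv-inv : ∀ w → inv (inv w) ≡ w
  inv-inv [] = refl
  inv-inv (l ∷ w) = begin
    inv (inv (l ∷ w))          ≡⟨ cong inv (inv-∷ l w) ⟩
    inv (inv w ++ flip l ∷ []) ≡⟨ inv-cut (inv w) [] ⟩
    flip (flip l) ∷ inv (inv w) ≡⟨ cong₂ _∷_ (flip-flip l) (inv-inv w) ⟩
    l ∷ w                      ∎
    where open ≡-Reasoning

  inv-cut₂ : ∀ x {l} s {m} y → inv (x ++ l ∷ s ++ m ∷ y) ≡ inv y ++ flip m ∷ inv s ++ flip l ∷ inv x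
  inv-cut₂ x {l} s {m} y = begin
    inv (x ++ l ∷ s ++ m ∷ y)                    ≡⟨ inv-cut x (s ++ m ∷ y) ⟩
    inv (s ++ m ∷ y) ++ flip l ∷ inv x           ≡⟨ cong (_++ flip l ∷ inv x) (inv-cut s y) ⟩
    (inv y ++ flip m ∷ inv s) ++ flip l ∷ inv x  ≡⟨ assoc∷ (inv y) (inv s) ⟩
    inv y ++ flip m ∷ inv s ++ flip l ∷ inv x    ∎
    where open ≡-Reasoning

  length-inv : ∀ w → length (inv w) ≡ length w
  length-inv w = trans (length-reverse (map flip w)) (length-map flip w)

  flip-inj : ∀ {l m} → flip l ≡ flip m → l ≡ m
  flip-inj {l} {m} e = trans (sym (flip-flip l)) (trans (cong flip e) (flip-flip m))

  inv-inj : ∀ {v w} → inv v ≡ inv w → v ≡ w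
  inv-inj {v} {w} e = trans (sym (inv-inv v)) (trans (cong inv e) (inv-inv w))

  uncut : ∀ {w x l y} → inv w ≡ x ++ l ∷ y → w ≡ inv y ++ flip l ∷ inv x
  uncut {w} {x} {l} {y} e = trans (sym (inv-inv w)) (trans (cong inv e) (inv-cut x y))

  pos-flip² : ∀ {l b} → pos l ≡ b → pos (flip l) ≡ not b
  pos-flip² {l} refl = pos-flip l

  chain-drop : ∀ {l} p {m s} → Chain l (p ++ m ∷ s) → Chain m s
  chain-drop [] (_ , c) = c
  chain-drop (_ ∷ p) (_ , c) = chain-drop p c

  chain-cut : ∀ {l} p {m s} → Chain l (p ++ m ∷ s) → Chain l (p ++ m ∷ [])
  chain-cut [] (h , _) = h , tt
  chain-cut (_ ∷ p) (h , c) = h , chain-cut p c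

  chain-join : ∀ {l} p {m s} → Chain l (p ++ m ∷ []) → Chain m s → Chain l (p ++ m ∷ s)
  chain-join [] (h , _) c = h , c
  chain-join (_ ∷ p) (h , c) d = h , chain-join p c d

  chain-inv : ∀ {l} p {m} → Chain l (p ++ m ∷ []) → Chain (flip m) (inv p ++ flip l ∷ [])
  chain-inv [] (h , _) = ⇝-flip h , tt
  chain-inv {l} (k ∷ p) {m} (h , c) =
    subst (Chain (flip m)) (trans (sym (++-assoc (inv p) _ _)) (cong (_++ flip l ∷ []) (sym (inv-∷ k p))))
      (chain-join (inv p) (chain-inv p c) (⇝-flip h , tt))

  chain-inv⁻ : ∀ {l} p {m} → Chain (flip m) (inv p ++ flip l ∷ []) → Chain l (p ++ m ∷ [])
  chain-inv⁻ {l} p {m} c with chain-inv (inv p) c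
  ... | d rewrite flip-flip l | inv-inv p | flip-flip m = d

  chain-last : ∀ {l} p {m} → Chain l (p ++ m ∷ []) → ∀ b → ∃ λ n → Chain l (p ++ n ∷ []) × pos n ≡ b
  chain-last [] (h , _) b with succ h b
  ... | n , h′ , e = n , (h′ , tt) , e
  chain-last (k ∷ p) (h , c) b with chain-last p c b
  ... | n , c′ , e = n , (h , c′) , e

  chain-last-unique : ∀ {l} p {m n} → Chain l (p ++ m ∷ []) → Chain l (p ++ n ∷ []) → pos m ≡ pos n → m ≡ n
  chain-last-unique [] (h , _) (k , _) = succ-unique h k
  chain-last-unique (_ ∷ p) (_ , c) (_ , d) = chain-last-unique p c d

  infix 4 _≈_
  -- The two letters enter their common vertex from the same side. Together with the sign this
  -- determines a letter (`≈-≡`), and both signs occur (`chain-first`).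
  _≈_ : Rel Letter 0ℓ
  k ≈ l = ∃ λ n → k ⇝ n × l ⇝ n

  ≈-sym : ∀ {k l} → k ≈ l → l ≈ k
  ≈-sym (n , h , h′) = n , h′ , h

  ≈-tgt : ∀ {k l} → k ≈ l → tgt k ≡ tgt l
  ≈-tgt (n , h , h′) = trans (⇝-tgt h) (sym (⇝-tgt h′))

  ≈-⇝ : ∀ {k l m} → k ≈ l → k ⇝ m → l ⇝ m
  ≈-⇝ (n , h , h′) = swap h h′

  ≈-≡ : ∀ {k l} → k ≈ l → pos k ≡ pos l → k ≡ l
  ≈-≡ {k} {l} (n , h , h′) e = flip-inj (succ-unique (⇝-flip h) (⇝-flip h′)
    (trans (pos-flip k) (trans (cong not e) (sym (pos-flip l)))))

  ≈-chain : ∀ {k l} w → k ≈ l → Chain k w → Chain l w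
  ≈-chain [] _ _ = tt
  ≈-chain (m ∷ w) e (h , c) = ≈-⇝ e h , c

  chain-≈ : ∀ {k l} w {m} → Chain k (w ++ m ∷ []) → Chain l (w ++ m ∷ []) → k ≈ l
  chain-≈ [] (h , _) (h′ , _) = _ , h , h′
  chain-≈ (m ∷ w) (h , _) (h′ , _) = m , h , h′

  chain-first : ∀ {l} p {m} → Chain l (p ++ m ∷ []) → ∀ b → ∃ λ k → k ≈ l × pos k ≡ b
  chain-first {l} p {m} c b with chain-last (inv p) (chain-inv p c) (not b)
  ... | n , d , e = flip n ,
    chain-≈ p (chain-inv⁻ p (subst (λ n → Chain (flip m) (inv p ++ n ∷ [])) (sym (flip-flip n)) d)) c ,
    trans (pos-flip² e) (not-involutive b)

  Terminal : Letter → Set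
  Terminal l = ∀ m → ¬ l ⇝ m

  Ray : Letter → List Letter → Set
  Ray l [] = Terminal l
  Ray l (m ∷ r) = l ⇝ m × Ray m r

  ray-chain : ∀ {l} r → Ray l r → Chain l r
  ray-chain [] _ = tt
  ray-chain (_ ∷ r) (h , c) = h , ray-chain r c

  ray-drop : ∀ {l} p {m s} → Ray l (p ++ m ∷ s) → Ray m s
  ray-drop [] (_ , c) = c
  ray-drop (_ ∷ p) (_ , c) = ray-drop p c

  ray-join : ∀ {l} p {m s} → Chain l (p ++ m ∷ []) → Ray m s → Ray l (p ++ m ∷ s)
  ray-join [] (h , _) c = h , c
  ray-join (_ ∷ p) (h , c) d = h , ray-join p c d

  ≈-ray : ∀ {k l} r → k ≈ l → Ray k r → Ray l r
  ≈-ray [] (n , h , _) t = ⊥-elim (t n h)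
  ≈-ray (m ∷ w) e (h , c) = ≈-⇝ e h , c

  data Fork (r r′ : List Letter) : Set where
    fork : ∀ c {m s m′ s′} → r ≡ c ++ m ∷ s → r′ ≡ c ++ m′ ∷ s′ → pos m ≡ not (pos m′) → Fork r r′

  data ChainFork (r r′ : List Letter) : Set where
    extends : ∀ t → r′ ≡ r ++ t → ChainFork r r′
    shorter : ∀ m t → r ≡ r′ ++ m ∷ t → ChainFork r r′
    forks   : Fork r r′ → ChainFork r r′

  first-fork : ∀ {l m n} → l ⇝ m → l ⇝ n → m ≡ n ⊎ pos m ≡ not (pos n)
  first-fork {l} {m} {n} h k with pos m Bool.≟ pos n
  ... | yes e = inj₁ (succ-unique h k e)
  ... | no ¬e = inj₂ (¬-not ¬e)

  fork-∷ : ∀ {r r′} m → Fork r r′ → Fork (m ∷ r) (m ∷ r′)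
  fork-∷ m (fork c refl refl e) = fork (m ∷ c) refl refl e

  chain-fork : ∀ {l} r r′ → Chain l r → Chain l r′ → ChainFork r r′
  chain-fork [] r′ _ _ = extends r′ refl
  chain-fork (m ∷ r) [] _ _ = shorter m r refl
  chain-fork (m ∷ r) (n ∷ r′) (h , c) (k , d) with first-fork h k
  ... | inj₂ e = forks (fork [] refl refl e)
  ... | inj₁ refl with chain-fork r r′ c d
  ... | extends t refl = extends t refl
  ... | shorter n t refl = shorter n t refl
  ... | forks f = forks (fork-∷ m f)

  ray-fork : ∀ {l} r r′ → Ray l r → Ray l r′ → r ≡ r′ ⊎ Fork r r′
  ray-fork [] [] _ _ = inj₁ refl
  ray-fork [] (n ∷ _) t (h , _) = ⊥-elim (t n h)
  ray-fork (n ∷ _) [] (h , _) t = ⊥-elim (t n h)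
  ray-fork (m ∷ r) (n ∷ r′) (h , c) (k , d) with first-fork h k
  ... | inj₂ e = inj₂ (fork [] refl refl e)
  ... | inj₁ refl with ray-fork r r′ c d
  ... | inj₁ refl = inj₁ refl
  ... | inj₂ f = inj₂ (fork-∷ m f)

  IsWalk : List Letter → Set
  IsWalk [] = ⊥
  IsWalk (l ∷ r) = Terminal (flip l) × Ray l r

  mark : ∀ x {l y} → IsWalk (x ++ l ∷ y) → Ray (flip l) (inv x) × Ray l y
  mark [] w = w
  mark (k ∷ x) {l} {y} (t , r) =
    subst (Ray (flip l)) (sym (inv-∷ k x)) (ray-join (inv x) (chain-inv x (chain-cut x (ray-chain _ r))) t) ,
    ray-drop x r

  unmark : ∀ x {l y} → Ray (flip l) (inv x) → Ray l y → IsWalk (x ++ l ∷ y)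
  unmark [] a b = a , b
  unmark (k ∷ x) {l} {y} a b = ray-drop (inv x) a′ , ray-join x (chain-inv⁻ x (ray-chain _ a′)) b
    where
    a′ : Ray (flip l) (inv x ++ flip k ∷ [])
    a′ = subst (Ray (flip l)) (inv-∷ k x) a

  walk-inv : ∀ {w} → IsWalk w → IsWalk (inv w)
  walk-inv {l ∷ r} (t , c) = subst IsWalk (sym (inv-cut [] r))
    (unmark (inv r) (subst (λ k → Ray k (inv (inv r))) (sym (flip-flip l)) (subst (Ray l) (sym (inv-inv r)) c)) t)

  walk-chain : ∀ x {l y} → IsWalk (x ++ l ∷ y) → Chain l y
  walk-chain x w = ray-chain _ (proj₂ (mark x w))

  chain-end : ∀ {k l} p {m n} → Chain k (p ++ m ∷ []) → Chain l (p ++ n ∷ []) → tgt k ≡ tgt l →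
              tgt (flip m) ≡ tgt (flip n)
  chain-end [] (h , _) (h′ , _) e = trans (sym (⇝-tgt h)) (trans e (⇝-tgt h′))
  chain-end (_ ∷ p) (_ , c) (_ , c′) _ = chain-end p c c′ refl

  ray-end : ∀ {l} p {m s} → Ray l p → Chain l (p ++ m ∷ s) → ⊥
  ray-end [] t (h , _) = t _ h
  ray-end (_ ∷ p) (_ , r) (_ , c) = ray-end p r c

  lastOf : Letter → List Letter → Letter
  lastOf l [] = l
  lastOf l (m ∷ c) = lastOf m c

  chain-snoc : ∀ {l} c {m} → Chain l c → lastOf l c ⇝ m → Chain l (c ++ m ∷ [])
  chain-snoc [] _ h = h , tt
  chain-snoc (_ ∷ c) (k , d) h = k , chain-snoc c d h

  ray-stop : ∀ {l} c → Chain l c → Terminal (lastOf l c) → Ray l c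
  ray-stop [] _ t = t
  ray-stop (_ ∷ c) (k , d) t = k , ray-stop c d t

  -- Quotients, substrings and factors.

  Pre : Bool → List Letter → List Letter → Set
  Pre b w s = w ≡ s ⊎ ∃₂ λ m q → w ≡ s ++ m ∷ q × pos m ≡ b

  Suf : Bool → V → List Letter → V → List Letter → Set
  Suf b v w v′ s = (v ≡ v′ × w ≡ s) ⊎ ∃₂ λ p m → w ≡ p ++ m ∷ s × pos m ≡ not b × tgt m ≡ v′

  -- Cutting is iterated, so that transitivity is concatenation of cuts and recursion on a part
  -- needs no bookkeeping of positions. `part-split` recovers the form of a suffix of a prefix.
  data Cuts (R L : Letter → Set) (v : V) : List Letter → V → List Letter → Set where
    whole : ∀ {w} → Cuts R L v w v w
    cutʳ  : ∀ p {m} q {v′ s} → R m → Cuts R L v p v′ s → Cuts R L v (p ++ m ∷ q) v′ s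
    cutˡ  : ∀ p {m} q {v′ s} → L m → Cuts R L (tgt m) q v′ s → Cuts R L v (p ++ m ∷ q) v′ s

  -- For b = true the quotients of the string w from v, for b = false its substrings
  -- in the module-theoretic sense.
  Part : Bool → V → List Letter → V → List Letter → Set
  Part b = Cuts (λ m → pos m ≡ b) (λ m → pos m ≡ not b)

  Factor : V → List Letter → V → List Letter → Set
  Factor = Cuts (λ _ → ⊤) (λ _ → ⊤)

  cuts-trans : ∀ {R L v w v′ w′ v″ w″} → Cuts R L v w v′ w′ → Cuts R L v′ w′ v″ w″ → Cuts R L v w v″ w″
  cuts-trans whole P = P
  cuts-trans (cutʳ p q e P) P′ = cutʳ p q e (cuts-trans P P′)
  cuts-trans (cutˡ p q e P) P′ = cutˡ p q e (cuts-trans P P′)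

  part-factor : ∀ {b v w v′ s} → Part b v w v′ s → Factor v w v′ s
  part-factor whole = whole
  part-factor (cutʳ p q _ P) = cutʳ p q tt (part-factor P)
  part-factor (cutˡ p q _ P) = cutˡ p q tt (part-factor P)

  cuts-length : ∀ {R L v w v′ s} → Cuts R L v w v′ s → (v ≡ v′ × w ≡ s) ⊎ length s < length w
  cuts-length whole = inj₁ (refl , refl)
  cuts-length (cutʳ p q _ P) with cuts-length P
  ... | inj₁ (_ , refl) = inj₂ (cut-<ˡ p)
  ... | inj₂ h = inj₂ (ℕ.<-trans h (cut-<ˡ p))
  cuts-length (cutˡ p q _ P) with cuts-length P
  ... | inj₁ (_ , refl) = inj₂ (cut-<ʳ p)
  ... | inj₂ h = inj₂ (ℕ.<-trans h (cut-<ʳ p))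

  cuts-context : ∀ {R L v w v′ s} → Cuts R L v w v′ s → ∀ {l n} → tgt l ≡ v → Chain l (w ++ n ∷ []) →
                 ∃₂ λ l′ n′ → tgt l′ ≡ v′ × Chain l′ (s ++ n′ ∷ [])
  cuts-context whole e c = _ , _ , e , c
  cuts-context (cutʳ p q _ P) {l} e c = cuts-context P e (chain-cut p (subst (Chain l) (assoc∷ p q) c))
  cuts-context (cutˡ p q _ P) {l} e c = cuts-context P refl (chain-drop p (subst (Chain l) (assoc∷ p q) c))

  pre-part : ∀ {b v w s} → Pre b w s → Part b v w v s
  pre-part (inj₁ refl) = whole
  pre-part (inj₂ (m , q , refl , e)) = cutʳ _ q e whole

  suf-part : ∀ {b v w v′ s} → Suf b v w v′ s → Part b v w v′ s
  suf-part (inj₁ (refl , refl)) = whole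
  suf-part (inj₂ (p , m , refl , e , refl)) = cutˡ p _ e whole

  pre-cut : ∀ {b} p {m q s} → pos m ≡ b → Pre b p s → Pre b (p ++ m ∷ q) s
  pre-cut p e (inj₁ refl) = inj₂ (_ , _ , refl , e)
  pre-cut p {m} {q} {s} _ (inj₂ (n , c , refl , e)) = inj₂ (n , c ++ m ∷ q , assoc∷ s c , e)

  suf-cut : ∀ {b v} p {m q v′ s} → pos m ≡ not b → Suf b (tgt m) q v′ s → Suf b v (p ++ m ∷ q) v′ s
  suf-cut p e (inj₁ (refl , refl)) = inj₂ (p , _ , refl , e , refl)
  suf-cut p {m} _ (inj₂ (a , n , refl , e , refl)) = inj₂ (p ++ m ∷ a , n , sym (assoc∷ p a) , e , refl)

  part-split : ∀ {b v w v′ s} → Part b v w v′ s → ∃ λ u → Pre b w u × Suf b v u v′ s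
  part-split whole = _ , inj₁ refl , inj₁ (refl , refl)
  part-split (cutʳ p q e P) with part-split P
  ... | u , a , z = u , pre-cut p e a , z
  part-split (cutˡ p {m} q e P) with part-split P
  ... | u , inj₁ refl , z = p ++ m ∷ u , inj₁ refl , suf-cut p e z
  ... | u , inj₂ (n , c , refl , e′) , z = p ++ m ∷ u , inj₂ (n , c , sym (assoc∷ p u) , e′) , suf-cut p e z

  -- Where a part of `p ++ m ∷ q` lies relative to m. `inˡ` and `inˡˡ` are kept apart for
  -- `memoryless`, where the sign of m excludes the former, while the latter is treated by
  -- greediness at the letter n.
  data Crossing (b : Bool) (v : V) (p : List Letter) (m : Letter) (q : List Letter)
                (v′ : V) (s : List Letter) : Set where
    inˡ  : pos m ≡ b → Part b v p v′ s → Crossing b v p m q v′ s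
    inˡˡ : ∀ a n c → p ≡ a ++ n ∷ c → pos n ≡ b → Part b v a v′ s → Crossing b v p m q v′ s
    inʳ  : Part b (tgt m) q v′ s → Crossing b v p m q v′ s
    over : ∀ p′ q′ → s ≡ p′ ++ m ∷ q′ → Suf b v p v′ p′ → Pre b q q′ → Crossing b v p m q v′ s

  crossing : ∀ {b v w v′ s} p m q → Part b v w v′ s → w ≡ p ++ m ∷ q → Crossing b v p m q v′ s
  crossing p m q whole refl = over p q refl (inj₁ (refl , refl)) (inj₁ refl)
  crossing p m q (cutʳ p₁ {m₁} q₁ e P) eq with cmp p₁ p eq
  ... | same refl refl refl = inˡ e P
  ... | after c refl refl = inˡˡ p₁ m₁ c refl e P
  ... | before c refl refl with crossing p m c P refl
  ... | inˡ e′ P′ = inˡ e′ P′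
  ... | inˡˡ a n d h e′ P′ = inˡˡ a n d h e′ P′
  ... | inʳ P′ = inʳ (cutʳ c q₁ e P′)
  ... | over p′ q′ h z a = over p′ q′ h z (pre-cut c e a)
  crossing {v = v} p m q (cutˡ p₁ {m₁} q₁ e P) eq with cmp p₁ p eq
  ... | same refl refl refl = inʳ P
  ... | before c refl refl = inʳ (cutˡ c q₁ e P)
  ... | after c refl refl with crossing c m q P refl
  ... | inˡ e′ P′ = inˡ e′ (cutˡ p₁ c e P′)
  ... | inˡˡ a n d refl e′ P′ = inˡˡ (p₁ ++ m₁ ∷ a) n d (sym (assoc∷ p₁ a)) e′ (cutˡ p₁ a e P′)
  ... | inʳ P′ = inʳ P′
  ... | over p′ q′ h z a = over p′ q′ h (suf-cut p₁ e z) a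

  part-inv : ∀ {b v w v′ s} → Part b v w v′ s → ∀ {l n} → tgt l ≡ v → Chain l (w ++ n ∷ []) →
             ∃₂ λ l′ n′ → tgt l′ ≡ v′ × Chain l′ (s ++ n′ ∷ []) ×
               Part b (tgt (flip n)) (inv w) (tgt (flip n′)) (inv s)
  part-inv whole e c = _ , _ , e , c , whole
  part-inv {b} {v} (cutʳ p {m} q h P) {l} {n} e c
    with part-inv P e (chain-cut p (subst (Chain l) (assoc∷ p q) c))
  ... | l′ , n′ , e′ , c′ , P′ = l′ , n′ , e′ , c′ ,
    subst (λ w → Part b _ w _ _) (sym (inv-cut p q)) (cutˡ (inv q) (inv p) (pos-flip² h) P′)
  part-inv {b} {v} (cutˡ p {m} q h P) {l} {n} e c
    with part-inv P refl (chain-drop p (subst (Chain l) (assoc∷ p q) c))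
  ... | l′ , n′ , e′ , c′ , P′ = l′ , n′ , e′ , c′ ,
    subst (λ w → Part b _ w _ _) (sym (inv-cut p q))
      (cutʳ (inv q) (inv p) (trans (pos-flip² h) (not-involutive b)) P′)

  module _ {R L : Letter → Set} (R? : ∀ m → Dec (R m)) (L? : ∀ m → Dec (L m))
    {P : V → List Letter → Set} (P? : ∀ v w → Dec (P v w)) where

    private
      cuts-go : ∀ v w → Acc _<_ (length w) → Dec (∃₂ λ v′ s → Cuts R L v w v′ s × P v′ s)
      cuts-go v w (acc rs) with P? v w
      ... | yes h = yes (v , w , whole , h)
      ... | no ¬h with split? {P = λ p m q →
              (R m × ∃₂ λ v′ s → Cuts R L v p v′ s × P v′ s)
              ⊎ (L m × ∃₂ λ v′ s → Cuts R L (tgt m) q v′ s × P v′ s)} w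
              (λ { p m q refl →
                (R? m ×-dec cuts-go v p (rs (cut-<ˡ p))) ⊎-dec (L? m ×-dec cuts-go (tgt m) q (rs (cut-<ʳ p))) })
      ... | yes (p , m , q , refl , inj₁ (e , v′ , s , Q , h)) = yes (v′ , s , cutʳ p q e Q , h)
      ... | yes (p , m , q , refl , inj₂ (e , v′ , s , Q , h)) = yes (v′ , s , cutˡ p q e Q , h)
      ... | no ¬k = no λ where
        (_ , _ , whole , h) → ¬h h
        (v′ , s , cutʳ p q e Q , h) → ¬k (p , _ , q , refl , inj₁ (e , v′ , s , Q , h))
        (v′ , s , cutˡ p q e Q , h) → ¬k (p , _ , q , refl , inj₂ (e , v′ , s , Q , h))

    cuts? : ∀ v w → Dec (∃₂ λ v′ s → Cuts R L v w v′ s × P v′ s)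
    cuts? v w = cuts-go v w (<-wellFounded _)

  module _ {P : V → List Letter → Set} (P? : ∀ v w → Dec (P v w)) where

    factor? : ∀ v w → Dec (∃₂ λ v′ s → Factor v w v′ s × P v′ s)
    factor? = cuts? (λ _ → yes tt) (λ _ → yes tt) P?

    private
      shortest : ∀ v w → Acc _<_ (length w) → P v w →
        ∃₂ λ v′ s → Factor v w v′ s × P v′ s × (∀ {v″ t} → Factor v′ s v″ t → P v″ t → v′ ≡ v″ × s ≡ t)
      shortest v w (acc rs) h
        with cuts? (λ _ → yes tt) (λ _ → yes tt) (λ v′ s → P? v′ s ×-dec (length s ℕ.<? length w)) v w
      ... | yes (v′ , s , Q , k , l) with shortest v′ s (rs l) k
      ... | v″ , t , Q′ , rest = v″ , t , cuts-trans Q Q′ , rest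
      shortest v w (acc rs) h | no ¬k = v , w , whole , h , least
        where
        least : ∀ {v″ t} → Factor v w v″ t → P v″ t → v ≡ v″ × w ≡ t
        least Q k with cuts-length Q
        ... | inj₁ e = e
        ... | inj₂ l = ⊥-elim (¬k (_ , _ , Q , k , l))

    minimal-factor : ∀ {v w} → P v w →
      ∃₂ λ v′ s → Factor v w v′ s × P v′ s × (∀ {v″ t} → Factor v′ s v″ t → P v″ t → v′ ≡ v″ × s ≡ t)
    minimal-factor {v} {w} = shortest v w (<-wellFounded _)

  module _ {P : V → List Letter → Set} (P? : ∀ v w → Dec (P v w)) (b : Bool) where

    part? : ∀ v w → Dec (∃₂ λ v′ s → Part b v w v′ s × P v′ s)
    part? = cuts? (λ m → pos m Bool.≟ b) (λ m → pos m Bool.≟ not b) P?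

    -- Minimality is asked for cuts at a single letter; this is what turns into greediness in
    -- `simple-sub` and `cosimple-quotient`.
    record Minimal (v : V) (w : List Letter) : Set where
      constructor minimal
      field
        {v′}   : V
        s      : List Letter
        part   : Part b v w v′ s
        holds  : P v′ s
        notʳ   : ∀ p {m} q → s ≡ p ++ m ∷ q → pos m ≡ b → ¬ P v′ p
        notˡ   : ∀ p {m} q → s ≡ p ++ m ∷ q → pos m ≡ not b → ¬ P (tgt m) q

    private
      min-go : ∀ v w → Acc _<_ (length w) → P v w → Minimal v w
      min-go v w (acc rs) h with split? {P = λ p m q →
              (pos m ≡ b × P v p) ⊎ (pos m ≡ not b × P (tgt m) q)} w
              (λ { p m q refl →
                ((pos m Bool.≟ b) ×-dec P? v p) ⊎-dec ((pos m Bool.≟ not b) ×-dec P? (tgt m) q) })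
      ... | yes (p , m , q , refl , inj₁ (e , k)) with min-go v p (rs (cut-<ˡ p)) k
      ... | minimal s Q j f g = minimal s (cutʳ p q e Q) j f g
      min-go v w (acc rs) h | yes (p , m , q , refl , inj₂ (e , k)) with min-go (tgt m) q (rs (cut-<ʳ p)) k
      ... | minimal s Q j f g = minimal s (cutˡ p q e Q) j f g
      min-go v w (acc rs) h | no ¬k = minimal w whole h
        (λ p q eq e k → ¬k (p , _ , q , eq , inj₁ (e , k)))
        (λ p q eq e k → ¬k (p , _ , q , eq , inj₂ (e , k)))

    minimal-part : ∀ v w → P v w → Minimal v w
    minimal-part v w = min-go v w (<-wellFounded _)

  -- The vertex is the source of the string, needed if there are no letters.
  Class : Set
  Class = V → List Letter → Bool

  -- `quotʳ`, `quotˡ` and `cat` are asked of all words, which spares every cut a chain hypothesis.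
  -- For `inversion` the chain supplies the source of the inverse word.
  record Closed (T : Class) : Set where
    field
      quotʳ     : ∀ {v} p {m} q → T v (p ++ m ∷ q) ≡ true → pos m ≡ true → T v p ≡ true
      quotˡ     : ∀ {v} p {m} q → T v (p ++ m ∷ q) ≡ true → pos m ≡ false → T (tgt m) q ≡ true
      cat       : ∀ {v} p {m} q → T v p ≡ true → T (tgt m) q ≡ true → T v (p ++ m ∷ q) ≡ true
      inversion : ∀ {l} p {m} → Chain l (p ++ m ∷ []) → T (tgt l) p ≡ T (tgt (flip m)) (inv p)

    -- For b = false: whichever way m points, one of the two pieces is a quotient of the whole, so
    -- the whole cannot lie in T.
    both : ∀ {v} p {m} q {b} → T v p ≡ b → T (tgt m) q ≡ b → T v (p ++ m ∷ q) ≡ b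
    both p q {true} e f = cat p q e f
    both {v} p {m} q {false} e f with bool? (T v (p ++ m ∷ q)) | bool? (pos m)
    ... | inj₂ h | _ = h
    ... | inj₁ h | inj₁ k = t≢f (quotʳ p q h k) e
    ... | inj₁ h | inj₂ k = t≢f (quotˡ p q h k) f

    quotient : ∀ {v w v′ s} → Part true v w v′ s → T v w ≡ true → T v′ s ≡ true
    quotient whole h = h
    quotient (cutʳ p q e P) h = quotient P (quotʳ p q h e)
    quotient (cutˡ p q e P) h = quotient P (quotˡ p q h e)

  -- The left perpendicular class: the members of T without a quotient in B. It is used with three
  -- choices of B: the bottom substrings of a list of walks, a single string up to inversion, and
  -- the strings that are torsion-free for two classes. `B-sub` and `B-subˡ`, which keep in B those
  -- substrings that lie in T, serve for closure under concatenation.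
  module Perp (T : Class) (closed : Closed T) {B : V → List Letter → Set} (B? : ∀ v w → Dec (B v w))
    (B-inv : ∀ {l} p {m} → Chain l (p ++ m ∷ []) → B (tgt l) p → B (tgt (flip m)) (inv p))
    (B-sub : ∀ {v} p {m} q → B v (p ++ m ∷ q) → pos m ≡ true → T (tgt m) q ≡ true → B (tgt m) q)
    (B-subˡ : ∀ {v} p {m} q → B v (p ++ m ∷ q) → pos m ≡ false → T v p ≡ true → B v p) where
    open Closed closed

    abstract
      perp : Class
      perp v w = T v w && not (does (part? B? true v w))

      perp-⊆ : ∀ {v w} → perp v w ≡ true → T v w ≡ true
      perp-⊆ h = proj₁ (∧-true h)

      perp-avoids : ∀ {v w v′ s} → perp v w ≡ true → Part true v w v′ s → ¬ B v′ s
      perp-avoids {v} {w} h P b = does-false (part? B? true v w) (not-true (proj₂ (∧-true {T v w} h))) (_ , _ , P , b)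

      perp-intro : ∀ {v w} → T v w ≡ true → (∀ {v′ s} → Part true v w v′ s → ¬ B v′ s) → perp v w ≡ true
      perp-intro {v} {w} h f rewrite h | false-does (part? B? true v w) (λ (_ , _ , P , b) → f P b) = refl

      perp-false : ∀ {v w} → perp v w ≡ false → T v w ≡ true → ∃₂ λ v′ s → Part true v w v′ s × B v′ s
      perp-false {v} {w} h t with part? B? true v w
      ... | yes k = k
      ... | no ¬k rewrite t with () ← h

    private
      inv-half : ∀ {l} p {m} → Chain l (p ++ m ∷ []) → perp (tgt l) p ≡ true → perp (tgt (flip m)) (inv p) ≡ true
      inv-half {l} p {m} c h = perp-intro (trans (sym (inversion p c)) (perp-⊆ h)) λ {_} {s} P b →
        let (l′ , n′ , e , d , Q) = part-inv P refl (chain-inv p c)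
        in perp-avoids h
             (subst₂ (λ k w → Part true (tgt k) w (tgt (flip n′)) (inv s)) (flip-flip l) (inv-inv p) Q)
             (B-inv s d (subst (λ v → B v s) (sym e) b))

    perp-closed : Closed perp
    perp-closed = record
      { quotʳ = λ p q h e → perp-intro (quotʳ p q (perp-⊆ h) e) (λ P → perp-avoids h (cutʳ p q e P))
      ; quotˡ = λ p q h e → perp-intro (quotˡ p q (perp-⊆ h) e) (λ P → perp-avoids h (cutˡ p q e P))
      ; cat = λ p q h k → perp-intro (cat p q (perp-⊆ h) (perp-⊆ k)) (crossed p q h k)
      ; inversion = λ {l} p {m} c → bool-ext (inv-half p c) λ h →
          subst₂ (λ k w → perp (tgt k) w ≡ true) (flip-flip l) (inv-inv p) (inv-half (inv p) (chain-inv p c) h)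
      }
      where
      crossed : ∀ {v} p {m} q → perp v p ≡ true → perp (tgt m) q ≡ true →
                ∀ {v′ s} → Part true v (p ++ m ∷ q) v′ s → ¬ B v′ s
      crossed p {m} q h k P b with crossing p m q P refl
      ... | inˡ _ P′ = perp-avoids h P′ b
      ... | inˡˡ a n c refl e P′ = perp-avoids h (cutʳ a c e P′) b
      ... | inʳ P′ = perp-avoids k P′ b
      -- The piece of the offending quotient on the side to which m points is a substring of it and
      -- a quotient of q or of p. So it lies in T, hence in B, although `perp` holds of q and of p.
      ... | over p′ q′ refl z a with bool? (pos m)
      ... | inj₁ e = perp-avoids k (pre-part a) (B-sub p′ q′ b e (quotient (pre-part a) (perp-⊆ k)))
      ... | inj₂ e = perp-avoids h (suf-part z) (B-subˡ p′ q′ b e (quotient (suf-part z) (perp-⊆ h)))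

  -- b = false: top substrings, b = true: bottom substrings.
  record Occ (b : Bool) (w : List Letter) (v : V) (s : List Letter) : Set where
    constructor occ
    field
      x     : List Letter
      {l m} : Letter
      y     : List Letter
      reads : w ≡ x ++ l ∷ s ++ m ∷ y
      at    : tgt l ≡ v
      signˡ : pos l ≡ b
      signʳ : pos m ≡ not b

  occ? : ∀ b w v s → Dec (Occ b w v s)
  occ? b w v s = map′
    (λ { (x , l , _ , refl , at , i , s′ , m , y , refl , j , refl) → occ x y refl at i j })
    (λ { (occ x {l} {m} y refl at i j) → x , l , _ , refl , at , i , s , m , y , refl , j , refl })
    (split? w λ x l r _ → (tgt l ≟ⱽ v) ×-dec (pos l Bool.≟ b) ×-dec
      split? r λ s′ m y _ → (pos m Bool.≟ not b) ×-dec ≡-dec _≟_ s′ s)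

  occ-context : ∀ {b w v s} → IsWalk w → (o : Occ b w v s) → Chain (Occ.l o) (s ++ Occ.m o ∷ [])
  occ-context {s = s} h (occ x y refl _ _ _) = chain-cut s (walk-chain x h)

  occ-part : ∀ {b w v s v′ s′} → Occ b w v s → Part (not b) v s v′ s′ → Occ b w v′ s′
  occ-part o whole = o
  occ-part (occ x {l} {m} y refl e i j) (cutʳ p {n} q k P) =
    occ-part (occ x (q ++ m ∷ y) (cong (λ u → x ++ l ∷ u) (assoc∷ p q)) e i k) P
  occ-part {b} (occ x {l} {m} y refl e i j) (cutˡ p {n} q k P) =
    occ-part (occ (x ++ l ∷ p) y (trans (cong (λ u → x ++ l ∷ u) (assoc∷ p q)) (sym (assoc∷ x p)))
      refl (trans k (not-involutive b)) j) P

  occ-inv : ∀ {b w v s} → IsWalk w → Occ b w v s → ∀ {l m} → tgt l ≡ v → Chain l (s ++ m ∷ []) →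
            Occ b (inv w) (tgt (flip m)) (inv s)
  occ-inv {b} {s = s} h o@(occ x {l} {m} y refl refl i j) e c =
    occ (inv y) (inv x) (inv-cut₂ x s y) (chain-end s (occ-context h o) c (sym e))
      (trans (pos-flip² j) (not-involutive b)) (pos-flip² i)

  -- Greedy rays and compatible walks.

  record Greedy (T : Class) (v : V) (r : List Letter) : Set where
    constructor greedy
    field turn : ∀ p {m} s → r ≡ p ++ m ∷ s → T v p ≡ pos m
  open Greedy public

  greedy-[] : ∀ {T v} → Greedy T v []
  greedy-[] = greedy λ p s e → snoc≢[] p e

  greedy-take : ∀ {T v} a {b} → Greedy T v (a ++ b) → Greedy T v a
  greedy-take a {b} g = greedy λ { p {m} s refl → turn g p (s ++ b) (++-assoc p (m ∷ s) b) }

  greedy-snoc : ∀ {T v} p {m} → Greedy T v p → T v p ≡ pos m → Greedy T v (p ++ m ∷ [])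
  greedy-snoc {T} {v} p {m} g h = greedy λ a s e → at a s e (cmp p a e)
    where
    at : ∀ a {n} s → p ++ m ∷ [] ≡ a ++ n ∷ s → Cmp p m [] a n s → T v a ≡ pos n
    at a s _ (same refl refl _) = h
    at a s _ (after c _ e) = snoc≢[] c e
    at a s _ (before c e _) = turn g a c e

  greedy-no-fork : ∀ {T v r r′} → Greedy T v r → Greedy T v r′ → ¬ Fork r r′
  greedy-no-fork g g′ (fork c refl refl e) = b≢notb (trans (trans (sym (turn g′ c _ refl)) (turn g c _ refl)) e)

  greedy-ray-unique : ∀ {T l r r′} → Ray l r → Greedy T (tgt l) r → Ray l r′ → Greedy T (tgt l) r′ → r ≡ r′
  greedy-ray-unique {r = r} {r′} a g a′ g′ with ray-fork r r′ a a′
  ... | inj₁ e = e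
  ... | inj₂ f = ⊥-elim (greedy-no-fork g g′ f)

  greedy-follow : ∀ {T l r} c → Ray l r → Greedy T (tgt l) r → Chain l c → Greedy T (tgt l) c →
                  ∃ λ t → r ≡ c ++ t
  greedy-follow {r = r} c a g d g′ with chain-fork c r d (ray-chain r a)
  ... | extends t e = t , e
  ... | shorter m t refl = ⊥-elim (ray-end r a d)
  ... | forks f = ⊥-elim (greedy-no-fork g′ g f)

  Good : Class → Set
  Good T = ∀ l → ∃ λ r → Ray l r × Greedy T (tgt l) r

  good-of-bounded : ∀ {T} M l → (∀ c → Chain l c → Greedy T (tgt l) c → length c ≤ M) →
                    ∃ λ r → Ray l r × Greedy T (tgt l) r
  good-of-bounded {T} M l bound = go (suc M) [] tt greedy-[] (ℕ.m≤m+n (suc M) 0)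
    where
    go : ∀ k c → Chain l c → Greedy T (tgt l) c → M < k + length c → ∃ λ r → Ray l r × Greedy T (tgt l) r
    go zero c d g h = contradiction (bound c d g) (ℕ.<⇒≱ h)
    go (suc k) c d g h with continues? (lastOf l c)
    ... | no t = c , ray-stop c d (λ m j → t (m , j)) , g
    ... | yes (_ , j) with succ j (T (tgt l) c)
    ... | n , j′ , e = go k (c ++ n ∷ []) (chain-snoc c d j′) (greedy-snoc c g (sym e))
      (subst (M <_) (trans (sym (ℕ.+-suc k (length c)))
        (cong (k +_) (sym (trans (length-cut c) (cong suc (ℕ.+-identityʳ _)))))) h)

  Compatible : Class → List Letter → Set
  Compatible T w = ∀ {b v s} → Occ b w v s → T v s ≡ not b

  Distinguished : Class → List Letter → Letter → List Letter → Set
  Distinguished T x l y = Greedy T (tgt (flip l)) (inv x) × Greedy T (tgt l) y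

  module _ {T : Class} (closed : Closed T) where
    open Closed closed

    greedyˡ : ∀ {x l} a {m} c → Greedy T (tgt (flip l)) (inv x) → x ≡ a ++ m ∷ c → Chain m (c ++ l ∷ []) →
              T (tgt m) c ≡ not (pos m)
    greedyˡ a {m} c g refl d = trans (inversion c d) (trans (turn g (inv c) (inv a) (inv-cut a c)) (pos-flip m))

    -- If the letter lies outside the occurrence, greediness gives the memberships of two strings
    -- that differ by the occurrence and one more letter, and closure gives that of the occurrence.
    -- If the letter lies inside, both pieces of the occurrence have the same membership, and `both`
    -- applies.
    distinguished-compatible : ∀ x {l} y → IsWalk (x ++ l ∷ y) → Distinguished T x l y → Compatible T (x ++ l ∷ y)
    distinguished-compatible x {l} y h (g , g′) {b} {_} {s} (occ x′ {m} {n} y′ e refl i j) with cmp x x′ e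
    ... | same refl refl refl = trans (turn g′ s y′ refl) j
    ... | after c refl refl = right b i j
      where
      before-m : T (tgt l) c ≡ pos m
      before-m = turn g′ c (s ++ n ∷ y′) refl
      before-n : T (tgt l) (c ++ m ∷ s) ≡ pos n
      before-n = turn g′ (c ++ m ∷ s) y′ (sym (assoc∷ c s))
      right : ∀ b → pos m ≡ b → pos n ≡ not b → T (tgt m) s ≡ not b
      right false i j = quotˡ c s (trans before-n j) i
      right true i j with bool? (T (tgt m) s)
      ... | inj₂ k = k
      ... | inj₁ k = t≢f (cat c s (trans before-m i) k) (trans before-n j)
    ... | before c refl e′ with cmp s c e′
    ... | same refl refl refl = trans (greedyˡ x′ s g refl (chain-cut s (walk-chain x′ (subst IsWalk e h)))) (cong not i)
    ... | before d refl refl = both c d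
        (trans (greedyˡ x′ c g refl (chain-cut c (walk-chain x′ (subst IsWalk (assoc∷ x′ c) h)))) (cong not i))
        (trans (turn g′ d y′ refl) j)
    ... | after d refl refl = left b i j
      where
      ch : Chain m ((s ++ n ∷ d) ++ l ∷ y)
      ch = walk-chain x′ (subst IsWalk (assoc∷ x′ (s ++ n ∷ d)) h)
      after-m : T (tgt m) (s ++ n ∷ d) ≡ not (pos m)
      after-m = greedyˡ x′ (s ++ n ∷ d) g refl (chain-cut (s ++ n ∷ d) ch)
      after-n : T (tgt n) d ≡ not (pos n)
      after-n = greedyˡ (x′ ++ m ∷ s) d g (sym (assoc∷ x′ s))
        (chain-cut d (chain-drop s (subst (Chain m) (assoc∷ s d) ch)))
      left : ∀ b → pos m ≡ b → pos n ≡ not b → T (tgt m) s ≡ not b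
      left false i j = quotʳ s d (trans after-m (cong not i)) j
      left true i j with bool? (T (tgt m) s)
      ... | inj₂ k = k
      ... | inj₁ k = t≢f (cat s d k (trans after-n (cong not j))) (trans after-m (cong not i))

    -- At each letter, the piece which is a quotient of s lies in T and the piece which is a
    -- substring does not. Written as greediness from both ends, this makes a greedy walk that
    -- enters s follow it to its end.
    record Simple (v : V) (s : List Letter) : Set where
      field
        holds : T v s ≡ true
        right : Greedy T v s
        left  : ∀ p {m} q → s ≡ p ++ m ∷ q → T (tgt m) q ≡ not (pos m)

    simple-sub : ∀ v s → T v s ≡ true → ∃₂ λ v′ q → Part false v s v′ q × Simple v′ q
    simple-sub v s h with minimal-part (λ v s → T v s Bool.≟ true) false v s h
    ... | minimal q P k nr nl = _ , q , P , record
      { holds = k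
      ; right = greedy λ p {m} r e → right p m r e (bool? (pos m))
      ; left  = λ p {m} r e → left p m r e (bool? (pos m))
      }
      where
      right : ∀ p m r → q ≡ p ++ m ∷ r → _ → T _ p ≡ pos m
      right p m r refl (inj₁ i) = trans (quotʳ p r k i) (sym i)
      right p m r e (inj₂ i) = trans (¬-not (nr p r e i)) (sym i)
      left : ∀ p m r → q ≡ p ++ m ∷ r → _ → T (tgt m) r ≡ not (pos m)
      left p m r e (inj₁ i) = trans (¬-not (nl p r e i)) (cong not (sym i))
      left p m r refl (inj₂ i) = trans (quotˡ p r k i) (cong not (sym i))

    -- The same conditions at the letters of a string outside T; they make it torsion-free, by
    -- `cosimple-sub`.
    record Cosimple (v : V) (s : List Letter) : Set where
      field
        fails : T v s ≡ false
        right : Greedy T v s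
        left  : ∀ p {m} q → s ≡ p ++ m ∷ q → T (tgt m) q ≡ not (pos m)

    cosimple-quotient : ∀ v s → T v s ≡ false → ∃₂ λ v′ q → Part true v s v′ q × Cosimple v′ q
    cosimple-quotient v s h with minimal-part (λ v s → T v s Bool.≟ false) true v s h
    ... | minimal q P k nr nl = _ , q , P , record
      { fails = k
      ; right = greedy λ p {m} r e → right p m r e (bool? (pos m))
      ; left  = λ p {m} r e → left p m r e (bool? (pos m))
      }
      where
      right : ∀ p m r → q ≡ p ++ m ∷ r → _ → T _ p ≡ pos m
      right p m r e (inj₁ i) = trans (¬-not (nr p r e i)) (sym i)
      right p m r refl (inj₂ i) with bool? (T _ p)
      ... | inj₂ f = trans f (sym i)
      ... | inj₁ t = t≢f (cat p r t (¬-not (nl p r refl i))) k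
      left : ∀ p m r → q ≡ p ++ m ∷ r → _ → T (tgt m) r ≡ not (pos m)
      left p m r e (inj₂ i) = trans (¬-not (nl p r e i)) (cong not (sym i))
      left p m r refl (inj₁ i) with bool? (T (tgt m) r)
      ... | inj₂ f = trans f (cong not (sym i))
      ... | inj₁ t = t≢f (cat p r (¬-not (nr p r refl i)) t) k

    module _ (good : Good T) where

      greedy-walk : ∀ l → ∃₂ λ x y → IsWalk (x ++ l ∷ y) × Distinguished T x l y
      greedy-walk l with good (flip l) | good l
      ... | a , ra , ga | r , rr , gr = inv a , r ,
        unmark (inv a) (subst (Ray (flip l)) (sym (inv-inv a)) ra) rr ,
        subst (Greedy T (tgt (flip l))) (sym (inv-inv a)) ga , gr

      -- The greedy walk through the letter before s follows s and then turns as T v s dictates.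
      realise : ∀ {k} s {n} b → Chain k (s ++ n ∷ []) → Greedy T (tgt k) s → T (tgt k) s ≡ not b →
                ∃ λ w → IsWalk w × Compatible T w × Occ b w (tgt k) s
      realise {k} s {n} b c g h with chain-first s c b
      ... | l , l≈k , i with chain-last s (≈-chain (s ++ n ∷ []) (≈-sym l≈k) c) (not b)
      ... | m , d , j with greedy-walk l
      ... | x , y , wk , gl , gr with greedy-follow (s ++ m ∷ []) (proj₂ (mark x wk)) gr d
             (subst (λ v → Greedy T v (s ++ m ∷ [])) (sym (≈-tgt l≈k)) (greedy-snoc s g (trans h (sym j))))
      ... | t , refl = x ++ l ∷ (s ++ m ∷ []) ++ t , wk , distinguished-compatible x _ wk (gl , gr) ,
        occ x t (cong (λ r → x ++ l ∷ r) (snoc-assoc s)) (≈-tgt l≈k) i j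

      bottom-quotient : ∀ {k} s {n} → Chain k (s ++ n ∷ []) → T (tgt k) s ≡ false →
        ∃₂ λ v′ q → Part true (tgt k) s v′ q × ∃ λ w → IsWalk w × Compatible T w × Occ true w v′ q
      bottom-quotient {k} s c h with cosimple-quotient (tgt k) s h
      ... | v′ , q , P , Q with part-inv P refl c
      ... | l′ , n′ , refl , d , _ = _ , q , P , realise q true d (Cosimple.right Q) (Cosimple.fails Q)

      top-sub : ∀ {k} s {n} → Chain k (s ++ n ∷ []) → T (tgt k) s ≡ true →
        ∃₂ λ v′ q → Part false (tgt k) s v′ q × Simple v′ q × ∃ λ w → IsWalk w × Compatible T w × Occ false w v′ q
      top-sub {k} s c h with simple-sub (tgt k) s h
      ... | v′ , q , P , Q with part-inv P refl c
      ... | l′ , n′ , refl , d , _ = _ , q , P , Q , realise q false d (Simple.right Q) (Simple.holds Q)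

  -- The torsion class of a list of walks.

  Member : List (List Letter) → List Letter → Set
  Member ws w = Any (λ u → u ≡ w ⊎ inv u ≡ w) ws

  OccIn : Bool → List (List Letter) → V → List Letter → Set
  OccIn b ws v s = ∃ λ w → Member ws w × Occ b w v s

  NonKissing : List (List Letter) → Set
  NonKissing ws = ∀ {v s} → OccIn true ws v s → OccIn false ws v s → ⊥

  top-class : Class
  top-class _ _ = true

  top-class-closed : Closed top-class
  top-class-closed = record { quotʳ = λ _ _ _ _ → refl ; quotˡ = λ _ _ _ _ → refl
                            ; cat = λ _ _ _ _ → refl ; inversion = λ _ _ → refl }

  member-inv : ∀ {ws w} → Member ws w → Member ws (inv w)
  member-inv = Any.map λ { {u} (inj₁ refl) → inj₂ refl ; {u} (inj₂ refl) → inj₁ (sym (inv-inv u)) }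

  occIn? : ∀ b ws v s → Dec (OccIn b ws v s)
  occIn? b ws v s = map′ to from (any? (λ u → occ? b u v s ⊎-dec occ? b (inv u) v s) ws)
    where
    to : ∀ {ws} → Any (λ u → Occ b u v s ⊎ Occ b (inv u) v s) ws → OccIn b ws v s
    to (here (inj₁ o)) = _ , here (inj₁ refl) , o
    to (here (inj₂ o)) = _ , here (inj₂ refl) , o
    to (there a) with to a
    ... | w , m , o = w , there m , o
    from : ∀ {ws} → OccIn b ws v s → Any (λ u → Occ b u v s ⊎ Occ b (inv u) v s) ws
    from (w , here (inj₁ refl) , o) = here (inj₁ o)
    from (w , here (inj₂ refl) , o) = here (inj₂ o)
    from (w , there m , o) = there (from (w , m , o))

  module Torsion (ws : List (List Letter)) (walks : All IsWalk ws) where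

    member-walk : ∀ {w} → Member ws w → IsWalk w
    member-walk = go walks
      where
      go : ∀ {ws w} → All IsWalk ws → Member ws w → IsWalk w
      go (h ∷ _) (here (inj₁ refl)) = h
      go (h ∷ _) (here (inj₂ refl)) = walk-inv h
      go (_ ∷ hs) (there m) = go hs m

    occIn-inv : ∀ {b l} s {m} → Chain l (s ++ m ∷ []) → OccIn b ws (tgt l) s → OccIn b ws (tgt (flip m)) (inv s)
    occIn-inv s c (w , h , o) = inv w , member-inv h , occ-inv (member-walk h) o refl c

    private
      module P = Perp top-class top-class-closed (occIn? true ws) occIn-inv
        (λ p q (w , h , o) e _ → w , h , occ-part o (cutˡ p q e whole))
        (λ p q (w , h , o) e _ → w , h , occ-part o (cutʳ p q e whole))

    torsion : Class
    torsion = P.perp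

    torsion-closed : Closed torsion
    torsion-closed = P.perp-closed

    torsion-avoids : ∀ {v w v′ s} → torsion v w ≡ true → Part true v w v′ s → ¬ OccIn true ws v′ s
    torsion-avoids = P.perp-avoids

    torsion-intro : ∀ {v w} → (∀ {v′ s} → Part true v w v′ s → ¬ OccIn true ws v′ s) → torsion v w ≡ true
    torsion-intro = P.perp-intro refl

  -- A string of length zero reads the same in both directions.
  orient-chain : ∀ {k l} s {m n} → Chain k (s ++ m ∷ []) → Chain l (s ++ n ∷ []) → tgt k ≡ tgt l →
                 k ≈ l ⊎ (s ≡ [] × l ≈ flip m)
  orient-chain {k} {l} [] {m} {n} (h , _) (h′ , _) e with orient h h′ e
  ... | inj₁ i = inj₁ (n , i , h′)
  ... | inj₂ i = inj₂ (refl , (flip k , subst (_⇝ flip k) (flip-flip l) (⇝-flip i) , ⇝-flip h))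
  orient-chain (k ∷ s) (h , _) (h′ , _) _ = inj₁ (k , h , h′)

  -- A walk with its two distinguished letters; σ is its distinguished string, a top
  -- substring for b = false and a bottom substring for b = true.
  record Frame (b : Bool) (T : Class) : Set where
    field
      x     : List Letter
      α     : Letter
      σ     : List Letter
      β     : Letter
      y     : List Letter
      walk  : IsWalk (x ++ α ∷ σ ++ β ∷ y)
      signˡ : pos α ≡ b
      signʳ : pos β ≡ not b
      distˡ : Distinguished T x α (σ ++ β ∷ y)
      distʳ : Distinguished T (x ++ α ∷ σ) β y

    word : List Letter
    word = x ++ α ∷ σ ++ β ∷ y

    chain : Chain α (σ ++ β ∷ [])
    chain = chain-cut σ (walk-chain x walk)

    ray-α : Ray α (σ ++ β ∷ y)
    ray-α = proj₂ (mark x walk)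

    ray-β : Ray β y
    ray-β = ray-drop σ ray-α

    ray-β⁻ : Ray (flip β) (inv σ ++ flip α ∷ inv x)
    ray-β⁻ = subst (Ray (flip β)) (inv-cut x σ)
      (proj₁ (mark (x ++ α ∷ σ) (subst IsWalk (sym (assoc∷ x σ)) walk)))

    greedy-β⁻ : Greedy T (tgt (flip β)) (inv σ ++ flip α ∷ inv x)
    greedy-β⁻ = subst (Greedy T (tgt (flip β))) (inv-cut x σ) (proj₁ distʳ)

    occurrence : Occ b word (tgt α) σ
    occurrence = occ x y refl refl signˡ signʳ

    compatible : Closed T → Compatible T word
    compatible closed = distinguished-compatible closed x (σ ++ β ∷ y) walk distˡ

  rev : ∀ {b T} → Frame b T → Frame b T
  rev {b} {T} f = record
    { x = inv y ; α = flip β ; σ = inv σ ; β = flip α ; y = inv x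
    ; walk = subst IsWalk (inv-cut₂ x σ y) (walk-inv walk)
    ; signˡ = trans (pos-flip² signʳ) (not-involutive b)
    ; signʳ = pos-flip² signˡ
    ; distˡ = subst₂ (λ l → Greedy T (tgt l)) (sym (flip-flip β)) (sym (inv-inv y)) (proj₂ distʳ) , greedy-β⁻
    ; distʳ = subst₂ (λ l → Greedy T (tgt l)) (sym (flip-flip α))
                (trans (sym (inv-inv (σ ++ β ∷ y))) (cong inv (inv-cut σ y))) (proj₂ distˡ) , proj₁ distˡ
    }
    where open Frame f

  word-rev : ∀ {b T} (f : Frame b T) → Frame.word (rev f) ≡ inv (Frame.word f)
  word-rev f = sym (inv-cut₂ (Frame.x f) (Frame.σ f) (Frame.y f))

  compatible-inv : ∀ {T w} → Closed T → IsWalk w → Compatible T w → Compatible T (inv w)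
  compatible-inv {T} {w} closed wk c {b} {v} {s} o@(occ x y e refl i j) =
    trans (Closed.inversion closed s d) (c o′)
    where
    d : Chain (Occ.l o) (s ++ Occ.m o ∷ [])
    d = occ-context (walk-inv wk) o
    o′ : Occ b w (tgt (flip (Occ.m o))) (inv s)
    o′ = subst (λ u → Occ b u _ (inv s)) (inv-inv w) (occ-inv (walk-inv wk) o refl d)

  module _ {b T} (f : Frame b T) where
    open Frame f

    -- If the walk left y after β, the deviating letter would close an occurrence begun by β or by
    -- α, according to its sign. Compatibility on that occurrence contradicts greediness of the
    -- frame from β, respectively from α.
    frame-uniqueʳ : ∀ x′ y′ → IsWalk (x′ ++ α ∷ σ ++ β ∷ y′) → Compatible T (x′ ++ α ∷ σ ++ β ∷ y′) → y′ ≡ y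
    frame-uniqueʳ x′ y′ wk c with ray-fork y y′ ray-β (ray-drop σ (proj₂ (mark x′ wk)))
    ... | inj₁ e = sym e
    ... | inj₂ (fork d {m} {s} {m′} {s′} refl refl e) with pos m′ Bool.≟ b
    ... | yes h = b≢notb (trans (cong not (sym h)) (trans (sym e) (trans (sym (turn (proj₂ distʳ) d s refl)) (c o))))
      where
      o : Occ (not b) (x′ ++ α ∷ σ ++ β ∷ d ++ m′ ∷ s′) (tgt β) d
      o = occ (x′ ++ α ∷ σ) s′ (sym (assoc∷ x′ σ)) refl signʳ (trans h (sym (not-involutive b)))
    ... | no h = b≢notb (trans (sym (c o)) (trans t (trans e (cong not (¬-not h)))))
      where
      o : Occ b (x′ ++ α ∷ σ ++ β ∷ d ++ m′ ∷ s′) (tgt α) (σ ++ β ∷ d)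
      o = occ x′ s′ (cong (λ r → x′ ++ α ∷ r) (sym (assoc∷ σ d))) refl signˡ (¬-not h)
      t : T (tgt α) (σ ++ β ∷ d) ≡ pos m
      t = turn (proj₂ distˡ) (σ ++ β ∷ d) s (sym (assoc∷ σ d))

  frame-unique : ∀ {b T} → Closed T → (f : Frame b T) → ∀ {w} → IsWalk w → Compatible T w →
                 ∀ x′ y′ → w ≡ x′ ++ Frame.α f ∷ Frame.σ f ++ Frame.β f ∷ y′ → x′ ≡ Frame.x f × y′ ≡ Frame.y f
  frame-unique {T = T} closed f wk c x′ y′ refl =
    inv-inj (frame-uniqueʳ (rev f) (inv y′) (inv x′)
      (subst IsWalk e (walk-inv wk)) (subst (Compatible T) e (compatible-inv closed wk c))) ,
    frame-uniqueʳ f x′ y′ wk c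
    where
    e : inv (x′ ++ Frame.α f ∷ Frame.σ f ++ Frame.β f ∷ y′) ≡ _
    e = inv-cut₂ x′ (Frame.σ f) y′

  -- Occurrences of a distinguished string.

  Hits : ∀ {b T} → Frame b T → V → List Letter → Set
  Hits f v s = (tgt (Frame.α f) ≡ v × Frame.σ f ≡ s) ⊎ (tgt (flip (Frame.β f)) ≡ v × inv (Frame.σ f) ≡ s)

  hits-length : ∀ {b T} (f : Frame b T) {v s} → Hits f v s → length s ≡ length (Frame.σ f)
  hits-length f (inj₁ (_ , refl)) = refl
  hits-length f (inj₂ (_ , refl)) = length-inv (Frame.σ f)

  -- `Hits` only compares strings; here the side from which σ is entered is fixed as well, which
  -- matters if σ has length zero.
  Along : ∀ {b T} → Frame b T → Letter → List Letter → Set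
  Along f l s = l ≈ Frame.α f × s ≡ Frame.σ f

  orient-hit : ∀ {b T} (f : Frame b T) {l s m} → Chain l (s ++ m ∷ []) → Hits f (tgt l) s →
               Along f l s ⊎ Along (rev f) l s
  orient-hit f c (inj₁ (e , refl)) with orient-chain (Frame.σ f) (Frame.chain f) c e
  ... | inj₁ a = inj₁ (≈-sym a , refl)
  ... | inj₂ (n , a) = inj₂ (a , trans n (sym (cong inv n)))
  orient-hit f c (inj₂ (e , refl)) with orient-chain (inv (Frame.σ f)) (Frame.chain (rev f)) c e
  ... | inj₁ a = inj₂ (≈-sym a , refl)
  ... | inj₂ (n , a) = inj₁ (subst (_ ≈_) (flip-flip (Frame.α f)) a ,
                             trans n (sym (trans (sym (inv-inv (Frame.σ f))) (cong inv n))))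

  -- In a compatible walk, of two letters of the same sign exactly one makes the right
  -- greedy choice at the other; a distinguished letter does so at all of them.
  distinguished-unique : ∀ {T} → Closed T → ∀ {w} → IsWalk w → ∀ x {l} y x′ {l′} y′ →
    w ≡ x ++ l ∷ y → w ≡ x′ ++ l′ ∷ y′ → Distinguished T x l y → Distinguished T x′ l′ y′ →
    pos l ≡ pos l′ → x ≡ x′
  distinguished-unique closed wk x {l} y x′ {l′} y′ refl e (g , g′) (h , h′) p with cmp x x′ e
  ... | same e′ _ _ = e′
  ... | after c refl refl = b≢notb (trans p (trans (sym (turn g′ c y′ refl))
        (greedyˡ closed x c h refl (chain-cut c (walk-chain x wk)))))
  ... | before c refl refl = b≢notb (trans (sym p) (trans (sym (turn h′ c y refl))
        (greedyˡ closed x′ c g refl (chain-cut c (walk-chain x′ (subst IsWalk e wk))))))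

  -- By `distinguished-unique` the positive letters of the two frames would coincide, and so would
  -- the negative ones; but the two frames have them in opposite orders.
  frames-opposite : ∀ {T} → Closed T → (f : Frame false T) (g : Frame true T) → Frame.word g ≢ Frame.word f
  frames-opposite closed f g e =
    ℕ.<-asym (subst (length f.x <_) (cong length (sym p)) (cut-<ˡ f.x))
             (subst (length g.x <_) (cong length q) (cut-<ˡ g.x))
    where
    module f = Frame f
    module g = Frame g
    p : g.x ≡ f.x ++ f.α ∷ f.σ
    p = distinguished-unique closed f.walk g.x (g.σ ++ g.β ∷ g.y) (f.x ++ f.α ∷ f.σ) f.y
          (sym e) (sym (assoc∷ f.x f.σ)) g.distˡ f.distʳ (trans g.signˡ (sym f.signʳ))
    q : g.x ++ g.α ∷ g.σ ≡ f.x
    q = distinguished-unique closed f.walk (g.x ++ g.α ∷ g.σ) g.y f.x (f.σ ++ f.β ∷ f.y)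
          (trans (sym e) (sym (assoc∷ g.x g.σ))) refl g.distʳ f.distˡ (trans g.signʳ (sym f.signˡ))

  -- Write the substring as a suffix of a prefix. If both ends are cut, the piece removed on the
  -- left lies in T; were the substring in T too, `cat` would put the prefix in T, against
  -- greediness.
  cosimple-sub : ∀ {T} (closed : Closed T) {v q v′ s} → Cosimple closed v q → Part false v q v′ s → T v′ s ≡ false
  cosimple-sub closed {v} {q} C P with part-split P
  ... | u , inj₁ refl , inj₁ (refl , refl) = Cosimple.fails C
  ... | u , inj₁ refl , inj₂ (p , m , e , i , refl) = trans (Cosimple.left C p _ e) (cong not i)
  ... | u , inj₂ (m , r , e , i) , inj₁ (refl , refl) = trans (turn (Cosimple.right C) u r e) i
  ... | u , inj₂ (m , r , refl , i) , inj₂ (p , n , refl , j , refl) = ¬-not λ t →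
    t≢f (Closed.cat closed p _ (trans (turn (Cosimple.right C) p _ (assoc∷ p _)) j) t)
        (trans (turn (Cosimple.right C) (p ++ n ∷ _) r refl) i)

  -- From any string separating two classes to a distinguished one.

  module _ {T : Class} (closed : Closed T) where
    open Closed closed

    simple-inv : ∀ {α} σ {β} → Chain α (σ ++ β ∷ []) → Simple closed (tgt α) σ → Simple closed (tgt (flip β)) (inv σ)
    simple-inv {α} σ {β} c S = record
      { holds = trans (sym (inversion σ c)) (Simple.holds S)
      ; right = greedy λ p {m} s e → right p m s e (uncut e)
      ; left  = λ p {m} s e → left p m s e (uncut e)
      }
      where
      right : ∀ p m s → inv σ ≡ p ++ m ∷ s → σ ≡ inv s ++ flip m ∷ inv p → T (tgt (flip β)) p ≡ pos m
      right p m s _ refl = begin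
        T (tgt (flip β)) p               ≡⟨ cong (T (tgt (flip β))) (sym (inv-inv p)) ⟩
        T (tgt (flip β)) (inv (inv p))   ≡⟨ sym (inversion (inv p) (chain-drop (inv s) (subst (Chain α) (assoc∷ (inv s) (inv p)) c))) ⟩
        T (tgt (flip m)) (inv p)         ≡⟨ Simple.left S (inv s) (inv p) refl ⟩
        not (pos (flip m))               ≡⟨ cong not (pos-flip m) ⟩
        not (not (pos m))                ≡⟨ not-involutive (pos m) ⟩
        pos m                            ∎
        where open ≡-Reasoning
      left : ∀ p m s → inv σ ≡ p ++ m ∷ s → σ ≡ inv s ++ flip m ∷ inv p → T (tgt m) s ≡ not (pos m)
      left p m s _ refl = begin
        T (tgt m) s                              ≡⟨ cong₂ (λ l → T (tgt l)) (sym (flip-flip m)) (sym (inv-inv s)) ⟩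
        T (tgt (flip (flip m))) (inv (inv s))    ≡⟨ sym (inversion (inv s) (chain-cut (inv s) (subst (Chain α) (assoc∷ (inv s) (inv p)) c))) ⟩
        T (tgt α) (inv s)                        ≡⟨ turn (Simple.right S) (inv s) (inv p) refl ⟩
        pos (flip m)                             ≡⟨ pos-flip m ⟩
        not (pos m)                              ∎
        where open ≡-Reasoning

    frame-simple : (f : Frame false T) → Simple closed (tgt (Frame.α f)) (Frame.σ f)
    frame-simple f = record
      { holds = trans (turn (proj₂ distˡ) σ y refl) signʳ
      ; right = greedy-take σ (proj₂ distˡ)
      ; left  = λ p {m} q e → greedyˡ closed (x ++ α ∷ p) q (proj₁ distʳ)
                  (trans (cong (λ s → x ++ α ∷ s) e) (sym (assoc∷ x p)))
                  (chain-drop p (subst (Chain α) (trans (cong (_++ β ∷ []) e) (assoc∷ p q)) chain))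
      }
      where open Frame f

    hits-simple : (f : Frame false T) → ∀ {v s} → Hits f v s → Simple closed v s
    hits-simple f (inj₁ (refl , refl)) = frame-simple f
    hits-simple f (inj₂ (refl , refl)) = frame-simple (rev f)

    module Descent (good : Good T) (L : ℕ)
      (short : ∀ {w v s} → IsWalk w → Compatible T w → Occ false w v s → length s ≤ L) where

      short-simple : ∀ {α} σ {β} → Chain α (σ ++ β ∷ []) → Simple closed (tgt α) σ → length σ ≤ L
      short-simple σ c S with realise closed good σ false c (Simple.right S) (Simple.holds S)
      ... | w , wk , k , o = short wk k o

      private
        follow : ∀ {α} σ {β} → Chain α (σ ++ β ∷ []) → Simple closed (tgt α) σ → pos β ≡ true →
                 ∃ λ y → Ray α (σ ++ β ∷ y) × Greedy T (tgt α) (σ ++ β ∷ y)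
        follow {α} σ {β} c S i with good α
        ... | r , ray , g with greedy-follow (σ ++ β ∷ []) ray g c
               (greedy-snoc σ (Simple.right S) (trans (Simple.holds S) (sym i)))
        ... | t , e = t , subst (Ray α) e′ ray , subst (Greedy T (tgt α)) e′ g
          where
          e′ : r ≡ σ ++ β ∷ t
          e′ = trans e (snoc-assoc σ)

        -- If β is not distinguished in the walk following σ, then a longer string with
        -- quotient σ is simple as well.
        data Right (α : Letter) (σ : List Letter) (β : Letter) : Set where
          stop   : ∀ y → Ray α (σ ++ β ∷ y) → Greedy T (tgt α) (σ ++ β ∷ y) → Greedy T (tgt β) y → Right α σ β
          extend : ∀ ρ β′ → Chain α ((σ ++ β ∷ ρ) ++ β′ ∷ []) → pos β′ ≡ true →
                   Simple closed (tgt α) (σ ++ β ∷ ρ) → Right α σ β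

        right? : ∀ {α} σ {β} → Chain α (σ ++ β ∷ []) → Simple closed (tgt α) σ → pos β ≡ true → Right α σ β
        right? {α} σ {β} c S i with follow σ c S i | good β
        ... | y , ray , g | yβ , rayβ , gβ with ray-fork y yβ (ray-drop σ ray) rayβ
        ... | inj₁ refl = stop y ray g gβ
        ... | inj₂ (fork ρ {m} {s} {m′} {s′} refl refl e) = extend ρ m
              (subst (Chain α) (sym (assoc∷ σ ρ)) (chain-join σ c (chain-cut ρ (ray-chain _ (ray-drop σ ray)))))
              long≡ record
              { holds = trans long long≡
              ; right = greedy-take (σ ++ β ∷ ρ) (subst (Greedy T (tgt α)) (sym (assoc∷ σ ρ)) g)
              ; left  = left
              }
          where
          long : T (tgt α) (σ ++ β ∷ ρ) ≡ pos m
          long = turn g (σ ++ β ∷ ρ) s (sym (assoc∷ σ ρ))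
          tail : T (tgt β) ρ ≡ pos m′
          tail = turn gβ ρ s′ refl
          m′≡ : pos m′ ≡ not (pos m)
          m′≡ = trans (sym (not-involutive (pos m′))) (cong not (sym e))
          long≡ : pos m ≡ true
          long≡ with bool? (pos m)
          ... | inj₁ t = t
          ... | inj₂ f = t≢f (cat σ ρ (Simple.holds S) (trans tail (trans m′≡ (cong not f)))) (trans long f)
          tail-false : T (tgt β) ρ ≡ false
          tail-false = trans tail (trans m′≡ (cong not long≡))
          left : ∀ p {n} q → σ ++ β ∷ ρ ≡ p ++ n ∷ q → T (tgt n) q ≡ not (pos n)
          left p {n} q eq with cmp σ p eq | bool? (pos n)
          ... | same refl refl refl | _ = trans tail-false (cong not (sym i))
          ... | after d refl refl | inj₂ f =
            trans (quotˡ (σ ++ β ∷ d) q (trans (cong (T (tgt α)) (assoc∷ σ d)) (trans long long≡)) f) (cong not (sym f))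
          ... | after d refl refl | inj₁ t = trans (¬-not λ k →
            t≢f (cat d q (trans (turn gβ d (q ++ m′ ∷ s′) (assoc∷ d q)) t) k) tail-false) (cong not (sym t))
          ... | before d refl refl | inj₂ f =
            trans (quotˡ p (d ++ β ∷ ρ) (trans (cong (T (tgt α)) (sym (assoc∷ p d))) (trans long long≡)) f) (cong not (sym f))
          ... | before d refl refl | inj₁ t = trans (¬-not λ k →
            t≢f (quotʳ d ρ k i) (trans (Simple.left S p d refl) (cong not t))) (cong not (sym t))

      module _ {T₁ : Class} (closed₁ : Closed T₁) where

        -- Every extension has σ as a quotient, so it stays outside T₁; it is also longer, and
        -- `short-simple` bounds its length. Extensions to the left are made on the inverse. When
        -- neither side extends, both neighbours of σ are distinguished.
        maximal : ∀ k {α} σ {β} → Chain α (σ ++ β ∷ []) → Simple closed (tgt α) σ → pos α ≡ false → pos β ≡ true →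
                  T₁ (tgt α) σ ≡ false → L < k + length σ → ∃ λ (f : Frame false T) → T₁ (tgt (Frame.α f)) (Frame.σ f) ≡ false
        maximal zero σ c S _ _ _ b = contradiction (short-simple σ c S) (ℕ.<⇒≱ b)
        maximal (suc k) {α} σ {β} c S i j h b with right? σ c S j
        ... | extend ρ β′ c′ j′ S′ = maximal k (σ ++ β ∷ ρ) c′ S′ i j′
                (¬-not λ t → t≢f (Closed.quotʳ closed₁ σ ρ t j) h)
                (ℕ.<-≤-trans b (subst (_≤ k + length (σ ++ β ∷ ρ)) (ℕ.+-suc k (length σ)) (ℕ.+-monoʳ-≤ k (cut-<ˡ σ))))
        ... | stop y ray g gβ with right? (inv σ) (chain-inv σ c) (simple-inv σ c S) (pos-flip² i)
        ... | extend ρ β′ c′ j′ S′ = maximal k (inv σ ++ flip α ∷ ρ) c′ S′ (pos-flip² j) j′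
                (¬-not λ t → t≢f (Closed.quotʳ closed₁ (inv σ) ρ t (pos-flip² i)) (trans (sym (Closed.inversion closed₁ σ c)) h))
                (ℕ.<-≤-trans b (subst (_≤ k + length (inv σ ++ flip α ∷ ρ)) (ℕ.+-suc k (length σ))
                  (ℕ.+-monoʳ-≤ k (subst (_< length (inv σ ++ flip α ∷ ρ)) (length-inv σ) (cut-<ˡ (inv σ))))))
        ... | stop a ray′ g′ gα = record
          { x = inv a ; α = α ; σ = σ ; β = β ; y = y
          ; walk = unmark (inv a) (subst (Ray (flip α)) (sym (inv-inv a)) (ray-drop (inv σ) ray′)) ray
          ; signˡ = i ; signʳ = j
          ; distˡ = subst (Greedy T (tgt (flip α))) (sym (inv-inv a)) gα , g
          ; distʳ = subst (Greedy T (tgt (flip β)))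
              (trans (cong (λ z → inv σ ++ flip α ∷ z) (sym (inv-inv a))) (sym (inv-cut (inv a) σ))) g′ , gβ
          } , h

        -- A quotient of κ cosimple for T₁ is still in T, and all its substrings are outside T₁.
        -- Hence a substring of it that is simple for T still separates the two classes, and
        -- `maximal` applies to it.
        descent : ∀ {k} κ {n} → Chain k (κ ++ n ∷ []) → T (tgt k) κ ≡ true → T₁ (tgt k) κ ≡ false →
                  ∃ λ (f : Frame false T) → T₁ (tgt (Frame.α f)) (Frame.σ f) ≡ false
        descent {k} κ c t h with cosimple-quotient closed₁ (tgt k) κ h
        ... | _ , q , P , C with part-inv P refl c
        ... | k₁ , n₁ , refl , c₁ , _ with simple-sub closed (tgt k₁) q (quotient P t)
        ... | _ , σ , P′ , S with part-inv P′ refl c₁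
        ... | k₂ , n₂ , refl , c₂ , _ with chain-first σ c₂ false
        ... | α , α≈ , i with chain-last σ (≈-chain (σ ++ n₂ ∷ []) (≈-sym α≈) c₂) true
        ... | β , c₃ , j = maximal (suc L) σ c₃
          (subst (λ v → Simple closed v σ) (sym (≈-tgt α≈)) S) i j
          (subst (λ v → T₁ v σ ≡ false) (sym (≈-tgt α≈)) (cosimple-sub closed₁ C P′))
          (ℕ.m≤m+n (suc L) (length σ))

  ≈-trans : ∀ {k l m} → k ≈ l → l ≈ m → k ≈ m
  ≈-trans (n , h , h′) e = n , h , ≈-⇝ e h′

  two-suffixes : ∀ {b v p v₁ s₁ v₂ s₂} → Suf b v p v₁ s₁ → Suf b v p v₂ s₂ → length s₂ < length s₁ →
                 ∃₂ λ a n → s₁ ≡ a ++ n ∷ s₂ × pos n ≡ not b × tgt n ≡ v₂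
  two-suffixes (inj₁ (refl , refl)) (inj₁ (refl , refl)) h = contradiction h (ℕ.<-irrefl refl)
  two-suffixes (inj₁ (refl , refl)) (inj₂ (a , n , e , i , j)) _ = a , n , e , i , j
  two-suffixes {s₁ = s₁} (inj₂ (a , n , refl , i , j)) (inj₁ (refl , refl)) h =
    contradiction (ℕ.<-trans h (cut-<ʳ a)) (ℕ.<-irrefl refl)
  two-suffixes (inj₂ (a , n , refl , i , j)) (inj₂ (a′ , n′ , e , i′ , j′)) h with cmp a a′ e
  ... | same refl refl refl = contradiction h (ℕ.<-irrefl refl)
  ... | after c refl refl = c , n′ , refl , i′ , j′
  ... | before c refl refl = contradiction (ℕ.<-trans h (cut-<ʳ c)) (ℕ.<-irrefl refl)

  hits? : ∀ {b T} (f : Frame b T) v s → Dec (Hits f v s)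
  hits? f v s = ((tgt (Frame.α f) ≟ⱽ v) ×-dec ≡-dec _≟_ (Frame.σ f) s)
                ⊎-dec ((tgt (flip (Frame.β f)) ≟ⱽ v) ×-dec ≡-dec _≟_ (inv (Frame.σ f)) s)

  hits-inv : ∀ {b T} (f : Frame b T) {l} s {m} → Chain l (s ++ m ∷ []) → Hits f (tgt l) s → Hits f (tgt (flip m)) (inv s)
  hits-inv f s c (inj₁ (e , refl)) = inj₂ (chain-end s (Frame.chain f) c e , refl)
  hits-inv f s c (inj₂ (e , refl)) = inj₁
    (trans (cong tgt (sym (flip-flip (Frame.α f)))) (chain-end s (Frame.chain (rev f)) c e) , sym (inv-inv (Frame.σ f)))

  -- The flip of a torsion class at a distinguished string.

  module Flip {T : Class} (closed : Closed T) (f : Frame false T) where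
    open Closed closed
    module f = Frame f
    module f⁻ = Frame (rev f)

    private
      module P = Perp T closed (hits? f) (hits-inv f)
        (λ p q h i t → t≢f t (trans (Simple.left (hits-simple closed f h) p q refl) (cong not i)))
        (λ p q h i t → t≢f t (trans (turn (Simple.right (hits-simple closed f h)) p q refl) i))

    opaque
      T′ : Class
      T′ = P.perp

      T′-closed : Closed T′
      T′-closed = P.perp-closed

      T′-⊆ : ∀ {v w} → T′ v w ≡ true → T v w ≡ true
      T′-⊆ = P.perp-⊆

      T′-avoids : ∀ {v w v′ s} → T′ v w ≡ true → Part true v w v′ s → ¬ Hits f v′ s
      T′-avoids = P.perp-avoids

      T′-intro : ∀ {v w} → T v w ≡ true → (∀ {v′ s} → Part true v w v′ s → ¬ Hits f v′ s) → T′ v w ≡ true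
      T′-intro = P.perp-intro

      T′-false : ∀ {v w} → T′ v w ≡ false → T v w ≡ true → ∃₂ λ v′ s → Part true v w v′ s × Hits f v′ s
      T′-false = P.perp-false

    T-false : ∀ {v w} → T v w ≡ false → T′ v w ≡ false
    T-false h = ¬-not λ t → t≢f (T′-⊆ t) h

    T′-hit : ∀ {v s} → Hits f v s → T′ v s ≡ false
    T′-hit h = ¬-not λ t → T′-avoids t whole h

    hit-holds : ∀ {v s} → Hits f v s → T v s ≡ true
    hit-holds h = Simple.holds (hits-simple closed f h)

    T′-largest : ∀ {T₁} → Closed T₁ → T₁ (tgt f.α) f.σ ≡ false →
                 ∀ {v w} → T v w ≡ true → T₁ v w ≡ true → T′ v w ≡ true
    T′-largest {T₁} closed₁ h t t₁ = T′-intro t (avoid t₁)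
      where
      avoid : ∀ {v w v′ s} → T₁ v w ≡ true → Part true v w v′ s → ¬ Hits f v′ s
      avoid t₁ P (inj₁ (refl , refl)) = t≢f (Closed.quotient closed₁ P t₁) h
      avoid t₁ P (inj₂ (refl , refl)) =
        t≢f (Closed.quotient closed₁ P t₁) (trans (sym (Closed.inversion closed₁ f.σ f.chain)) h)

    -- If the quotient σ ended before the end of p, it would be a quotient of a prefix followed by a
    -- positive letter; greediness puts that prefix in T′, where σ is not allowed.
    hit-suffix : ∀ {v p v′ s} → Greedy T′ v p → Part true v p v′ s → Hits f v′ s → Suf true v p v′ s
    hit-suffix g P h with part-split P
    ... | u , inj₁ refl , z = z
    ... | u , inj₂ (m , q , e , i) , z = ⊥-elim (T′-avoids (trans (turn g u q e) i) (suf-part z) h)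

    -- Proper prefixes of σ are too short to have the quotient σ, so T and T′ agree on them, and σ
    -- is greedy for T because it is simple.
    hit-greedy : ∀ {v s} → Hits f v s → Greedy T′ v s
    hit-greedy {v} {s} h = greedy λ p {m} q e → at p m q e (bool? (pos m))
      where
      simple = hits-simple closed f h
      at : ∀ p m q → s ≡ p ++ m ∷ q → _ → T′ v p ≡ pos m
      at p m q e (inj₂ i) = trans (T-false (trans (turn (Simple.right simple) p q e) i)) (sym i)
      at p m q refl (inj₁ i) = trans (T′-intro (trans (turn (Simple.right simple) p q refl) i) avoid) (sym i)
        where
        too-long : ∀ {v′ s′} → Hits f v′ s′ → ¬ length s′ ≤ length p
        too-long h′ l = ℕ.<⇒≱ (cut-<ˡ p {m} {q}) (subst (_≤ length p) (trans (hits-length f h′) (sym (hits-length f h))) l)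
        avoid : ∀ {v′ s′} → Part true v p v′ s′ → ¬ Hits f v′ s′
        avoid P h′ with cuts-length P
        ... | inj₁ (_ , refl) = too-long h′ ℕ.≤-refl
        ... | inj₂ l = too-long h′ (ℕ.<⇒≤ l)

    -- After a turn forced by σ the rays of T′ forget what they read before.
    memoryless : ∀ {v p v′ s δ} c → Greedy T′ v p → T v p ≡ true → Suf true v p v′ s → Hits f v′ s →
                 pos δ ≡ false → T′ v (p ++ δ ∷ c) ≡ T′ (tgt δ) c
    memoryless {v} {p} {v′} {s} {δ} c g t z h i = bool-ext
      (λ t′ → Closed.quotˡ T′-closed p c t′ i)
      (λ t′ → T′-intro (cat p c t (T′-⊆ t′)) (avoid t′))
      where
      avoid : T′ (tgt δ) c ≡ true → ∀ {v″ s″} → Part true v (p ++ δ ∷ c) v″ s″ → ¬ Hits f v″ s″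
      avoid t′ P h′ with crossing p δ c P refl
      ... | inˡ j _ = t≢f j i
      ... | inˡˡ a n d e j P′ = T′-avoids (trans (turn g a d e) j) P′ h′
      ... | inʳ P′ = T′-avoids t′ P′ h′
      -- A quotient σ across δ begins with a suffix p′ of p that is also a proper suffix of the
      -- earlier σ. Simplicity of the earlier one puts p′ in T, that of the later one puts it
      -- outside T.
      ... | over p′ q′ refl z′ _ with two-suffixes z z′
              (subst (length p′ <_) (trans (hits-length f h′) (sym (hits-length f h))) (cut-<ˡ p′))
      ... | a , n , refl , j , refl = t≢f (trans (Simple.left (hits-simple closed f h) a p′ refl) (cong not j))
              (trans (turn (Simple.right (hits-simple closed f h′)) p′ q′ refl) i)

    turned-greedy : ∀ {v p v′ s δ t} → Greedy T′ v p → T v p ≡ true → T′ v p ≡ false → Suf true v p v′ s → Hits f v′ s →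
                    pos δ ≡ false → Greedy T′ (tgt δ) t → Greedy T′ v (p ++ δ ∷ t)
    turned-greedy {v} {p} {δ = δ} {t} g h h′ z k i gt = greedy λ a {n} s e → at a n s (cmp p a e)
      where
      at : ∀ a n s → Cmp p δ t a n s → T′ v a ≡ pos n
      at a n s (same refl refl _) = trans h′ (sym i)
      at a n s (after c refl e) = trans (memoryless c g h z k i) (turn gt c s e)
      at a n s (before c e _) = turn g a c e

    -- As T′ is contained in T, a T-greedy ray first fails to be T′-greedy at a positive letter,
    -- after a prefix that T′ has lost; `stray` records this place.
    data Agree (v : V) (r : List Letter) : Set where
      agree : Greedy T′ v r → Agree v r
      stray : ∀ p m t → r ≡ p ++ m ∷ t → Greedy T′ v p → T v p ≡ true → T′ v p ≡ false → pos m ≡ true → Agree v r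

    agree? : ∀ {v} r → Greedy T v r → Agree v r
    agree? {v} r g = go [] r refl greedy-[]
      where
      go : ∀ p q → r ≡ p ++ q → Greedy T′ v p → Agree v r
      go p [] e g′ = agree (subst (Greedy T′ v) (sym (trans e (++-identityʳ p))) g′)
      go p (m ∷ q) e g′ with T′ v p Bool.≟ pos m
      ... | yes h = go (p ++ m ∷ []) q (trans e (sym (snoc-assoc p))) (greedy-snoc p g′ h)
      ... | no h with bool? (pos m)
      ... | inj₁ i = stray p m q e g′ (trans (turn g p q e) i) (¬-not λ t → h (trans t (sym i))) i
      ... | inj₂ i = ⊥-elim (h (trans (T-false (trans (turn g p q e) i)) (sym i)))

    RayFrom : Letter → Set
    RayFrom k = ∃ λ r → Ray k r × Greedy T′ (tgt k) r

    record Hit (k : Letter) (p : List Letter) : Set where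
      field
        {v}    : V
        {s}    : List Letter
        suffix : Suf true (tgt k) p v s
        hits   : Hits f v s

    data Before (k : Letter) (p s : List Letter) : Letter → Set where
      first : p ≡ s → Before k p s k
      inner : ∀ a {l} → p ≡ a ++ l ∷ s → pos l ≡ false → Before k p s l

    before-letter : ∀ {k p v s} → Suf true (tgt k) p v s → ∃ λ l → tgt l ≡ v × Before k p s l
    before-letter (inj₁ (e , e′)) = _ , e , first e′
    before-letter (inj₂ (a , l , e , i , j)) = l , j , inner a e i

    before-chain : ∀ {k p s l n} → Before k p s l → Chain k (p ++ n ∷ []) → Chain l (s ++ n ∷ [])
    before-chain (first refl) c = c
    before-chain {k = k} {s = s} (inner a refl _) c = chain-drop a (subst (Chain k) (assoc∷ a s) c)

    oriented : ∀ {k p n} → Chain k (p ++ n ∷ []) → (h : Hit k p) →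
               ∃ λ l → Before k p (Hit.s h) l × (Along f l (Hit.s h) ⊎ Along (rev f) l (Hit.s h))
    oriented c record { suffix = z ; hits = h } with before-letter z
    ... | l , refl , b = l , b , orient-hit f (before-chain b c) h

    stray-hit : ∀ {k p} → Greedy T′ (tgt k) p → T (tgt k) p ≡ true → T′ (tgt k) p ≡ false → Hit k p
    stray-hit g t t′ with T′-false t′ t
    ... | v , s , P , h = record { suffix = hit-suffix g P h ; hits = h }

    module _ (good : Good T) where

      opaque
        -- Where T leaves σ by the arrow `β`, the class T′ must leave it by this inverse arrow.
        δ : ∀ (g : Frame false T) → ∃ λ n → Chain (Frame.α g) (Frame.σ g ++ n ∷ []) × pos n ≡ false
        δ g = chain-last (Frame.σ g) (Frame.chain g) false

      after-hit : ∀ (g : Frame false T) {k p s l n} → Before k p s l → Along g l s → Chain k (p ++ n ∷ []) → pos n ≡ false →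
                  n ≡ proj₁ (δ g)
      after-hit g b (a , refl) c i = chain-last-unique (Frame.σ g) (≈-chain (Frame.σ g ++ _ ∷ []) a (before-chain b c))
        (proj₁ (proj₂ (δ g))) (trans i (sym (proj₂ (proj₂ (δ g)))))

      ray-through : ∀ {k p n t} → Chain k (p ++ n ∷ []) → Greedy T′ (tgt k) p → T (tgt k) p ≡ true → T′ (tgt k) p ≡ false → (h : Hit k p) →
                    pos n ≡ false → Ray n t → Greedy T′ (tgt n) t → RayFrom k
      ray-through c g h h′ record { suffix = z ; hits = j } i ray gt =
        _ , ray-join _ c ray , turned-greedy g h h′ z j i gt

      -- `flip (δ g)` and `flip β` enter σ from the same side, so the T-greedy walk through `δ g`
      -- has the same left arm as the frame.
      walk-δ : ∀ (g : Frame false T) → ∃ λ y → IsWalk ((Frame.x g ++ Frame.α g ∷ Frame.σ g) ++ proj₁ (δ g) ∷ y)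
        × Compatible T ((Frame.x g ++ Frame.α g ∷ Frame.σ g) ++ proj₁ (δ g) ∷ y) × Greedy T (tgt (proj₁ (δ g))) y
      walk-δ g with greedy-walk closed good d
        where d = proj₁ (δ g)
      ... | X , Y , wk , gl , gr = Y , subst (λ X → IsWalk (X ++ d ∷ Y)) X≡ wk ,
        subst (λ X → Compatible T (X ++ d ∷ Y)) X≡ (distinguished-compatible closed X Y wk (gl , gr)) , gr
        where
        module g = Frame g
        d = proj₁ (δ g)
        d≈ : flip d ≈ flip g.β
        d≈ = chain-≈ (inv g.σ) (chain-inv g.σ (proj₁ (proj₂ (δ g)))) (chain-inv g.σ g.chain)
        X≡ : X ≡ g.x ++ g.α ∷ g.σ
        X≡ = inv-inj (trans
          (greedy-ray-unique (proj₁ (mark X wk)) gl (≈-ray _ (≈-sym d≈) g.ray-β⁻)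
            (subst (λ v → Greedy T v (inv g.σ ++ flip g.α ∷ inv g.x)) (sym (≈-tgt d≈)) g.greedy-β⁻))
          (sym (inv-cut g.x g.σ)))

      opaque
        -- A ray from δ g can stray only along the reverse of g, and then the right arm of g
        -- is longer than the left one; so at most one of δ f and δ (rev f) strays.
        ray-δ : ∀ (g : Frame false T) →
                (∀ {l s} → Along f l s ⊎ Along (rev f) l s → Along g l s ⊎ Along (rev g) l s) →
                RayFrom (proj₁ (δ g)) ⊎
                (length (Frame.x g) < length (Frame.y g) × (RayFrom (proj₁ (δ (rev g))) → RayFrom (proj₁ (δ g))))
        ray-δ g swap′ with walk-δ g
        ... | Y , wk , comp , gY with agree? Y gY
        ... | agree gY′ = inj₁ (Y , proj₂ (mark (g.x ++ g.α ∷ g.σ) wk) , gY′)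
          where module g = Frame g
        ... | stray p m t refl g′ tp t′p im with stray-hit g′ tp t′p
        ... | h with oriented (chain-cut p (walk-chain (Frame.x g ++ Frame.α g ∷ Frame.σ g) wk)) h
        ... | l , b , o = result (swap′ o)
          where
          module g = Frame g
          d : Letter
          d = proj₁ (δ g)
          W : List Letter
          W = (g.x ++ g.α ∷ g.σ) ++ d ∷ p ++ m ∷ t
          cp : Chain d (p ++ m ∷ [])
          cp = chain-cut p (walk-chain (g.x ++ g.α ∷ g.σ) wk)
          l-negative : ∀ {l} → Before d p (Hit.s h) l → pos l ≡ false
          l-negative (first _) = proj₂ (proj₂ (δ g))
          l-negative (inner _ _ i) = i
          position : ∀ {l} → Before d p (Hit.s h) l → ∃ λ x′ → W ≡ x′ ++ l ∷ Hit.s h ++ m ∷ t × length g.x < length x′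
          position (first e) = g.x ++ g.α ∷ g.σ , cong (λ q → (g.x ++ g.α ∷ g.σ) ++ d ∷ q ++ m ∷ t) e , cut-<ˡ g.x
          position {l} (inner a e _) = (g.x ++ g.α ∷ g.σ) ++ d ∷ a ,
            trans (cong (λ q → (g.x ++ g.α ∷ g.σ) ++ d ∷ q) (trans (cong (_++ m ∷ t) e) (assoc∷ a (Hit.s h))))
              (sym (assoc∷ (g.x ++ g.α ∷ g.σ) a)) ,
            ℕ.<-trans (cut-<ˡ g.x) (cut-<ˡ (g.x ++ g.α ∷ g.σ))
          located : ∀ (e : Frame false T) → Along e l (Hit.s h) → ∃ λ x′ → W ≡ x′ ++ Frame.α e ∷ Frame.σ e ++ Frame.β e ∷ t × length g.x < length x′
          located e (a , refl) with ≈-≡ a (trans (l-negative b) (sym (Frame.signˡ e))) | position b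
          ... | refl | x′ , q , lt with chain-last-unique (Frame.σ e) (before-chain b cp) (Frame.chain e) (trans im (sym (Frame.signʳ e)))
          ... | refl = x′ , q , lt
          result : Along g l (Hit.s h) ⊎ Along (rev g) l (Hit.s h) → RayFrom d ⊎
            (length g.x < length g.y × (RayFrom (proj₁ (δ (rev g))) → RayFrom d))
          -- The walk would contain the letters of the frame g further to the right than
          -- `frame-unique` allows.
          result (inj₁ o) with located g o
          ... | x′ , q , lt = ⊥-elim (ℕ.<-irrefl (cong length (sym (proj₁ (frame-unique closed g wk comp x′ t q)))) lt)
          result (inj₂ o) with located (rev g) o
          ... | x′ , q , lt = inj₂
            ( subst (length g.x <_) (trans (cong length (proj₁ (frame-unique closed (rev g) wk comp x′ t q))) (length-inv g.y)) lt
            , continue )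
            where
            continue : RayFrom (proj₁ (δ (rev g))) → RayFrom d
            continue (r , ray , gr) with chain-last p cp false
            ... | n , cn , i with after-hit (rev g) b o cn i
            ... | refl = ray-through cn g′ tp t′p h i ray gr

      private
        d d⁻ : Letter
        d = proj₁ (δ f)
        d⁻ = proj₁ (δ (rev f))

        d-chain : Chain f.α (f.σ ++ d ∷ [])
        d-chain = proj₁ (proj₂ (δ f))

        d⁻-chain : Chain (flip f.β) (inv f.σ ++ d⁻ ∷ [])
        d⁻-chain = proj₁ (proj₂ (δ (rev f)))

        δ-rev-rev : proj₁ (δ (rev (rev f))) ≡ d
        δ-rev-rev = chain-last-unique f.σ
          (subst₂ (λ l s → Chain l (s ++ proj₁ (δ (rev (rev f))) ∷ [])) (flip-flip f.α) (inv-inv f.σ) (proj₁ (proj₂ (δ (rev (rev f))))))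
          d-chain (trans (proj₂ (proj₂ (δ (rev (rev f))))) (sym (proj₂ (proj₂ (δ f)))))

        along-swap : ∀ {l s} → Along f l s ⊎ Along (rev f) l s → Along (rev f) l s ⊎ Along (rev (rev f)) l s
        along-swap (inj₂ o) = inj₁ o
        along-swap (inj₁ (a , e)) = inj₂ (subst (_ ≈_) (sym (flip-flip f.α)) a , trans e (sym (inv-inv f.σ)))

      opaque
        rays-δ : RayFrom d × RayFrom d⁻
        rays-δ with ray-δ f id | ray-δ (rev f) along-swap
        ... | inj₁ r | inj₁ r⁻ = r , r⁻
        ... | inj₁ r | inj₂ (_ , go) = r , go (subst RayFrom (sym δ-rev-rev) r)
        ... | inj₂ (_ , go) | inj₁ r⁻ = go r⁻ , r⁻
        ... | inj₂ (lt , _) | inj₂ (lt′ , _) =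
          contradiction (subst₂ _<_ (length-inv f.y) (length-inv f.x) lt′) (ℕ.<-asym lt)

      opaque
        -- A T-greedy ray that strays has just read σ in one of its two directions. T′ sends it on
        -- by the letter `δ` of that direction, and by `memoryless` the rest is the ray from that
        -- letter, already known to be finite by `rays-δ`.
        T′-good : Good T′
        T′-good k with good k
        ... | r , ray , g with agree? r g
        ... | agree g′ = r , ray , g′
        ... | stray p m t refl g′ tp t′p im with stray-hit g′ tp t′p
        ... | h with chain-cut p (ray-chain _ ray)
        ... | c with oriented c h | chain-last p c false
        ... | l , b , inj₁ o | n , cn , i with after-hit f b o cn i
        ... | refl = ray-through cn g′ tp t′p h i (proj₁ (proj₂ (proj₁ rays-δ))) (proj₂ (proj₂ (proj₁ rays-δ)))
        T′-good k | r , ray , g | stray p m t refl g′ tp t′p im | h | c | l , b , inj₂ o | n , cn , i with after-hit (rev f) b o cn i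
        ... | refl = ray-through cn g′ tp t′p h i (proj₁ (proj₂ (proj₂ rays-δ))) (proj₂ (proj₂ (proj₂ rays-δ)))

      private
        γ : Letter
        γ = flip d⁻

        γ≈ : γ ≈ f.α
        γ≈ = chain-≈ f.σ (subst₂ (λ s l → Chain γ (s ++ l ∷ [])) (inv-inv f.σ) (flip-flip f.β) (chain-inv (inv f.σ) d⁻-chain)) f.chain

        d≈ : flip d ≈ flip f.β
        d≈ = chain-≈ (inv f.σ) (chain-inv f.σ d-chain) (chain-inv f.σ f.chain)

        hit : Hits f (tgt γ) f.σ
        hit = inj₁ (sym (≈-tgt γ≈) , refl)

        hit⁻ : Hits f (tgt (flip d)) (inv f.σ)
        hit⁻ = inj₂ (sym (≈-tgt d≈) , refl)

      private
        y′ a′ : List Letter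
        y′ = proj₁ (proj₁ rays-δ)
        a′ = proj₁ (proj₂ rays-δ)

      -- The walk exchanged for that of f: σ prolonged on both sides by the rays of `rays-δ`.
      -- Reading σ itself is the forced turn to which `turned-greedy` is applied, once in each
      -- direction.
      flipped : Frame true T′
      flipped = record
        { x = inv a′ ; α = γ ; σ = f.σ ; β = d ; y = y′
        ; walk = unmark (inv a′) (subst₂ Ray (sym (flip-flip d⁻)) (sym (inv-inv a′)) (proj₁ (proj₂ (proj₂ rays-δ))))
            (ray-join f.σ (≈-chain (f.σ ++ d ∷ []) (≈-sym γ≈) d-chain) (proj₁ (proj₂ (proj₁ rays-δ))))
        ; signˡ = pos-flip² (proj₂ (proj₂ (δ (rev f)))) ; signʳ = proj₂ (proj₂ (δ f))
        ; distˡ = subst₂ (λ l → Greedy T′ (tgt l)) (sym (flip-flip d⁻)) (sym (inv-inv a′)) ga ,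
            turned-greedy (hit-greedy hit) (hit-holds hit) (T′-hit hit) (inj₁ (refl , refl)) hit (proj₂ (proj₂ (δ f))) gy
        ; distʳ = subst (Greedy T′ (tgt (flip d)))
            (trans (cong₂ (λ l z → inv f.σ ++ l ∷ z) (sym (flip-flip d⁻)) (sym (inv-inv a′))) (sym (inv-cut (inv a′) f.σ)))
            (turned-greedy (hit-greedy hit⁻) (hit-holds hit⁻) (T′-hit hit⁻) (inj₁ (refl , refl)) hit⁻ (proj₂ (proj₂ (δ (rev f)))) ga) , gy
        }
        where
        gy : Greedy T′ (tgt d) y′
        gy = proj₂ (proj₂ (proj₁ rays-δ))
        ga : Greedy T′ (tgt d⁻) a′
        ga = proj₂ (proj₂ (proj₂ rays-δ))

      flipped-along : Frame.α flipped ≈ f.α × Frame.σ flipped ≡ f.σ × flip (Frame.β flipped) ≈ flip f.β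
      flipped-along = γ≈ , refl , d≈

    frame-word : ∀ {b T} → Closed T → (e : Frame b T) → ∀ {w v s} → IsWalk w → Compatible T w → (o : Occ b w v s) →
                 Along e (Occ.l o) s → w ≡ Frame.word e
    frame-word cl e wk c o@(occ x y refl _ i j) (a , refl) with ≈-≡ a (trans i (sym (Frame.signˡ e)))
    ... | refl with chain-last-unique (Frame.σ e) (occ-context wk o) (Frame.chain e) (trans j (sym (Frame.signʳ e)))
    ... | refl with frame-unique cl e wk c x y refl
    ... | refl , refl = refl

    hit-word : ∀ {w v s} → IsWalk w → Compatible T w → Occ false w v s → Hits f v s → f.word ≡ w ⊎ inv f.word ≡ w
    hit-word {s = s} wk c o@(occ _ _ _ refl _ _) h with orient-hit f {s = s} (occ-context wk o) h
    ... | inj₁ a = inj₁ (sym (frame-word closed f wk c o a))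
    ... | inj₂ a = inj₂ (trans (sym (word-rev f)) (sym (frame-word closed (rev f) wk c o a)))

    preserved : ∀ {w} → Compatible T w → (∀ {v s} → Occ false w v s → ¬ Hits f v s) → Compatible T′ w
    preserved c free {true} o = T-false (c o)
    preserved c free {false} o = T′-intro (c o) (λ P → free (occ-part o P))

    module _ (good : Good T) where

      -- The greedy walk following ρ has σ at the top, so by `frame-unique` it is the walk of f or
      -- of its inverse. If σ were a proper quotient of ρ, a distinguished letter of that frame
      -- would be a letter of ρ, and greediness from it would contradict simplicity of ρ.
      simple-hit : ∀ {k ρ n v s} → Simple closed (tgt k) ρ → Chain k (ρ ++ n ∷ []) → Part true (tgt k) ρ v s → Hits f v s →
                   tgt k ≡ v × ρ ≡ s
      simple-hit {k} {ρ} {n} {v} {s} S c P h with chain-first ρ c false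
      ... | α₁ , α₁≈ , i₁ with chain-last ρ (≈-chain (ρ ++ n ∷ []) (≈-sym α₁≈) c) true
      ... | β₁ , c₁ , j₁ with greedy-walk closed good α₁
      ... | X , Y , wk , gl , gr with greedy-follow (ρ ++ β₁ ∷ []) (proj₂ (mark X wk)) gr c₁
              (subst (λ u → Greedy T u (ρ ++ β₁ ∷ [])) (sym (≈-tgt α₁≈)) (greedy-snoc ρ (Simple.right S) (trans (Simple.holds S) (sym j₁))))
      ... | t , refl = go (part-split P)
        where
        W : List Letter
        W = X ++ α₁ ∷ (ρ ++ β₁ ∷ []) ++ t
        comp : Compatible T W
        comp = distinguished-compatible closed X _ wk (gl , gr)
        at : ∀ x′ {l} m y′ → W ≡ x′ ++ l ∷ s ++ m ∷ y′ → tgt l ≡ v → pos l ≡ false → pos m ≡ true →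
             ∃ λ (e : Frame false T) → x′ ≡ Frame.x e × l ≡ Frame.α e × m ≡ Frame.β e × y′ ≡ Frame.y e
        at x′ {l} m y′ e refl i j = located (orient-hit f (occ-context wk o) h)
          where
          o : Occ false W (tgt l) s
          o = occ x′ y′ e refl i j
          locate : (e : Frame false T) → Along e l s → x′ ≡ Frame.x e × l ≡ Frame.α e × m ≡ Frame.β e × y′ ≡ Frame.y e
          locate e′ (a , refl) with ≈-≡ a (trans i (sym (Frame.signˡ e′)))
          ... | refl with chain-last-unique (Frame.σ e′) (occ-context wk o) (Frame.chain e′) (trans j (sym (Frame.signʳ e′)))
          ... | refl with frame-unique closed e′ wk comp x′ y′ e
          ... | p , q = p , refl , refl , q
          located : Along f l s ⊎ Along (rev f) l s → _
          located (inj₁ a) = f , locate f a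
          located (inj₂ a) = rev f , locate (rev f) a
        no-left : ∀ (e : Frame false T) a {n} q → ρ ≡ a ++ n ∷ q → pos n ≡ false → n ≡ Frame.α e → X ++ α₁ ∷ a ≢ Frame.x e
        no-left e a q refl j refl p = t≢f
          (trans (greedyˡ closed X a (subst (λ x → Greedy T (tgt (flip (Frame.α e))) (inv x)) (sym p) (proj₁ (Frame.distˡ e))) refl
            (chain-cut a (subst (Chain α₁) (assoc∷ a q) c₁))) (cong not i₁))
          (trans (subst (λ u → T u a ≡ pos (Frame.α e)) (sym (≈-tgt α₁≈)) (turn (Simple.right S) a q refl)) j)
        no-right : ∀ (e : Frame false T) u {m} q → ρ ≡ u ++ m ∷ q → pos m ≡ true → m ≡ Frame.β e → q ++ β₁ ∷ t ≢ Frame.y e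
        no-right e u q refl j refl p = t≢f
          (trans (turn (proj₂ (Frame.distʳ e)) q t (sym p)) j₁) (trans (Simple.left S u q refl) (cong not j))
        go : ∃ (λ u → Pre true ρ u × Suf true (tgt k) u v s) → tgt k ≡ v × ρ ≡ s
        go (u , inj₁ refl , inj₁ (e , e′)) = e , e′
        go (u , inj₁ e₀ , inj₂ (a , n , refl , i , e))
          with at (X ++ α₁ ∷ a) β₁ t (trans (cong (λ r → X ++ α₁ ∷ r) (trans (snoc-assoc ρ) (trans (cong (_++ β₁ ∷ t) e₀) (assoc∷ a s)))) (sym (assoc∷ X a))) e i j₁
        ... | fr , p , q , _ = ⊥-elim (no-left fr a s e₀ i q p)
        go (u , inj₂ (m , q , e₀ , j) , inj₁ (e , refl))
          with at X m (q ++ β₁ ∷ t) (cong (λ r → X ++ α₁ ∷ r) (trans (snoc-assoc ρ) (trans (cong (_++ β₁ ∷ t) e₀) (assoc∷ s q)))) (trans (≈-tgt α₁≈) e) i₁ j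
        ... | fr , _ , _ , r , p = ⊥-elim (no-right fr s q e₀ j r p)
        go (u , inj₂ (m , q , e₀ , j) , inj₂ (a , n , refl , i , e))
          with at (X ++ α₁ ∷ a) m (q ++ β₁ ∷ t) (trans (cong (λ r → X ++ α₁ ∷ r) (trans (snoc-assoc ρ) (trans (cong (_++ β₁ ∷ t) e₀)
                 (trans (assoc∷ (a ++ n ∷ s) q) (assoc∷ a s))))) (sym (assoc∷ X a))) e i j
        ... | fr , _ , _ , r , p = ⊥-elim (no-right fr (a ++ n ∷ s) q e₀ j r p)

      bad? : ∀ w → Dec (∃₂ λ v s → Occ true w v s × T v s ≡ true)
      bad? w = map′
        (λ { (x , l , _ , refl , i , s , m , y , refl , j , h) → tgt l , s , occ x y refl refl i j , h })
        (λ { (_ , s , occ x {l} {m} y refl refl i j , h) → x , l , _ , refl , i , s , m , y , refl , j , h })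
        (split? w λ x l r _ → (pos l Bool.≟ true) ×-dec split? r λ s m y _ → (pos m Bool.≟ false) ×-dec (T (tgt l) s Bool.≟ true))

      -- If w is not compatible with T, some bottom substring of w lies in T, and then so does a
      -- simple substring ρ of it, again at the bottom of w. Not being in T′, this ρ has the
      -- quotient σ, so it is σ by `simple-hit`, and `frame-unique` for `flipped` identifies w.
      new-walk : ∀ {w} → IsWalk w → Compatible T′ w →
                 Compatible T w ⊎ (Frame.word (flipped good) ≡ w ⊎ inv (Frame.word (flipped good)) ≡ w)
      new-walk {w} wk c with bad? w
      ... | no ¬bad = inj₁ old
        where
        old : Compatible T w
        old {true} o = ¬-not λ t → ¬bad (_ , _ , o , t)
        old {false} o = T′-⊆ (c o)
      ... | yes (v , s , o , t) with simple-sub closed v s t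
      ... | v₁ , ρ , P , S with occ-part o P
      ... | o₁@(occ _ _ _ refl _ _) with T′-false (c o₁) (Simple.holds S)
      ... | v₂ , s₂ , P₂ , h with simple-hit S (occ-context wk o₁) P₂ h
      ... | refl , refl = inj₂ (which (orient-hit f (occ-context wk o₁) h))
        where
        module f′ = Frame (flipped good)
        which : Along f (Occ.l o₁) ρ ⊎ Along (rev f) (Occ.l o₁) ρ → f′.word ≡ w ⊎ inv f′.word ≡ w
        which (inj₁ (a , e)) with flipped-along good
        ... | b , σ≡ , _ = inj₁ (sym (frame-word T′-closed (flipped good) wk c o₁ (≈-trans a (≈-sym b) , trans e (sym σ≡))))
        which (inj₂ (a , e)) with flipped-along good
        ... | _ , σ≡ , b = inj₂ (trans (sym (word-rev (flipped good)))
          (sym (frame-word T′-closed (rev (flipped good)) wk c o₁ (≈-trans a (≈-sym b) , trans e (cong inv (sym σ≡))))))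

  -- Finitely many walks: deciding compatibility and inclusion.

  Context : Set
  Context = Letter × List Letter × Letter

  cuts-of : List Letter → List (List Letter × Letter)
  cuts-of [] = []
  cuts-of (m ∷ r) = ([] , m) ∷ map (λ (s , n) → m ∷ s , n) (cuts-of r)

  contexts : List Letter → List Context
  contexts [] = []
  contexts (l ∷ r) = map (l ,_) (cuts-of r) ++ contexts r

  ∈-cuts-of⁺ : ∀ s {m} y → (s , m) ∈ˡ cuts-of (s ++ m ∷ y)
  ∈-cuts-of⁺ [] y = here refl
  ∈-cuts-of⁺ (k ∷ s) y = there (∈-map⁺ _ (∈-cuts-of⁺ s y))

  ∈-cuts-of⁻ : ∀ r {s m} → (s , m) ∈ˡ cuts-of r → ∃ λ y → r ≡ s ++ m ∷ y
  ∈-cuts-of⁻ (m ∷ r) (here refl) = r , refl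
  ∈-cuts-of⁻ (m ∷ r) (there i) with ∈-map⁻ _ i
  ... | _ , j , refl with ∈-cuts-of⁻ r j
  ... | y , refl = y , refl

  ∈-contexts⁺ : ∀ x {l} s {m} y → (l , s , m) ∈ˡ contexts (x ++ l ∷ s ++ m ∷ y)
  ∈-contexts⁺ [] s y = ∈-++⁺ˡ (∈-map⁺ _ (∈-cuts-of⁺ s y))
  ∈-contexts⁺ (k ∷ x) {l} s {m} y = ∈-++⁺ʳ (map (k ,_) (cuts-of (x ++ l ∷ s ++ m ∷ y))) (∈-contexts⁺ x s y)

  ∈-contexts⁻ : ∀ w {l s m} → (l , s , m) ∈ˡ contexts w → ∃₂ λ x y → w ≡ x ++ l ∷ s ++ m ∷ y
  ∈-contexts⁻ (l ∷ r) i with ∈-++⁻ (map (l ,_) (cuts-of r)) i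
  ... | inj₁ j with ∈-map⁻ _ j
  ... | _ , k , refl with ∈-cuts-of⁻ r k
  ... | y , refl = [] , y , refl
  ∈-contexts⁻ (l ∷ r) i | inj₂ j with ∈-contexts⁻ r j
  ... | x , y , refl = l ∷ x , y , refl

  infix 4 _⊆ᵀ_ _≗_
  -- Only strings within Q₀ are compared; the values of a class on other words carry no meaning.
  _⊆ᵀ_ _≗_ : Class → Class → Set
  T ⊆ᵀ T₁ = ∀ {l} s {m} → Chain l (s ++ m ∷ []) → T (tgt l) s ≡ true → T₁ (tgt l) s ≡ true
  T ≗ T₁ = ∀ {l} s {m} → Chain l (s ++ m ∷ []) → T (tgt l) s ≡ T₁ (tgt l) s

  ≗-sym : ∀ {T T₁} → T ≗ T₁ → T₁ ≗ T
  ≗-sym e s c = sym (e s c)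

  ≗-trans : ∀ {T T₁ T₂} → T ≗ T₁ → T₁ ≗ T₂ → T ≗ T₂
  ≗-trans e e′ s c = trans (e s c) (e′ s c)

  ≗-⊆ : ∀ {T T₁} → T ≗ T₁ → T ⊆ᵀ T₁
  ≗-⊆ e s c h = trans (sym (e s c)) h

  ⊆-antisym : ∀ {T T₁} → T ⊆ᵀ T₁ → T₁ ⊆ᵀ T → T ≗ T₁
  ⊆-antisym a b s c = bool-ext (a s c) (b s c)

  greedy-≗ : ∀ {T T₁ l r} → T ≗ T₁ → Chain l r → Greedy T (tgt l) r → Greedy T₁ (tgt l) r
  greedy-≗ {T} {T₁} {l} {r} e c g = greedy λ p s eq →
    trans (sym (e p (chain-cut p (subst (Chain l) eq c)))) (turn g p s eq)

  compatible-≗ : ∀ {T T₁ w} → T ≗ T₁ → IsWalk w → Compatible T w → Compatible T₁ w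
  compatible-≗ e wk c {s = s} o@(occ _ _ _ refl _ _) = trans (sym (e s (occ-context wk o))) (c o)

  opaque
    compatible? : ∀ T w → Dec (Compatible T w)
    compatible? T w with any? (λ { (l , s , m) → ((pos l Bool.≟ not (pos m)) ×-dec ¬? (T (tgt l) s Bool.≟ pos m)) }) (contexts w)
    ... | yes a = no λ c → bad c (find a)
      where
      bad : Compatible T w → ¬ (∃ λ (k : Context) → k ∈ˡ contexts w × pos (proj₁ k) ≡ not (pos (proj₂ (proj₂ k))) ×
        ¬ (T (tgt (proj₁ k)) (proj₁ (proj₂ k)) ≡ pos (proj₂ (proj₂ k))))
      bad c ((l , s , m) , i , e , h) with ∈-contexts⁻ w i
      ... | x , y , eq = h (trans (c (occ x y eq refl refl (trans (sym (not-involutive _)) (cong not (sym e)))))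
                                (trans (cong not e) (not-involutive _)))
    ... | no ¬a = yes λ { {b} {v} {s} (occ x {l} {m} y refl refl i j) → at x {l} s {m} y i j refl }
      where
      at : ∀ {b} x {l} s {m} y → pos l ≡ b → pos m ≡ not b → w ≡ x ++ l ∷ s ++ m ∷ y → T (tgt l) s ≡ not b
      at {b} x {l} s {m} y i j refl with T (tgt l) s Bool.≟ pos m
      ... | yes e = trans e j
      ... | no ¬e = ⊥-elim (¬a (lose (∈-contexts⁺ x s y)
                      (trans i (trans (sym (not-involutive b)) (cong not (sym j))) , ¬e)))

  nonkissing-of-compatible : ∀ {T w} → Closed T → IsWalk w → Compatible T w → NonKissing (w ∷ [])
  nonkissing-of-compatible {T} {w} closed wk c (u , m , o) (u′ , m′ , o′) = t≢f (comp m′ o′) (comp m o)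
    where
    comp : ∀ {u} → Member (w ∷ []) u → Compatible T u
    comp (here (inj₁ refl)) = c
    comp (here (inj₂ refl)) = compatible-inv closed wk c

  member-sum : ∀ {ws w} → Member ws w → length w ≤ sum (map length ws)
  member-sum {u ∷ us} (here (inj₁ refl)) = ℕ.m≤m+n (length u) (sum (map length us))
  member-sum {u ∷ us} (here (inj₂ refl)) = subst (_≤ sum (map length (u ∷ us))) (sym (length-inv u)) (ℕ.m≤m+n (length u) (sum (map length us)))
  member-sum {u ∷ us} (there h) = ℕ.≤-trans (member-sum h) (ℕ.m≤n+m _ (length u))

  occ-length : ∀ {b w v s} → Occ b w v s → length s ≤ length w
  occ-length {s = s} (occ x y refl _ _ _) = ℕ.≤-trans (ℕ.<⇒≤ (cut-<ˡ s)) (ℕ.<⇒≤ (cut-<ʳ x))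

  -- Greedy reading for the largest class takes positive letters only, and `bounded` limits the
  -- length of such chains.
  top-good : Good top-class
  top-good l = good-of-bounded (proj₁ bounded) l λ c d g → proj₂ bounded c d (positive c c [] refl g)
    where
    positive : ∀ c r p → c ≡ p ++ r → Greedy top-class (tgt l) c → All (λ m → pos m ≡ true) r
    positive c [] p e g = []
    positive c (m ∷ r) p e g = sym (turn g p r e) ∷ positive c r (p ++ m ∷ []) (trans e (sym (snoc-assoc p))) g

  module Finite (W : List (List Letter)) (walks : All IsWalk W)
    (complete : ∀ {b w v s} → IsWalk w → Occ b w v s → NonKissing (w ∷ []) → Member W w) where

    member-of-compatible : ∀ {T b w v s} → Closed T → IsWalk w → Compatible T w → Occ b w v s → Member W w
    member-of-compatible closed wk c o = complete wk o (nonkissing-of-compatible closed wk c)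

    short : ∀ {T} → Closed T → ∀ {w v s} → IsWalk w → Compatible T w → Occ false w v s → length s ≤ sum (map length W)
    short closed wk c o = ℕ.≤-trans (occ-length o) (member-sum (member-of-compatible closed wk c o))

    all-contexts : List Context
    all-contexts = concatMap (λ w → contexts w ++ contexts (inv w)) W

    ∈-all-contexts⁺ : ∀ {w l s m} → Member W w → (l , s , m) ∈ˡ contexts w → (l , s , m) ∈ˡ all-contexts
    ∈-all-contexts⁺ {w} k i with find k
    ... | u , j , inj₁ refl = ∈-concatMap⁺ _ (lose j (∈-++⁺ˡ i))
    ... | u , j , inj₂ refl = ∈-concatMap⁺ _ (lose j (∈-++⁺ʳ (contexts u) i))

    ∈-all-contexts⁻ : ∀ {l s m} → (l , s , m) ∈ˡ all-contexts → Chain l (s ++ m ∷ [])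
    ∈-all-contexts⁻ {l} {s} {m} i with find (∈-concatMap⁻ _ i)
    ... | w , j , k with ∈-++⁻ (contexts w) k
    ... | inj₁ h with ∈-contexts⁻ w h
    ... | x , y , e = chain-cut s (walk-chain x (subst IsWalk e (All.lookup walks j)))
    ∈-all-contexts⁻ {l} {s} {m} i | w , j , k | inj₂ h with ∈-contexts⁻ (inv w) h
    ... | x , y , e = chain-cut s (walk-chain x (subst IsWalk e (walk-inv (All.lookup walks j))))

    frame-context : ∀ {T} → Closed T → (f : Frame false T) → (Frame.α f , Frame.σ f , Frame.β f) ∈ˡ all-contexts
    frame-context closed f = ∈-all-contexts⁺
      (member-of-compatible closed (Frame.walk f) (Frame.compatible f closed) (Frame.occurrence f))
      (∈-contexts⁺ (Frame.x f) (Frame.σ f) (Frame.y f))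

    Differ : Class → Class → Context → Set
    Differ T T₁ (l , s , _) = T (tgt l) s ≡ true × T₁ (tgt l) s ≡ false

    -- Inclusion concerns all strings, yet testing `all-contexts` decides it: by `descent` any
    -- difference also shows at the distinguished string of a frame of T, and the walk of that frame
    -- is listed.
    compare-good : ∀ {T T₁} → Closed T → Good T → Closed T₁ →
                   T ⊆ᵀ T₁ ⊎ ∃ λ (f : Frame false T) → T₁ (tgt (Frame.α f)) (Frame.σ f) ≡ false
    compare-good {T} {T₁} closed good closed₁
      with any? {P = Differ T T₁} (λ (l , s , _) → (T (tgt l) s Bool.≟ true) ×-dec (T₁ (tgt l) s Bool.≟ false)) all-contexts
    ... | yes a with find a
    ... | (l , s , m) , i , t , t₁ = inj₂ (Descent.descent closed good _ (short closed) closed₁ s (∈-all-contexts⁻ i) t t₁)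
    compare-good {T} {T₁} closed good closed₁ | no ¬a = inj₁ included
      where
      included : T ⊆ᵀ T₁
      included {l} s c t with bool? (T₁ (tgt l) s)
      ... | inj₁ h = h
      ... | inj₂ h with Descent.descent closed good _ (short closed) closed₁ s c t h
      ... | f , h′ = ⊥-elim (¬a (lose (frame-context closed f) (Simple.holds (frame-simple closed f) , h′)))

    good-≗ : ∀ {T T₁} → T ≗ T₁ → Good T → Good T₁
    good-≗ {T} {T₁} e good l with good l
    ... | r , ray , g = r , ray , greedy-≗ {T} {T₁} e (ray-chain r ray) g

    opaque
      -- Every class is reached from the largest one by finitely many flips.
      all-good : ∀ {T₁} → Closed T₁ → Good T₁
      all-good {T₁} closed₁ = go top-class (<-wellFounded _) top-class-closed top-good (λ _ → refl)
        where
        Holds : Class → Context → Set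
        Holds T (l , s , _) = T (tgt l) s ≡ true
        holds? : ∀ T c → Dec (Holds T c)
        holds? T (l , s , _) = T (tgt l) s Bool.≟ true
        go : ∀ T → Acc _<_ (length (filter (holds? T) all-contexts)) → Closed T → Good T →
             (∀ {v s} → T₁ v s ≡ true → T v s ≡ true) → Good T₁
        go T (acc rs) closed good above with compare-good closed good closed₁
        ... | inj₁ h = good-≗ {T} {T₁} (⊆-antisym {T} {T₁} h (λ _ _ → above)) good
        ... | inj₂ (f , h) = go F.T′
          (rs (count-< (holds? F.T′) (holds? T) F.T′-⊆
            (lose (frame-context closed f) (F.hit-holds (inj₁ (refl , refl)) , λ t → t≢f t (F.T′-hit (inj₁ (refl , refl)))))))
          F.T′-closed (F.T′-good good) (λ t₁ → F.T′-largest closed₁ h (above t₁) t₁)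
          where module F = Flip closed f

    compare : ∀ {T T₁} → Closed T → Closed T₁ → T ⊆ᵀ T₁ ⊎ ∃ λ (f : Frame false T) → T₁ (tgt (Frame.α f)) (Frame.σ f) ≡ false
    compare closed = compare-good closed (all-good closed)

    walksOf : Class → List (List Letter)
    walksOf T = filter (compatible? T) W

    walksOf-walks : ∀ T → All IsWalk (walksOf T)
    walksOf-walks T = All.filter⁺ (compatible? T) walks

    walksOf-compatible : ∀ {T w} → Closed T → Member (walksOf T) w → Compatible T w
    walksOf-compatible {T} closed k with find k
    ... | u , j , e with ∈-filter⁻ (compatible? T) {xs = W} j
    ... | i , c with e
    ... | inj₁ refl = c
    ... | inj₂ refl = compatible-inv closed (All.lookup walks i) c

    member-walksOf : ∀ {T b w v s} → Closed T → IsWalk w → Compatible T w → Occ b w v s → Member (walksOf T) w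
    member-walksOf {T} {w = w} closed wk c o with find (member-of-compatible closed wk c o)
    ... | u , j , inj₁ refl = lose (∈-filter⁺ (compatible? T) j c) (inj₁ refl)
    ... | u , j , inj₂ refl = lose (∈-filter⁺ (compatible? T) j
      (subst (Compatible T) (inv-inv u) (compatible-inv closed wk c))) (inj₂ refl)

    module WalksOf (T : Class) = Torsion (walksOf T) (walksOf-walks T)

    torsion-walksOf : ∀ {T} → Closed T → T ≗ WalksOf.torsion T
    torsion-walksOf {T} closed {l} s c = bool-ext
      (λ t → WalksOf.torsion-intro T λ P (w , k , o) → t≢f (Closed.quotient closed P t) (walksOf-compatible closed k o))
      back
      where
      back : WalksOf.torsion T (tgt l) s ≡ true → T (tgt l) s ≡ true
      back h with bool? (T (tgt l) s)
      ... | inj₁ t = t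
      ... | inj₂ t with bottom-quotient closed (all-good closed) s c t
      ... | v′ , q , P , w , wk , k , o = ⊥-elim (WalksOf.torsion-avoids T h P (w , member-walksOf closed wk k o , o))

  -- Meets and joins of torsion classes.

  meet : Class → Class → Class
  meet T₁ T₂ v s = T₁ v s && T₂ v s

  ∧-intro : ∀ {a b} → a ≡ true → b ≡ true → a && b ≡ true
  ∧-intro refl refl = refl

  meet-closed : ∀ {T₁ T₂} → Closed T₁ → Closed T₂ → Closed (meet T₁ T₂)
  meet-closed c₁ c₂ = record
    { quotʳ = λ p q h e → let (a , b) = ∧-true h in ∧-intro (Closed.quotʳ c₁ p q a e) (Closed.quotʳ c₂ p q b e)
    ; quotˡ = λ p q h e → let (a , b) = ∧-true h in ∧-intro (Closed.quotˡ c₁ p q a e) (Closed.quotˡ c₂ p q b e)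
    ; cat = λ p q h k → let (a , b) = ∧-true h ; (a′ , b′) = ∧-true k in
        ∧-intro (Closed.cat c₁ p q a a′) (Closed.cat c₂ p q b b′)
    ; inversion = λ p c → cong₂ _&&_ (Closed.inversion c₁ p c) (Closed.inversion c₂ p c)
    }

  -- The torsion-free class of T.
  record Free (T : Class) (v : V) (s : List Letter) : Set where
    constructor free
    field none : ∀ {v′ q} → Part false v s v′ q → T v′ q ≡ false
  open Free public

  free? : ∀ T v s → Dec (Free T v s)
  free? T v s with part? (λ v s → T v s Bool.≟ true) false v s
  ... | yes (_ , _ , P , t) = no λ f → t≢f t (none f P)
  ... | no ¬k = yes (free λ P → ¬-not λ t → ¬k (_ , _ , P , t))

  free-sub : ∀ {T v s v′ q} → Free T v s → Part false v s v′ q → Free T v′ q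
  free-sub f P = free λ P′ → none f (cuts-trans P P′)

  free-⊆ : ∀ {T T₁ l} s {m} → T ⊆ᵀ T₁ → Chain l (s ++ m ∷ []) → Free T₁ (tgt l) s → Free T (tgt l) s
  free-⊆ s a c f = free λ P → ¬-not λ t → at P t (cuts-context P refl c)
    where
    at : ∀ {v q} → Part false _ s v q → _ ≡ true → (∃₂ λ l′ n′ → tgt l′ ≡ v × Chain l′ (q ++ n′ ∷ [])) → ⊥
    at P t (_ , _ , refl , d) = t≢f (a _ d t) (none f P)

  free-inv : ∀ {T l} s {m} → Closed T → Chain l (s ++ m ∷ []) → Free T (tgt l) s → Free T (tgt (flip m)) (inv s)
  free-inv {T} {l} s closed c f = free λ {v} {q} P → at P (part-inv P refl (chain-inv s c))
    where
    at : ∀ {v q} → Part false _ (inv s) v q → (∃₂ λ l′ n′ → tgt l′ ≡ v × Chain l′ (q ++ n′ ∷ []) ×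
         Part false (tgt (flip (flip l))) (inv (inv s)) (tgt (flip n′)) (inv q)) → T v q ≡ false
    at {q = q} P (_ , n′ , refl , d , P′) = trans (Closed.inversion closed q d)
      (none f (subst₂ (λ k w → Part false (tgt k) w (tgt (flip n′)) (inv q)) (flip-flip l) (inv-inv s) P′))

  cosimple-free : ∀ {T} (closed : Closed T) {v s} → Cosimple closed v s → Free T v s
  cosimple-free closed C = free (cosimple-sub closed C)

  -- The union of two torsion classes need not be closed under concatenation, so the join is built
  -- from the torsion-free side: a string belongs to it if no quotient is torsion-free for both
  -- classes. In this form membership depends on factors only, as `agree-join` requires.
  module Join {T₁ T₂ : Class} (c₁ : Closed T₁) (c₂ : Closed T₂) where
    private
      module P = Perp top-class top-class-closed (λ v s → free? T₁ v s ×-dec free? T₂ v s)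
        (λ s c (f₁ , f₂) → free-inv s c₁ c f₁ , free-inv s c₂ c f₂)
        (λ p q (f₁ , f₂) e _ → free-sub f₁ (cutˡ p q e whole) , free-sub f₂ (cutˡ p q e whole))
        (λ p q (f₁ , f₂) e _ → free-sub f₁ (cutʳ p q e whole) , free-sub f₂ (cutʳ p q e whole))

    opaque
      join : Class
      join = P.perp

      join-closed : Closed join
      join-closed = P.perp-closed

      join-avoids : ∀ {v s v′ q} → join v s ≡ true → Part true v s v′ q → Free T₁ v′ q → Free T₂ v′ q → ⊥
      join-avoids h P f₁ f₂ = P.perp-avoids h P (f₁ , f₂)

      join-intro : ∀ {v s} → (∀ {v′ q} → Part true v s v′ q → Free T₁ v′ q → Free T₂ v′ q → ⊥) → join v s ≡ true
      join-intro k = P.perp-intro refl λ P (f₁ , f₂) → k P f₁ f₂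

    join-upperˡ : ∀ {v s} → T₁ v s ≡ true → join v s ≡ true
    join-upperˡ t = join-intro λ P f _ → t≢f (Closed.quotient c₁ P t) (none f whole)

    join-upperʳ : ∀ {v s} → T₂ v s ≡ true → join v s ≡ true
    join-upperʳ t = join-intro λ P _ f → t≢f (Closed.quotient c₂ P t) (none f whole)

    join-free : ∀ {v s} → Free T₁ v s → Free T₂ v s → Free join v s
    join-free f₁ f₂ = free λ P → ¬-not λ t → join-avoids t whole (free-sub f₁ P) (free-sub f₂ P)

    -- A string outside T has a quotient cosimple for T. This quotient is torsion-free for T, hence
    -- for the smaller classes T₁ and T₂, and strings of the join have no such quotient.
    join-least : ∀ {T} → Closed T → T₁ ⊆ᵀ T → T₂ ⊆ᵀ T → join ⊆ᵀ T
    join-least {T} closed a b {l} s c t with bool? (T (tgt l) s)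
    ... | inj₁ h = h
    ... | inj₂ h with cosimple-quotient closed (tgt l) s h
    ... | v′ , q , P , C with cuts-context P refl c
    ... | l′ , n′ , refl , d = ⊥-elim (join-avoids t P (free-⊆ q a d f) (free-⊆ q b d f))
      where
      f : Free T (tgt l′) q
      f = cosimple-free closed C

  Agree : V → List Letter → Class → Class → Set
  Agree v s T T₁ = ∀ {v′ q} → Factor v s v′ q → T v′ q ≡ T₁ v′ q

  agree-sym : ∀ {v s T T₁} → Agree v s T T₁ → Agree v s T₁ T
  agree-sym a P = sym (a P)

  agree? : ∀ v s T T₁ → Dec (Agree v s T T₁)
  agree? v s T T₁ with factor? (λ v s → ¬? (T v s Bool.≟ T₁ v s)) v s
  ... | yes (_ , _ , P , h) = no λ a → h (a P)
  ... | no ¬k = yes λ {v′} {q} P → decidable-stable (T v′ q Bool.≟ T₁ v′ q) λ h → ¬k (_ , _ , P , h)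

  agree-≗ : ∀ {T T₁ l} s {m} → Chain l (s ++ m ∷ []) → T ≗ T₁ → Agree (tgt l) s T T₁
  agree-≗ s c e P with cuts-context P refl c
  ... | l′ , n′ , refl , d = e _ d

  agree-free : ∀ {T T₁ v s} → Agree v s T T₁ → ∀ {v′ q} → Factor v s v′ q → Free T v′ q → Free T₁ v′ q
  agree-free a P f = free λ P′ → trans (sym (a (cuts-trans P (part-factor P′)))) (none f P′)

  agree-join : ∀ {T T′ U U′ v s} (c : Closed T) (c′ : Closed T′) (d : Closed U) (d′ : Closed U′) →
               Agree v s T T′ → Agree v s U U′ → Agree v s (Join.join c d) (Join.join c′ d′)
  agree-join {v = v} {s} c c′ d d′ a b P = bool-ext (half c c′ d d′ a b P) (half c′ c d′ d (agree-sym a) (agree-sym b) P)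
    where
    half : ∀ {T T′ U U′} (c : Closed T) (c′ : Closed T′) (d : Closed U) (d′ : Closed U′) →
           Agree v s T T′ → Agree v s U U′ → ∀ {v′ q} → Factor v s v′ q →
           Join.join c d v′ q ≡ true → Join.join c′ d′ v′ q ≡ true
    half c c′ d d′ a b P t = Join.join-intro c′ d′ λ P′ f g →
      let Q = cuts-trans P (part-factor P′)
      in Join.join-avoids c d t P′ (agree-free (agree-sym a) Q f) (agree-free (agree-sym b) Q g)

  Differs : Class → Class → Set
  Differs T T₁ = ∃₂ λ l s → ∃ λ m → Chain l (s ++ m ∷ []) × T (tgt l) s ≡ true × T₁ (tgt l) s ≡ false

  -- This passes from torsion to torsion-free classes: a quotient cosimple for T₁ is torsion-free
  -- for T₁, but it lies in T and so is not torsion-free for T.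
  differs-free : ∀ {T T₁} → Closed T → Closed T₁ → ∀ {l} s {m} → Chain l (s ++ m ∷ []) →
    T (tgt l) s ≡ true → T₁ (tgt l) s ≡ false →
    ∃₂ λ l′ q → ∃ λ n → Chain l′ (q ++ n ∷ []) × Factor (tgt l) s (tgt l′) q × Free T₁ (tgt l′) q × ¬ Free T (tgt l′) q
  differs-free {T} closed closed₁ {l} s c t t₁ with cosimple-quotient closed₁ (tgt l) s t₁
  ... | v′ , q , P , C with cuts-context P refl c
  ... | l′ , n , refl , d = l′ , q , n , d , part-factor P , cosimple-free closed₁ C ,
        λ f → t≢f (Closed.quotient closed P t) (none f whole)

  factor-antisym : ∀ {v s v′ q} → Factor v s v′ q → Factor v′ q v s → v ≡ v′ × s ≡ q
  factor-antisym P Q with cuts-length P | cuts-length Q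
  ... | inj₁ e | _ = e
  ... | inj₂ _ | inj₁ (refl , refl) = refl , refl
  ... | inj₂ a | inj₂ b = ⊥-elim (ℕ.<-asym a b)

  disagree : ∀ {T T₁ l} s {m} → T ⊆ᵀ T₁ → Chain l (s ++ m ∷ []) → ¬ Agree (tgt l) s T₁ T →
    ∃₂ λ l′ q → ∃ λ n → Chain l′ (q ++ n ∷ []) × Factor (tgt l) s (tgt l′) q × T₁ (tgt l′) q ≡ true × T (tgt l′) q ≡ false
  disagree {T} {T₁} {l} s a c ¬agree with factor? (λ v s → ¬? (T₁ v s Bool.≟ T v s)) (tgt l) s
  ... | no ¬k = ⊥-elim (¬agree λ {v′} {q} P → decidable-stable (T₁ v′ q Bool.≟ T v′ q) λ h → ¬k (_ , _ , P , h))
  ... | yes (v′ , q , P , h) with cuts-context P refl c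
  ... | l′ , n , refl , d with bool? (T (tgt l′) q) | bool? (T₁ (tgt l′) q)
  ... | inj₁ t | _ = ⊥-elim (h (trans (a q d t) (sym t)))
  ... | inj₂ t | inj₁ t₁ = l′ , q , n , d , P , t₁ , t
  ... | inj₂ t | inj₂ t₁ = ⊥-elim (h (trans t₁ (sym t)))

  -- The lattice of torsion classes and its congruences.

  module ClassLattice (X : Setoid 0ℓ 0ℓ)
    (T : Setoid.Carrier X → Class) (closed : ∀ x → Closed (T x)) (facet : ∀ {T} → Closed T → Setoid.Carrier X)
    (facet-T : ∀ {T′} (c : Closed T′) → T (facet c) ≗ T′)
    (≈⇒≗ : ∀ {x y} → Setoid._≈_ X x y → T x ≗ T y) (≗⇒≈ : ∀ {x y} → T x ≗ T y → Setoid._≈_ X x y)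
    (compare : ∀ {T T₁} → Closed T → Closed T₁ → T ⊆ᵀ T₁ ⊎ Differs T T₁) where

    open Setoid X using (Carrier)

    infix 4 _⊑_
    _⊑_ : Carrier → Carrier → Set
    x ⊑ y = T y ⊆ᵀ T x

    _∨_ _∧ᶠ_ : Carrier → Carrier → Carrier
    x ∨ y = facet (meet-closed (closed x) (closed y))
    x ∧ᶠ y = facet (Join.join-closed (closed x) (closed y))

    latticeOn : LatticeOn X
    latticeOn = record
      { _⊑_ = _⊑_ ; _∨_ = _∨_ ; _∧_ = _∧ᶠ_
      ; isLattice = record
        { isPartialOrder = record
          { isPreorder = record
            { isEquivalence = Setoid.isEquivalence X
            ; reflexive = λ {x} {y} e s c h → trans (≈⇒≗ {x} {y} e s c) h
            ; trans = λ a b s c h → a s c (b s c h)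
            }
          ; antisym = λ {x} {y} a b → ≗⇒≈ {x} {y} (⊆-antisym {T x} {T y} b a)
          }
        ; supremum = λ x y →
            (λ s c h → proj₁ (∧-true (trans (sym (facet-T (meet-closed (closed x) (closed y)) s c)) h))) ,
            (λ s c h → proj₂ (∧-true {T x _ s} (trans (sym (facet-T (meet-closed (closed x) (closed y)) s c)) h))) ,
            λ z a b s c h → trans (facet-T (meet-closed (closed x) (closed y)) s c) (∧-intro (a s c h) (b s c h))
        ; infimum = λ x y → let open Join (closed x) (closed y) in
            (λ s c h → trans (facet-T join-closed s c) (join-upperˡ h)) ,
            (λ s c h → trans (facet-T join-closed s c) (join-upperʳ h)) ,
            λ z a b s c h → join-least (closed z) a b s c (trans (sym (facet-T join-closed s c)) h)
        }
      }

    L : Lattice 0ℓ 0ℓ 0ℓ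
    L = LatticeOn.lattice latticeOn

    _⊑?_ : ∀ x y → Dec (x ⊑ y)
    x ⊑? y with compare (closed y) (closed x)
    ... | inj₁ h = yes h
    ... | inj₂ (_ , s , _ , c , t , t′) = no λ h → t≢f (h s c t) t′

    String : Set
    String = ∃₂ λ l s → ∃ λ m → Chain l (s ++ m ∷ [])

    agreement : String → Congruence L
    agreement (l , s , m , c) = record
      { _∼_ = λ x y → Agree (tgt l) s (T x) (T y)
      ; _∼?_ = λ x y → agree? (tgt l) s (T x) (T y)
      ; isEquivalence = record { refl = λ _ → refl ; sym = λ a P → sym (a P) ; trans = λ a b P → trans (a P) (b P) }
      ; reflexive = λ {x} {y} e → agree-≗ s c (≈⇒≗ {x} {y} e)
      ; ∨-cong = λ {x} {y} {u} {v} a b P → trans (at-facet (meet-closed (closed x) (closed u)) P)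
          (trans (cong₂ _&&_ (a P) (b P)) (sym (at-facet (meet-closed (closed y) (closed v)) P)))
      ; ∧-cong = λ {x} {y} {u} {v} a b P → trans (at-facet (Join.join-closed (closed x) (closed u)) P)
          (trans (agree-join (closed x) (closed y) (closed u) (closed v) a b P)
            (sym (at-facet (Join.join-closed (closed y) (closed v)) P)))
      }
      where
      at-facet : ∀ {T′} (c′ : Closed T′) → Agree (tgt l) s (T (facet c′)) T′
      at-facet c′ = agree-≗ s c (facet-T c′)

    module _ (enumeration : Defs.Finite X) where
      open Dual L
      private
        module F = FiniteLattice L _⊑?_ (proj₁ enumeration) (proj₂ enumeration)
        _⊒?_ : ∀ x y → Dec (y ⊑ x)
        x ⊒? y = y ⊑? x
        module F⁻ = FiniteLattice dualLattice _⊒?_ (proj₁ enumeration) (proj₂ enumeration)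

      _⊴_ : String → String → Set
      (l′ , q , _) ⊴ (l , s , _) = Factor (tgt l) s (tgt l′) q

      minimal-string : ∀ {P : V → List Letter → Set} → (∀ v s → Dec (P v s)) → (ρ : String) → P (tgt (proj₁ ρ)) (proj₁ (proj₂ ρ)) →
        ∃ λ (σ : String) → P (tgt (proj₁ σ)) (proj₁ (proj₂ σ)) ×
          (∀ (τ : String) → τ ⊴ σ → P (tgt (proj₁ τ)) (proj₁ (proj₂ τ)) → σ ⊴ τ)
      minimal-string P? (l , s , m , c) h with minimal-factor P? h
      ... | v′ , q , P , k , least with cuts-context P refl c
      ... | l′ , n , refl , d = (l′ , q , n , d) , k , λ _ Q g → back (least Q g)
        where
        back : ∀ {v″ t} → tgt l′ ≡ v″ × q ≡ t → Factor v″ t (tgt l′) q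
        back (refl , refl) = whole

      separation : F.Separation
      separation = record
        { K = String
        ; _∋_ = λ x (l , s , _) → Free (T x) (tgt l) s
        ; ∋-mono = λ { {ρ = l , s , m , c} a f → free-⊆ s a c f }
        ; ∋-sep = sep
        ; ∋-∧ = λ { {x} {y} {l , s , m , c} f g → let open Join (closed x) (closed y) in
            free-⊆ {T (x ∧ᶠ y)} {join} s (≗-⊆ {T (x ∧ᶠ y)} {join} (facet-T join-closed)) c (join-free f g) }
        ; _⊴_ = _⊴_
        ; ⊴-refl = whole
        ; ⊴-trans = λ P Q → cuts-trans Q P
        ; ⊴-∋ = λ {x} P Q → subst-free {x} (factor-antisym Q P)
        ; ⊴-minimal = λ {x} {y} {ρ} f ¬f →
            let (σ , h , least) = minimal-string (λ v s → free? (T x) v s ×-dec ¬? (free? (T y) v s)) ρ (f , ¬f)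
            in σ , h , λ {τ} P g ¬g → least τ P (g , ¬g)
        ; Θ = agreement
        ; Θ-∋ = λ P a f → agree-free a P f
        ; Θ-sep = λ {ρ} {x} {y} → split {ρ} {x} {y}
        }
        where
        sep : ∀ {x y} → ¬ (x ⊑ y) → _
        sep {x} {y} h with compare (closed y) (closed x)
        ... | inj₁ k = ⊥-elim (h k)
        ... | inj₂ (l , s , m , c , t , t′) with differs-free (closed y) (closed x) s c t t′
        ... | l′ , q , n , d , _ , f , ¬f = (l′ , q , n , d) , f , ¬f
        subst-free : ∀ {x v s v′ q} → v ≡ v′ × s ≡ q → Free (T x) v s → Free (T x) v′ q
        subst-free (refl , refl) f = f
        split : ∀ {ρ x y} → x ⊑ y → ¬ Congruence._∼_ (agreement ρ) x y → _
        split {l , s , m , c} {x} {y} a h with disagree s a c h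
        ... | l′ , q , n , d , P , t , t′ with differs-free (closed x) (closed y) q d t t′
        ... | l″ , r , k , d′ , P′ , f , ¬f = (l″ , r , k , d′) , cuts-trans P P′ , f , ¬f

      separation⁻ : F⁻.Separation
      separation⁻ = record
        { K = String
        ; _∋_ = λ x (l , s , _) → T x (tgt l) s ≡ true
        ; ∋-mono = λ { {ρ = l , s , m , c} a t → a s c t }
        ; ∋-sep = λ {x} {y} → sep {x} {y}
        ; ∋-∧ = λ { {x} {y} {l , s , m , c} t u → trans (facet-T (meet-closed (closed x) (closed y)) s c) (∧-intro t u) }
        ; _⊴_ = _⊴_
        ; ⊴-refl = whole
        ; ⊴-trans = λ P Q → cuts-trans Q P
        ; ⊴-∋ = λ {x} P Q → subst-true {x} (factor-antisym Q P)
        ; ⊴-minimal = λ {x} {y} {ρ} t ¬t →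
            let (σ , h , least) = minimal-string (λ v s → (T x v s Bool.≟ true) ×-dec ¬? (T y v s Bool.≟ true)) ρ (t , ¬t)
            in σ , h , λ {τ} P u ¬u → least τ P (u , ¬u)
        ; Θ = λ ρ → toDual (agreement ρ)
        ; Θ-∋ = λ P a t → trans (sym (a P)) t
        ; Θ-sep = λ {ρ} {x} {y} → split {ρ} {x} {y}
        }
        where
        sep : ∀ {x y} → ¬ (y ⊑ x) → ∃ λ ρ → T x (tgt (proj₁ ρ)) (proj₁ (proj₂ ρ)) ≡ true × ¬ (T y (tgt (proj₁ ρ)) (proj₁ (proj₂ ρ)) ≡ true)
        sep {x} {y} h with compare (closed x) (closed y)
        ... | inj₁ k = ⊥-elim (h k)
        ... | inj₂ (l , s , m , c , t , t′) = (l , s , m , c) , t , λ u → t≢f u t′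
        subst-true : ∀ {x v s v′ q} → v ≡ v′ × s ≡ q → T x v s ≡ true → T x v′ q ≡ true
        subst-true (refl , refl) t = t
        split : ∀ {ρ x y} → y ⊑ x → ¬ Congruence._∼_ (agreement ρ) x y → _
        split {l , s , m , c} {x} {y} a h with disagree {T x} {T y} s a c (λ g → h (agree-sym g))
        ... | l′ , q , n , d , P , t , t′ = (l′ , q , n , d) , P , t , λ u → t≢f u t′

      uniform : CongruenceUniform L
      uniform = congruenceUniform L _⊑?_ enumeration separation separation⁻

  -- Flips of torsion classes are the cover relations.

  infix 4 _reads_
  _reads_ : ∀ {b T} → Frame b T → List Letter → Set
  f reads w = Frame.word f ≡ w ⊎ inv (Frame.word f) ≡ w

  top-not-bottom : ∀ {T} → Closed T → (f : Frame false T) (g : Frame true T) → ¬ (g reads Frame.word f)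
  top-not-bottom closed f g (inj₁ e) = frames-opposite closed f g e
  top-not-bottom closed f g (inj₂ e) = frames-opposite closed f (rev g) (trans (word-rev g) e)

  frame-≗ : ∀ {b T T₁} → T ≗ T₁ → Frame b T → Frame b T₁
  frame-≗ {b} {T} {T₁} e f = record
    { x = x ; α = α ; σ = σ ; β = β ; y = y ; walk = walk ; signˡ = signˡ ; signʳ = signʳ
    ; distˡ = dist x walk distˡ
    ; distʳ = dist (x ++ α ∷ σ) (subst IsWalk (sym (assoc∷ x σ)) walk) distʳ
    }
    where
    open Frame f
    dist : ∀ x {l y} → IsWalk (x ++ l ∷ y) → Distinguished T x l y → Distinguished T₁ x l y
    dist x wk (g , g′) = greedy-≗ {T} {T₁} e (ray-chain _ (proj₁ (mark x wk))) g , greedy-≗ {T} {T₁} e (walk-chain x wk) g′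

  hits-false : ∀ {T T₁} (f : Frame false T) → Closed T₁ → ∀ {v s} → Hits f v s → T₁ v s ≡ false → T₁ (tgt (Frame.α f)) (Frame.σ f) ≡ false
  hits-false f closed₁ (inj₁ (refl , refl)) h = h
  hits-false f closed₁ (inj₂ (refl , refl)) h = trans (Closed.inversion closed₁ (Frame.σ f) (Frame.chain f)) h

  frame-fails : ∀ {T} (g : Frame true T) → T (tgt (Frame.α g)) (Frame.σ g) ≡ false
  frame-fails g = trans (turn (proj₂ (Frame.distˡ g)) (Frame.σ g) (Frame.y g) refl) (Frame.signʳ g)

  -- The flip of facets, expressed by compatible walks. The `Occ` arguments of `to` and `from`
  -- restrict them to bending walks, and `shared` identifies the distinguished strings up to
  -- inversion.
  record IsFlip (T T₁ : Class) : Set where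
    field
      f    : Frame false T
      g    : Frame true T₁
      shared : Hits f (tgt (Frame.α g)) (Frame.σ g)
      to   : ∀ {b w v s} → IsWalk w → Occ b w v s → Compatible T w → ¬ (f reads w) → Compatible T₁ w
      from : ∀ {b w v s} → IsWalk w → Occ b w v s → Compatible T₁ w → ¬ (g reads w) → Compatible T w

  module Covering (W : List (List Letter)) (walks : All IsWalk W)
    (complete : ∀ {b w v s} → IsWalk w → Occ b w v s → NonKissing (w ∷ []) → Member W w) where
    open Finite W walks complete

    -- If an inclusion failed, it would fail at the distinguished string of a top frame of the
    -- smaller side. The walk of this frame is not the one introduced by the flip, which carries a
    -- bottom frame, nor the one removed, which has σ at the top. So it is compatible with both
    -- classes, and its string lies in both.
    flip-class : ∀ {T T₁} → (closed : Closed T) → Closed T₁ → (φ : IsFlip T T₁) → T₁ ≗ Flip.T′ closed (IsFlip.f φ)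
    flip-class {T} {T₁} closed closed₁ φ = ⊆-antisym {T₁} {F.T′} (λ s c t → F.T′-largest closed₁ σ-false (T₁⊆T s c t) t) T′⊆T₁
      where
      open IsFlip φ
      module F = Flip closed f
      σ-false : T₁ (tgt (Frame.α f)) (Frame.σ f) ≡ false
      σ-false = hits-false f closed₁ shared (frame-fails g)
      T₁⊆T : T₁ ⊆ᵀ T
      T₁⊆T s c t with compare closed₁ (meet-closed closed₁ closed)
      ... | inj₁ h = proj₂ (∧-true {T₁ _ s} (h s c t))
      ... | inj₂ (f₁ , h) = t≢f (∧-intro (Simple.holds (frame-simple closed₁ f₁))
              (from (Frame.walk f₁) (Frame.occurrence f₁) (Frame.compatible f₁ closed₁) (top-not-bottom closed₁ f₁ g) (Frame.occurrence f₁))) h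
      T′⊆T₁ : F.T′ ⊆ᵀ T₁
      T′⊆T₁ s c t with compare F.T′-closed closed₁
      ... | inj₁ h = h s c t
      ... | inj₂ (f₃ , h) with F.new-walk (all-good closed) (Frame.walk f₃) (Frame.compatible f₃ F.T′-closed)
      ... | inj₂ r = ⊥-elim (top-not-bottom F.T′-closed f₃ (F.flipped (all-good closed)) r)
      ... | inj₁ k = t≢f (to (Frame.walk f₃) (Frame.occurrence f₃) k other (Frame.occurrence f₃)) h
        where
        c₃ : Compatible F.T′ (Frame.word f₃)
        c₃ = Frame.compatible f₃ F.T′-closed
        other : ¬ (f reads Frame.word f₃)
        other (inj₁ e) = t≢f (c₃ (subst (λ w → Occ false w _ _) e (Frame.occurrence f))) (F.T′-hit (inj₁ (refl , refl)))
        other (inj₂ e) = t≢f (c₃ (subst (λ w → Occ false w _ _) (trans (word-rev f) e) (Frame.occurrence (rev f)))) (F.T′-hit (inj₂ (refl , refl)))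

    flip-of : ∀ {T T₁} (closed : Closed T) (f : Frame false T) → T₁ ≗ Flip.T′ closed f → IsFlip T T₁
    flip-of {T} {T₁} closed f e = record
      { f = f
      ; g = frame-≗ {T = F.T′} {T₁} (≗-sym {T₁} {F.T′} e) (F.flipped good)
      ; shared = inj₁ (sym (≈-tgt (proj₁ (F.flipped-along good))) , sym (proj₁ (proj₂ (F.flipped-along good))))
      ; to = λ wk _ c ¬r → compatible-≗ {F.T′} {T₁} (≗-sym {T₁} {F.T′} e) wk (F.preserved c λ o h → ¬r (F.hit-word wk c o h))
      ; from = λ wk _ c ¬r → old wk (F.new-walk good wk (compatible-≗ {T₁} {F.T′} e wk c)) ¬r
      }
      where
      module F = Flip closed f
      good = all-good closed
      old : ∀ {w} → IsWalk w → Compatible T w ⊎ (F.flipped good reads w) → ¬ (F.flipped good reads w) → Compatible T w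
      old _ (inj₁ c) _ = c
      old _ (inj₂ r) ¬r = ⊥-elim (¬r r)

    compare-differs : ∀ {T T₁} → Closed T → Closed T₁ → T ⊆ᵀ T₁ ⊎ Differs T T₁
    compare-differs closed closed₁ with compare closed closed₁
    ... | inj₁ h = inj₁ h
    ... | inj₂ (f , h) = inj₂ (Frame.α f , Frame.σ f , Frame.β f , Frame.chain f , Simple.holds (frame-simple closed f) , h)

    module FacetLattice (X : Setoid 0ℓ 0ℓ)
      (T : Setoid.Carrier X → Class) (closed : ∀ x → Closed (T x)) (facet : ∀ {T} → Closed T → Setoid.Carrier X)
      (facet-T : ∀ {T′} (c : Closed T′) → T (facet c) ≗ T′)
      (≈⇒≗ : ∀ {x y} → Setoid._≈_ X x y → T x ≗ T y) (≗⇒≈ : ∀ {x y} → T x ≗ T y → Setoid._≈_ X x y) where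
      open Setoid X using (Carrier) renaming (_≈_ to _≈ˣ_)
      open ClassLattice X T closed facet facet-T ≈⇒≗ ≗⇒≈ compare-differs public

      -- If z lies above x and differs from it, some frame of `T x` has its string outside `T z` and
      -- thus outside T′. This string is simple and has the quotient σ, so it is σ by `simple-hit`.
      -- Hence `T z` avoids σ and is contained in the largest such class T′.
      flip-covers : ∀ {x y} → IsFlip (T x) (T y) → Covers (Lattice.poset L) y x
      flip-covers {x} {y} φ = (λ s c t → F.T′-⊆ (trans (sym (e s c)) t)) ,
        (λ x≈y → t≢f (F.hit-holds h) (trans (≈⇒≗ {x} {y} x≈y f.σ f.chain) (trans (e f.σ f.chain) (F.T′-hit h)))) , between
        where
        module f = Frame (IsFlip.f φ)
        module F = Flip (closed x) (IsFlip.f φ)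
        e : T y ≗ F.T′
        e = flip-class (closed x) (closed y) φ
        h : Hits (IsFlip.f φ) (tgt f.α) f.σ
        h = inj₁ (refl , refl)
        between : ∀ z → x ⊑ z → z ⊑ y → z ≈ˣ x ⊎ z ≈ˣ y
        between z a b with compare (closed x) (closed z)
        ... | inj₁ k = inj₁ (≗⇒≈ {z} {x} (⊆-antisym {T z} {T x} a k))
        ... | inj₂ (f₃ , k) = inj₂ (≗⇒≈ {z} {y} (⊆-antisym {T z} {T y} below b))
          where
          module f₃ = Frame f₃
          holds₃ : T x (tgt f₃.α) f₃.σ ≡ true
          holds₃ = Simple.holds (frame-simple (closed x) f₃)
          T′-false₃ : F.T′ (tgt f₃.α) f₃.σ ≡ false
          T′-false₃ = ¬-not λ t → t≢f (b f₃.σ f₃.chain (trans (e f₃.σ f₃.chain) t)) k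
          hit₃ : Hits (IsFlip.f φ) (tgt f₃.α) f₃.σ
          hit₃ with F.T′-false T′-false₃ holds₃
          ... | v , s , P , h′ with F.simple-hit (all-good (closed x)) (frame-simple (closed x) f₃) f₃.chain P h′
          ... | refl , refl = h′
          below : T z ⊆ᵀ T y
          below s c t = trans (e s c) (F.T′-largest (closed z) (hits-false (IsFlip.f φ) (closed z) hit₃ k) (a s c t) t)

      -- `compare` yields a frame of `T x` whose string is missing from `T y`. The flip there gives
      -- a class between `T y` and `T x`, different from `T x`, so the cover relation forces it to
      -- be `T y`.
      covers-flip : ∀ {x y} → Covers (Lattice.poset L) y x → IsFlip (T x) (T y)
      covers-flip {x} {y} (x⊑y , x≉y , between) with compare (closed x) (closed y)
      ... | inj₁ k = ⊥-elim (x≉y (≗⇒≈ {x} {y} (⊆-antisym {T x} {T y} k x⊑y)))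
      ... | inj₂ (f , k) = flip-of (closed x) f (⊆-antisym {T y} {F.T′} below above)
        where
        module F = Flip (closed x) f
        z : Carrier
        z = facet F.T′-closed
        below : T y ⊆ᵀ F.T′
        below s c t = F.T′-largest (closed y) k (x⊑y s c t) t
        above : F.T′ ⊆ᵀ T y
        above with between z (λ s c t → F.T′-⊆ (trans (sym (facet-T F.T′-closed s c)) t))
                             (λ s c t → trans (facet-T F.T′-closed s c) (below s c t))
        ... | inj₂ e = λ s c t → trans (sym (≈⇒≗ {z} {y} e s c)) (trans (facet-T F.T′-closed s c) t)
        ... | inj₁ e = ⊥-elim (t≢f (F.hit-holds (inj₁ (refl , refl)))
          (trans (sym (≈⇒≗ {z} {x} e (Frame.σ f) (Frame.chain f)))
            (trans (facet-T F.T′-closed (Frame.σ f) (Frame.chain f)) (F.T′-hit (inj₁ (refl , refl))))))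

-- Blossoming quivers as string systems

Two : ∀ {A : Set} → (A → Set) → Set
Two P = ∃₂ λ a b → a ≢ b × P a × P b

two-of-list : ∀ {A : Set} {P : A → Set} (xs : List A) → Unique xs → (∀ {x} → x ∈ˡ xs → P x) → 2 ≤ length xs → Two P
two-of-list (a ∷ b ∷ _) ((a≢b ∷ _) ∷ _) f _ = a , b , a≢b , f (here refl) , f (there (here refl))
two-of-list (_ ∷ []) _ _ (s≤s ())

-- The `2 ∸ length xs` values of j supply whatever the list lacks of two.
two-completed : ∀ {A B : Set} {P : A → Set} (xs : List A) → Unique xs → (∀ {x} → x ∈ˡ xs → P x) →
  (i : A → B) → (∀ {a b} → i a ≡ i b → a ≡ b) → (j : Fin (2 ∸ length xs) → B) → (∀ {a b} → j a ≡ j b → a ≡ b) →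
  (∀ a b → i a ≢ j b) → ∀ {R : B → Set} → (∀ {a} → P a → R (i a)) → (∀ b → R (j b)) → Two R
two-completed [] _ _ i _ j j-inj _ _ g = j fzero , j (fsuc fzero) , (λ e → contradiction (j-inj e) λ ()) , g _ , g _
two-completed (a ∷ []) _ f i _ j _ i≢j h g = i a , j fzero , i≢j a fzero , h (f (here refl)) , g _
two-completed (a ∷ b ∷ xs) u f i i-inj j _ _ h g with two-of-list (a ∷ b ∷ xs) u f (s≤s (s≤s z≤n))
... | c , d , c≢d , p , q = i c , i d , (λ e → c≢d (i-inj e)) , h p , h q

module Instance (Q : GentleBoundQuiver) (B : Blossoming Q) where
  open GentleBoundQuiver Q using (#V; #A; indeg; outdeg)
  private module Q = GentleBoundQuiver Q
  open Blossoming B using (R⊛; R⊛?; R⊛-composable; boundQuiver⊛; gentle⊛)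
  open Strings boundQuiver⊛
  open IsGentle gentle⊛

  A V : Set
  A = A⊛ Q
  V = V⊛ Q

  s t : A → V
  s = s⊛ Q
  t = t⊛ Q

  _≟ⱽ_ : DecidableEquality V
  vertex u ≟ⱽ vertex v = map′ (cong vertex) (λ { refl → refl }) (u Fin.≟ v)
  inBlossom u i ≟ⱽ inBlossom v j with u Fin.≟ v
  ... | no ¬e = no λ { refl → ¬e refl }
  ... | yes refl = map′ (cong (inBlossom u)) (λ { refl → refl }) (i Fin.≟ j)
  outBlossom u i ≟ⱽ outBlossom v j with u Fin.≟ v
  ... | no ¬e = no λ { refl → ¬e refl }
  ... | yes refl = map′ (cong (outBlossom u)) (λ { refl → refl }) (i Fin.≟ j)
  vertex _ ≟ⱽ inBlossom _ _ = no λ ()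
  vertex _ ≟ⱽ outBlossom _ _ = no λ ()
  inBlossom _ _ ≟ⱽ vertex _ = no λ ()
  inBlossom _ _ ≟ⱽ outBlossom _ _ = no λ ()
  outBlossom _ _ ≟ⱽ vertex _ = no λ ()
  outBlossom _ _ ≟ⱽ inBlossom _ _ = no λ ()

  _≟ᴬ_ : DecidableEquality A
  arrow u ≟ᴬ arrow v = map′ (cong arrow) (λ { refl → refl }) (u Fin.≟ v)
  inArrow u i ≟ᴬ inArrow v j with u Fin.≟ v
  ... | no ¬e = no λ { refl → ¬e refl }
  ... | yes refl = map′ (cong (inArrow u)) (λ { refl → refl }) (i Fin.≟ j)
  outArrow u i ≟ᴬ outArrow v j with u Fin.≟ v
  ... | no ¬e = no λ { refl → ¬e refl }
  ... | yes refl = map′ (cong (outArrow u)) (λ { refl → refl }) (i Fin.≟ j)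
  arrow _ ≟ᴬ inArrow _ _ = no λ ()
  arrow _ ≟ᴬ outArrow _ _ = no λ ()
  inArrow _ _ ≟ᴬ arrow _ = no λ ()
  inArrow _ _ ≟ᴬ outArrow _ _ = no λ ()
  outArrow _ _ ≟ᴬ arrow _ = no λ ()
  outArrow _ _ ≟ᴬ inArrow _ _ = no λ ()

  ⁺-inj : ∀ {α β} → α ⁺ ≡ β ⁺ → α ≡ β
  ⁺-inj refl = refl

  ⁻-inj : ∀ {α β} → α ⁻ ≡ β ⁻ → α ≡ β
  ⁻-inj refl = refl

  _≟ᴸ_ : DecidableEquality Letter
  (α ⁺) ≟ᴸ (β ⁺) = map′ (cong _⁺) ⁺-inj (α ≟ᴬ β)
  (α ⁻) ≟ᴸ (β ⁻) = map′ (cong _⁻) ⁻-inj (α ≟ᴬ β)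
  (α ⁺) ≟ᴸ (β ⁻) = no λ ()
  (α ⁻) ≟ᴸ (β ⁺) = no λ ()

  pos : Letter → Bool
  pos (_ ⁺) = true
  pos (_ ⁻) = false

  Related : Letter → Letter → Set
  Related (α ⁺) (β ⁺) = R⊛ α β
  Related (α ⁻) (β ⁻) = R⊛ β α
  Related (α ⁺) (β ⁻) = ⊥
  Related (α ⁻) (β ⁺) = ⊥

  related? : ∀ l m → Dec (Related l m)
  related? (α ⁺) (β ⁺) = R⊛? α β
  related? (α ⁻) (β ⁻) = R⊛? β α
  related? (α ⁺) (β ⁻) = no λ ()
  related? (α ⁻) (β ⁺) = no λ ()

  infix 4 _⇝_
  -- The ideal is generated in length two, so being a string is a condition on consecutive letters:
  -- composable, reduced and no relation.
  _⇝_ : Letter → Letter → Set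
  l ⇝ m = tgt l ≡ src m × m ≢ flip l × ¬ Related l m

  _⇝?_ : ∀ l m → Dec (l ⇝ m)
  l ⇝? m = (tgt l ≟ⱽ src m) ×-dec ¬? (m ≟ᴸ flip l) ×-dec ¬? (related? l m)

  src-flip : ∀ l → src (flip l) ≡ tgt l
  src-flip (_ ⁺) = refl
  src-flip (_ ⁻) = refl

  tgt-flip : ∀ l → tgt (flip l) ≡ src l
  tgt-flip (_ ⁺) = refl
  tgt-flip (_ ⁻) = refl

  related-flip : ∀ l m → Related (flip m) (flip l) → Related l m
  related-flip (α ⁺) (β ⁺) h = h
  related-flip (α ⁻) (β ⁻) h = h
  related-flip (α ⁺) (β ⁻) ()
  related-flip (α ⁻) (β ⁺) ()

  ⇝-flip : ∀ {l m} → l ⇝ m → flip m ⇝ flip l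
  ⇝-flip {l} {m} (e , h , k) =
    trans (tgt-flip m) (trans (sym e) (sym (src-flip l))) ,
    (λ e′ → h (trans (trans (sym (flip-involutive m)) (sym e′)) refl)) ,
    (λ r → k (related-flip l m r))

  pair-∈I : ∀ {α β} → R⊛ α β → (α ∷ β ∷ []) ∈I
  pair-∈I r = (R⊛-composable r ∷ [-]) , _ , _ , r , here (refl ∷ refl ∷ [])

  ∈I-pair : ∀ {α β} → (α ∷ β ∷ []) ∈I → R⊛ α β
  ∈I-pair (_ , _ , _ , r , here (refl ∷ refl ∷ [])) = r
  ∈I-pair (_ , _ , _ , r , there (here (_ ∷ ())))
  ∈I-pair (_ , _ , _ , r , there (there (here ())))

  out-unique : ∀ {α β γ} → t α ≡ s β → t α ≡ s γ → ¬ R⊛ α β → ¬ R⊛ α γ → β ≡ γ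
  out-unique e f h k = after-∉ e f (h ∘ ∈I-pair) (k ∘ ∈I-pair)

  out-related : ∀ {α β γ} → R⊛ α β → R⊛ α γ → β ≡ γ
  out-related h k = after-∈ (pair-∈I h) (pair-∈I k)

  in-unique : ∀ {α β γ} → t α ≡ s γ → t β ≡ s γ → ¬ R⊛ α γ → ¬ R⊛ β γ → α ≡ β
  in-unique e f h k = before-∉ e f (h ∘ ∈I-pair) (k ∘ ∈I-pair)

  in-related : ∀ {α β γ} → R⊛ α γ → R⊛ β γ → α ≡ β
  in-related h k = before-∈ (pair-∈I h) (pair-∈I k)

  twoIn : ∀ v → Two λ α → t α ≡ vertex v
  twoIn v = two-completed (filter (λ α → Q.t α Fin.≟ v) (allFin #A)) (Unique.filter⁺ _ (Unique.allFin⁺ #A))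
    (λ i → proj₂ (∈-filter⁻ (λ α → Q.t α Fin.≟ v) {xs = allFin #A} i)) arrow (λ { refl → refl }) (inArrow v) (λ { refl → refl })
    (λ _ _ ()) (cong vertex) (λ _ → refl)

  twoOut : ∀ v → Two λ α → s α ≡ vertex v
  twoOut v = two-completed (filter (λ α → Q.s α Fin.≟ v) (allFin #A)) (Unique.filter⁺ _ (Unique.allFin⁺ #A))
    (λ i → proj₂ (∈-filter⁻ (λ α → Q.s α Fin.≟ v) {xs = allFin #A} i)) arrow (λ { refl → refl }) (outArrow v) (λ { refl → refl })
    (λ _ _ ()) (cong vertex) (λ _ → refl)

  other : ∀ {P : A → Set} → Two P → ∀ α → ∃ λ β → P β × β ≢ α
  other (a , b , a≢b , p , q) α with a ≟ᴬ α
  ... | yes refl = b , q , λ e → a≢b (sym e)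
  ... | no h = a , p , h

  -- The blossoms provide two arrows into and two out of v. A change of sign takes the arrow other
  -- than that of l; keeping the sign takes one of two arrows, of which gentleness lets at most one
  -- form a relation with that of l.
  next : ∀ l {v} → tgt l ≡ vertex v → ∀ b → ∃ λ n → l ⇝ n × pos n ≡ b
  next (α ⁺) {v} e false with other (twoIn v) α
  ... | β , p , h = β ⁻ , (trans e (sym p) , (λ { refl → h refl }) , λ ()) , refl
  next (α ⁻) {v} e true with other (twoOut v) α
  ... | β , p , h = β ⁺ , (trans e (sym p) , (λ { refl → h refl }) , λ ()) , refl
  next (α ⁺) {v} e true with twoOut v
  ... | a , b , a≢b , p , q with R⊛? α a | R⊛? α b
  ... | no h | _ = a ⁺ , (trans e (sym p) , (λ ()) , h) , refl
  ... | yes _ | no h = b ⁺ , (trans e (sym q) , (λ ()) , h) , refl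
  ... | yes h | yes k = ⊥-elim (a≢b (out-related h k))
  next (α ⁻) {v} e false with twoIn v
  ... | a , b , a≢b , p , q with R⊛? a α | R⊛? b α
  ... | no h | _ = a ⁻ , (trans e (sym p) , (λ ()) , h) , refl
  ... | yes _ | no h = b ⁻ , (trans e (sym q) , (λ ()) , h) , refl
  ... | yes h | yes k = ⊥-elim (a≢b (in-related h k))

  Internal : V → Set
  Internal u = ∃ λ v → u ≡ vertex v

  -- A blossom vertex carries a single arrow, so only the inverse of l could follow there.
  ⇝-internal : ∀ {l m} → l ⇝ m → Internal (tgt l)
  ⇝-internal {l} {m} (e , h , _) = go l m e h
    where
    go : ∀ l m → tgt l ≡ src m → m ≢ flip l → Internal (tgt l)
    go (arrow _ ⁺) _ _ _ = _ , refl
    go (inArrow _ _ ⁺) _ _ _ = _ , refl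
    go (arrow _ ⁻) _ _ _ = _ , refl
    go (outArrow _ _ ⁻) _ _ _ = _ , refl
    go (outArrow v i ⁺) (outArrow _ _ ⁻) refl h = ⊥-elim (h refl)
    go (outArrow v i ⁺) (arrow _ ⁺) () _
    go (outArrow v i ⁺) (arrow _ ⁻) () _
    go (outArrow v i ⁺) (inArrow _ _ ⁺) () _
    go (outArrow v i ⁺) (inArrow _ _ ⁻) () _
    go (outArrow v i ⁺) (outArrow _ _ ⁺) () _
    go (inArrow v i ⁻) (inArrow _ _ ⁺) refl h = ⊥-elim (h refl)
    go (inArrow v i ⁻) (arrow _ ⁺) () _
    go (inArrow v i ⁻) (arrow _ ⁻) () _
    go (inArrow v i ⁻) (outArrow _ _ ⁺) () _
    go (inArrow v i ⁻) (outArrow _ _ ⁻) () _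
    go (inArrow v i ⁻) (inArrow _ _ ⁻) () _

  continues? : ∀ l → Dec (∃ λ m → l ⇝ m)
  continues? l = at (tgt l) refl
    where
    at : ∀ u → tgt l ≡ u → Dec (∃ λ m → l ⇝ m)
    at (vertex v) e with next l e true
    ... | n , h , _ = yes (n , h)
    at (inBlossom v i) e = no λ (m , h) → contradiction (trans (sym e) (proj₂ (⇝-internal h))) λ ()
    at (outBlossom v i) e = no λ (m , h) → contradiction (trans (sym e) (proj₂ (⇝-internal h))) λ ()

  succ-unique : ∀ {l m n} → l ⇝ m → l ⇝ n → pos m ≡ pos n → m ≡ n
  succ-unique {α ⁺} {β ⁺} {γ ⁺} (e , _ , h) (f , _ , k) _ = cong _⁺ (out-unique e f h k)
  succ-unique {α ⁻} {β ⁻} {γ ⁻} (e , _ , h) (f , _ , k) _ = cong _⁻ (in-unique (sym e) (sym f) h k)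
  succ-unique {α ⁺} {β ⁻} {γ ⁻} (e , h , _) (f , k , _) _ with in≤2 e (trans (sym e) f)
  ... | inj₁ refl = ⊥-elim (h refl)
  ... | inj₂ (inj₁ refl) = refl
  ... | inj₂ (inj₂ refl) = ⊥-elim (k refl)
  succ-unique {α ⁻} {β ⁺} {γ ⁺} (e , h , _) (f , k , _) _ with out≤2 e (trans (sym e) f)
  ... | inj₁ refl = ⊥-elim (h refl)
  ... | inj₂ (inj₁ refl) = refl
  ... | inj₂ (inj₂ refl) = ⊥-elim (k refl)
  succ-unique {_} {_ ⁺} {_ ⁻} _ _ ()
  succ-unique {_} {_ ⁻} {_ ⁺} _ _ ()

  pred-unique : ∀ {k l m} → k ⇝ m → l ⇝ m → pos k ≡ pos l → k ≡ l
  pred-unique {k} {l} h h′ e = trans (sym (flip-involutive k)) (trans (cong flip (succ-unique (⇝-flip h) (⇝-flip h′) (pos-flips k l e))) (flip-involutive l))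
    where
    pos-flips : ∀ k l → pos k ≡ pos l → pos (flip k) ≡ pos (flip l)
    pos-flips (_ ⁺) (_ ⁺) _ = refl
    pos-flips (_ ⁻) (_ ⁻) _ = refl

  -- Letters of equal sign with a common successor are equal. Letters α⁺ and γ⁻ enter from the same
  -- side when αγ is a relation, and gentleness then matches their successors of either sign.
  swap : ∀ {k l m n} → k ⇝ m → l ⇝ m → k ⇝ n → l ⇝ n
  swap {k} {l} {m} {n} a b c = go k l m n a b c
    where
    go : ∀ k l m n → k ⇝ m → l ⇝ m → k ⇝ n → l ⇝ n
    go (α ⁺) (γ ⁺) m n a b c with pred-unique a b refl
    ... | refl = c
    go (α ⁻) (γ ⁻) m n a b c with pred-unique a b refl
    ... | refl = c
    go k@(α ⁺) l@(γ ⁻) m@(_ ⁺) n@(_ ⁺) a b c with succ-unique {k} a c refl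
    ... | refl = b
    go k@(α ⁺) l@(γ ⁻) m@(_ ⁻) n@(_ ⁻) a b c with succ-unique {k} a c refl
    ... | refl = b
    go k@(α ⁻) l@(γ ⁺) m@(_ ⁺) n@(_ ⁺) a b c with succ-unique {k} a c refl
    ... | refl = b
    go k@(α ⁻) l@(γ ⁺) m@(_ ⁻) n@(_ ⁻) a b c with succ-unique {k} a c refl
    ... | refl = b
    go (α ⁺) (γ ⁻) (β ⁺) (δ ⁻) (e , _ , h) (e′ , h′ , _) (e″ , h″ , _) =
      trans e′ (trans (sym e) e″) , (λ ()) , λ r → h″ (cong _⁻ (in-related r αγ))
      where
      αγ : R⊛ α γ
      αγ with R⊛? α γ
      ... | yes r = r
      ... | no ¬r = ⊥-elim (h′ (cong _⁺ (out-unique e (trans e (sym e′)) h ¬r)))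
    go (α ⁺) (γ ⁻) (δ ⁻) (β ⁺) (e , h , _) (e′ , _ , h′) (e″ , _ , h″) =
      trans e′ (trans (sym e) e″) , (λ { refl → h (cong _⁻ (in-unique (sym e′) e″ h′ h″)) }) , λ ()
    go (γ ⁻) (α ⁺) (β ⁺) (δ ⁻) (e , h , _) (e′ , _ , h′) (e″ , _ , h″) =
      trans e′ (trans (sym e) e″) , (λ { refl → h (cong _⁺ (out-unique e′ (sym e″) h′ h″)) }) , λ ()
    go (γ ⁻) (α ⁺) (δ ⁻) (β ⁺) (e , _ , h) (e′ , h′ , _) (e″ , h″ , _) =
      trans e′ (trans (sym e) e″) , (λ ()) , λ r → h″ (cong _⁺ (out-related r αγ))
      where
      αγ : R⊛ α γ
      αγ with R⊛? α γ
      ... | yes r = r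
      ... | no ¬r = ⊥-elim (h′ (cong _⁻ (in-unique (sym e) (trans e′ (sym e)) h ¬r)))

  -- If k followed by `flip l` were a relation, k and l would enter from the same side, and n could
  -- follow k as it follows l.
  orient : ∀ {k l m n} → k ⇝ m → l ⇝ n → tgt k ≡ tgt l → k ⇝ n ⊎ k ⇝ flip l
  orient {k} {l} {m} {n} _ c e with k ⇝? n
  ... | yes h = inj₁ h
  ... | no ¬h = inj₂ (trans e (sym (src-flip l)) , (λ f → ¬h (subst (_⇝ n) (flip-inj f) c)) , go k l n c e ¬h)
    where
    flip-inj : flip l ≡ flip k → l ≡ k
    flip-inj f = trans (sym (flip-involutive l)) (trans (cong flip f) (flip-involutive k))
    go : ∀ k l n → l ⇝ n → tgt k ≡ tgt l → ¬ k ⇝ n → ¬ Related k (flip l)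
    go (α ⁺) (β ⁺) _ _ _ _ ()
    go (α ⁻) (β ⁻) _ _ _ _ ()
    go (α ⁺) (β ⁻) (δ ⁻) (f , _ , h) e ¬k r with δ ≟ᴬ α
    ... | yes refl = h r
    ... | no δ≢α = ¬k (trans e f , (λ { refl → δ≢α refl }) , λ ())
    go (α ⁺) (β ⁻) (γ ⁺) (f , h , _) e ¬k r =
      ¬k (trans e f , (λ ()) , λ r′ → h (cong _⁺ (out-related r′ r)))
    go (α ⁻) (β ⁺) (γ ⁺) (f , _ , h) e ¬k r with γ ≟ᴬ α
    ... | yes refl = h r
    ... | no γ≢α = ¬k (trans e f , (λ { refl → γ≢α refl }) , λ ())
    go (α ⁻) (β ⁺) (δ ⁻) (f , h , _) e ¬k r =
      ¬k (trans e f , (λ ()) , λ r′ → h (cong _⁻ (in-related r′ r)))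

  infix-split : ∀ {A : Set} {as bs : List A} → Infix _≡_ as bs → ∃₂ λ x y → bs ≡ x ++ as ++ y
  infix-split (here p) = let (y , e) = prefix p in [] , y , e
    where
    prefix : ∀ {as bs} → Prefix _≡_ as bs → ∃ λ y → bs ≡ as ++ y
    prefix [] = _ , refl
    prefix (refl ∷ p) with prefix p
    ... | y , refl = y , refl
  infix-split {bs = b ∷ _} (there i) with infix-split i
  ... | x , y , refl = b ∷ x , y , refl

  split-infix : ∀ {A : Set} x {as y : List A} → Infix _≡_ as (x ++ as ++ y)
  split-infix [] {as} = here (prefix as)
    where
    prefix : ∀ as {y} → Prefix _≡_ as (as ++ y)
    prefix [] = []
    prefix (a ∷ as) = refl ∷ prefix as
  split-infix (_ ∷ x) = there (split-infix x)

  positive-path : ∀ {l} w → ChainOf _⇝_ l w → All (λ m → pos m ≡ true) w → ∃ λ π → w ≡ map _⁺ π × Path π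
  positive-path [] _ _ = [] , refl , []
  positive-path (α ⁺ ∷ w) (_ , c) (_ ∷ a) with positive-path w c a
  ... | [] , refl , _ = α ∷ [] , refl , [-]
  ... | β ∷ π , refl , p = α ∷ β ∷ π , refl , proj₁ (proj₁ c) ∷ p
  positive-path (α ⁻ ∷ w) _ (() ∷ _)

  unrelated : ∀ {l} x {α β y} → ChainOf _⇝_ l (map _⁺ (x ++ α ∷ β ∷ y)) → ¬ R⊛ α β
  unrelated [] (_ , (_ , _ , h) , _) = h
  unrelated (_ ∷ x) (_ , c) = unrelated x c

  bounded : ∃ λ N → ∀ {l} w → ChainOf _⇝_ l w → All (λ m → pos m ≡ true) w → length w ≤ N
  bounded = proj₁ admissible , λ w c a → short w c (positive-path w c a)
    where
    short : ∀ {l} w → ChainOf _⇝_ l w → ∃ (λ π → w ≡ map _⁺ π × Path π) → length w ≤ proj₁ admissible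
    short _ c (π , refl , p) with proj₁ admissible ℕ.≤? length π
    ... | no h = subst (_≤ _) (sym (length-map _⁺ π)) (ℕ.<⇒≤ (ℕ.≰⇒> h))
    ... | yes h with proj₂ admissible p h
    ... | _ , α , β , r , i with infix-split i
    ... | x , y , refl = ⊥-elim (unrelated x c r)

  system : StringSystem
  system = record
    { Letter = Letter ; V = V ; _≟_ = _≟ᴸ_ ; _≟ⱽ_ = _≟ⱽ_
    ; flip = flip ; flip-flip = flip-involutive ; tgt = tgt ; pos = pos
    ; pos-flip = λ { (_ ⁺) → refl ; (_ ⁻) → refl }
    ; _⇝_ = _⇝_ ; ⇝-flip = λ {l} {m} → ⇝-flip {l} {m} ; ⇝-tgt = λ {l} {m} (e , _) → trans e (sym (tgt-flip m))
    ; continues? = continues?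
    ; succ = λ {l} {m} h b → next l (proj₂ (⇝-internal {l} {m} h)) b
    ; succ-unique = λ {l} {m} {n} → succ-unique {l} {m} {n}
    ; swap = λ {k} {l} {m} {n} → swap {k} {l} {m} {n}
    ; orient = λ {k} {l} {m} {n} → orient {k} {l} {m} {n}
    ; bounded = bounded
    }

-- Walks, facets and flips

module Walks (Q : GentleBoundQuiver) (B : Blossoming Q) where
  open NonKissing Q B public
  open Instance Q B public using (system; pos; _≟ᴸ_; Related; Internal; ⇝-internal; tgt-flip; src-flip; pair-∈I; infix-split; split-infix; twoOut)
  open Combinatorics system public hiding (Letter; V; flip; tgt; inv; _≈_; Distinguished; pos)
  module C = Combinatorics system

  adjacent : ∀ {l} r → Chain l r → ∀ x {a b} y → l ∷ r ≡ x ++ a ∷ b ∷ y → a ⇝ b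
  adjacent (_ ∷ r) (h , _) [] y refl = h
  adjacent (_ ∷ r) (_ , c) (_ ∷ x) y e = adjacent r c x y (proj₂ (∷-injective e))
  adjacent [] _ (_ ∷ []) y ()
  adjacent [] _ (_ ∷ _ ∷ _) y ()

  chain-of-adjacent : ∀ {w} → (∀ x {a b} y → w ≡ x ++ a ∷ b ∷ y → a ⇝ b) → ∀ x {l} r → w ≡ x ++ l ∷ r → Chain l r
  chain-of-adjacent f x [] e = tt
  chain-of-adjacent f x {l} (m ∷ r) e = f x r e , chain-of-adjacent f (x ++ l ∷ []) r (trans e (sym (snoc-assoc x)))

  joins-chain : ∀ {l} r → Chain l r → Joins (tgt l) r (tgt (lastOf l r))
  joins-chain [] _ = refl
  joins-chain (_ ∷ r) ((e , _) , c) = e , joins-chain r c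

  joins-ends : ∀ {u l v} r → Joins u (l ∷ r) v → u ≡ src l × v ≡ tgt (lastOf l r)
  joins-ends [] (e , f) = e , sym f
  joins-ends (m ∷ r) (e , j) = e , proj₂ (joins-ends r j)

  joins-adjacent : ∀ {u v} x {a b} y → Joins u (x ++ a ∷ b ∷ y) v → tgt a ≡ src b
  joins-adjacent [] y (_ , e , _) = e
  joins-adjacent (_ ∷ x) y (_ , j) = joins-adjacent x y j

  joins-snoc : ∀ {u} x m → Joins u x (src m) → Joins u (x ++ m ∷ []) (tgt m)
  joins-snoc [] m e = e , refl
  joins-snoc (_ ∷ x) m (e , j) = e , joins-snoc x m j

  joins-inv : ∀ {u v} w → Joins u w v → Joins v (inv w) u
  joins-inv [] e = sym e
  joins-inv {v = v} (l ∷ w) (refl , j) = subst (λ x → Joins v x (src l)) (sym (inv-∷ l w))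
    (subst (Joins v (inv w ++ flip l ∷ [])) (tgt-flip l)
      (joins-snoc (inv w) (flip l) (subst (Joins v (inv w)) (sym (src-flip l)) (joins-inv w j))))

  string-chain : ∀ {u v} w → IsString (word u w v) → ∀ x {l} r → w ≡ x ++ l ∷ r → Chain l r
  string-chain {u} {v} w S = chain-of-adjacent λ x {a} {b} y e →
    joins-adjacent x y (subst (λ w → Joins u w v) e composable) ,
    (λ { refl → reduced a (subst (Infix _≡_ _) (sym e) (split-infix x)) }) ,
    unrelated x y a b e
    where
    open IsString S
    unrelated : ∀ x y a b → w ≡ x ++ a ∷ b ∷ y → ¬ Related a b
    unrelated x y (α ⁺) (β ⁺) e r = proj₁ (avoids (pair-∈I r)) (subst (Infix _≡_ _) (sym e) (split-infix x))
    unrelated x y (α ⁻) (β ⁻) e r = proj₂ (avoids (pair-∈I r)) (subst (Infix _≡_ _) (sym e) (split-infix x))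
    unrelated x y (α ⁺) (β ⁻) e ()
    unrelated x y (α ⁻) (β ⁺) e ()

  chain-string : ∀ l r → Chain l r → IsString (word (src l) (l ∷ r) (tgt (lastOf l r)))
  chain-string l r c = record
    { composable = refl , joins-chain r c
    ; reduced = λ k i → let (x , y , e) = infix-split i in proj₁ (proj₂ (adjacent r c x y e)) refl
    ; avoids = λ { (_ , α , β , h , i) → let (x , y , e) = infix-split i in
        (λ j → let (x′ , y′ , e′) = infix-split j in forward x y e x′ y′ e′ h) ,
        (λ j → let (x′ , y′ , e′) = infix-split j in backward x y e x′ y′ e′ h) }
    }
    where
    forward : ∀ {π α β} x y → π ≡ x ++ α ∷ β ∷ y → ∀ x′ y′ → l ∷ r ≡ x′ ++ map _⁺ π ++ y′ → ¬ Related (α ⁺) (β ⁺)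
    forward {α = α} {β} x y refl x′ y′ e = proj₂ (proj₂ (adjacent r c (x′ ++ map _⁺ x) (map _⁺ y ++ y′)
      (trans e (trans (cong (λ z → x′ ++ z ++ y′) (map-++ _⁺ x (α ∷ β ∷ y)))
        (trans (cong (x′ ++_) (++-assoc (map _⁺ x) (α ⁺ ∷ β ⁺ ∷ map _⁺ y) y′))
          (sym (++-assoc x′ (map _⁺ x) (α ⁺ ∷ β ⁺ ∷ map _⁺ y ++ y′))))))))
    backward : ∀ {π α β} x y → π ≡ x ++ α ∷ β ∷ y → ∀ x′ y′ → l ∷ r ≡ x′ ++ inv (map _⁺ π) ++ y′ → ¬ Related (α ⁺) (β ⁺)
    backward {α = α} {β} x y refl x′ y′ e = proj₂ (proj₂ (adjacent r c (x′ ++ inv (map _⁺ y)) (inv (map _⁺ x) ++ y′)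
      (trans e (trans (cong (λ z → x′ ++ inv z ++ y′) (map-++ _⁺ x (α ∷ β ∷ y)))
        (trans (cong (λ z → x′ ++ z ++ y′) (inv-cut₂ (map _⁺ x) [] (map _⁺ y)))
          (trans (cong (x′ ++_) (++-assoc (inv (map _⁺ y)) (β ⁻ ∷ α ⁻ ∷ inv (map _⁺ x)) y′))
            (sym (++-assoc x′ (inv (map _⁺ y)) (β ⁻ ∷ α ⁻ ∷ inv (map _⁺ x) ++ y′)))))))))

  leaving : ∀ u → ∃ λ l → src l ≡ u
  leaving (vertex v) = let (α , _ , _ , e , _) = twoOut v in α ⁺ , e
  leaving (inBlossom v i) = inArrow v i ⁺ , refl
  leaving (outBlossom v i) = outArrow v i ⁻ , refl

  lastOf-snoc : ∀ l r {m} → lastOf l (r ++ m ∷ []) ≡ m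
  lastOf-snoc l [] = refl
  lastOf-snoc l (k ∷ r) = lastOf-snoc k r

  is-walk : ∀ ω → IsWalk (lettersʷ ω)
  -- A word of length zero is not maximal, as some letter leaves every vertex, blossoms included.
  is-walk (walk (word u [] v) M) = ⊥-elim (maximalʳ l (trans e (IsString.composable isString))
    (subst (λ u → IsString (word u (l ∷ []) (tgt l))) e (chain-string l [] tt)))
    where
    open IsMaximalString M
    l = proj₁ (leaving u)
    e = proj₂ (leaving u)
  is-walk (walk (word u (l ∷ r) v) M) =
    (λ m h → maximalˡ (flip m) (trans (proj₁ (back h)) (sym u≡))
      (subst (λ v → IsString (word (src (flip m)) (flip m ∷ l ∷ r) v)) (sym v≡) (chain-string (flip m) (l ∷ r) (back h , c)))) ,
    ray-stop r c λ m h → maximalʳ m (trans (sym (proj₁ h)) (sym v≡))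
      (subst₂ (λ u v → IsString (word u (l ∷ r ++ m ∷ []) v)) (sym u≡) (cong tgt (lastOf-snoc l r)) (chain-string l (r ++ m ∷ []) (chain-snoc r c h)))
    where
    open IsMaximalString M
    c : Chain l r
    c = string-chain (l ∷ r) isString [] r refl
    u≡ = proj₁ (joins-ends {l = l} r (IsString.composable isString))
    v≡ = proj₂ (joins-ends {l = l} r (IsString.composable isString))
    back : ∀ {m} → flip l ⇝ m → flip m ⇝ l
    back {m} h = subst (flip m ⇝_) (flip-involutive l) (⇝-flip h)

  toWalk : ∀ {w} → IsWalk w → Walk
  toWalk {l ∷ r} (t , ray) = walk (word (src l) (l ∷ r) (tgt (lastOf l r))) record
    { isString = chain-string l r (ray-chain r ray)
    ; maximalˡ = λ m _ S → t (flip m) (⇝-flip (proj₁ (string-chain (m ∷ l ∷ r) S [] (l ∷ r) refl)))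
    ; maximalʳ = λ m _ S → ray-end r ray (string-chain (l ∷ r ++ m ∷ []) S [] (r ++ m ∷ []) refl)
    }

  letters-toWalk : ∀ {w} (h : IsWalk w) → lettersʷ (toWalk h) ≡ w
  letters-toWalk {l ∷ r} _ = refl

  word-unique : ∀ {u v u′ v′} w → IsWalk w → Joins u w v → Joins u′ w v′ → word u w v ≡ word u′ w v′
  word-unique (l ∷ r) _ j j′ with joins-ends {l = l} r j | joins-ends {l = l} r j′
  ... | refl , refl | refl , refl = refl

  private
    joins : ∀ ω → Joins (source (toWord ω)) (lettersʷ ω) (target (toWord ω))
    joins ω = IsString.composable (IsMaximalString.isString (isMaximalString ω))

  letters-≈ : ∀ ω ω′ → lettersʷ ω ≡ lettersʷ ω′ ⊎ inv (lettersʷ ω) ≡ lettersʷ ω′ → ω ≈ʷ ω′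
  letters-≈ ω@(walk (word u w v) _) ω′@(walk (word u′ _ v′) _) (inj₁ refl) = inj₁ (word-unique w (is-walk ω) (joins ω) (joins ω′))
  letters-≈ ω@(walk (word u w v) _) ω′@(walk (word u′ _ v′) _) (inj₂ refl) =
    inj₂ (word-unique (inv w) (is-walk ω′) (joins-inv w (joins ω)) (joins ω′))

  ≈-letters : ∀ {ω ω′} → ω ≈ʷ ω′ → lettersʷ ω ≡ lettersʷ ω′ ⊎ inv (lettersʷ ω) ≡ lettersʷ ω′
  ≈-letters (inj₁ e) = inj₁ (cong letters e)
  ≈-letters (inj₂ e) = inj₂ (cong letters e)

  -- Having a letter before and after puts the word within Q₀ and fixes its endpoints, independently
  -- of the walk in which it is found.
  Inner : Word → Set
  Inner σ = ∃₂ λ l m → tgt l ≡ source σ × Chain l (letters σ ++ m ∷ []) × src m ≡ target σ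

  inner-inv : ∀ {σ} → Inner σ → Inner (σ ⁻¹)
  inner-inv {word u w v} (l , m , e , c , f) =
    flip m , flip l , trans (tgt-flip m) f , chain-inv w c , trans (src-flip l) e

  Occᵂ : Bool → List Letter → Word → Set
  Occᵂ b w σ = Occ b w (source σ) (letters σ)

  occᵂ-inner : ∀ {b w v s} → IsWalk w → (o : Occ b w v s) → Inner (word v s (src (Occ.m o)))
  occᵂ-inner wk o = _ , _ , Occ.at o , occ-context wk o , refl

  occᵂ-inv : ∀ {b w σ} → IsWalk w → Inner σ → Occᵂ b w σ → Occᵂ b (inv w) (σ ⁻¹)
  occᵂ-inv {b} {w} {word u s v} wk (l , m , e , c , f) o =
    subst (λ v → Occ b (inv w) v (inv s)) (trans (tgt-flip m) f) (occ-inv wk o e c)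

  occᵂ-inv⁻ : ∀ {b w σ} → IsWalk w → Inner σ → Occᵂ b (inv w) σ → Occᵂ b w (σ ⁻¹)
  occᵂ-inv⁻ {b} {w} {σ} wk i o = subst (λ w → Occᵂ b w (σ ⁻¹)) (inv-inv w) (occᵂ-inv (walk-inv wk) i o)

  Sub : Bool → Walk → Word → Set
  Sub b ω = UpToInversion λ σ → ∃₂ λ x y → ∃₂ λ l m → Occurs ω x l σ m y × pos l ≡ b × pos m ≡ not b

  -- Inverts the walk instead of the substring, which replaces `UpToInversion` in the arguments
  -- about kissing.
  Either : Bool → List Letter → Word → Set
  Either b w σ = Occᵂ b w σ ⊎ Occᵂ b (inv w) σ

  internal : ∀ {l} s {m} → Chain l (s ++ m ∷ []) → All Internal (tgt l ∷ map tgt s)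
  internal {l} [] {m} (h , _) = ⇝-internal {l} {m} h ∷ []
  internal {l} (k ∷ s) (h , c) = ⇝-internal {l} {k} h ∷ internal s c

  occurs-occᵂ : ∀ {b ω x l σ m y} → Occurs ω x l σ m y → pos l ≡ b → pos m ≡ not b → Occᵂ b (lettersʷ ω) σ
  occurs-occᵂ {x = x} {y = y} o i j = occ x y (Occurs.factors o) (sym (Occurs.starts o)) i j

  occᵂ-occurs : ∀ {b ω σ} → Inner σ → (o : Occᵂ b (lettersʷ ω) σ) → Occurs ω (Occ.x o) (Occ.l o) σ (Occ.m o) (Occ.y o)
  occᵂ-occurs {ω = ω} {word u s v} (l , m , e , c , f) o = record
    { factors = Occ.reads o
    ; starts = sym (Occ.at o)
    ; ends = trans (sym f) (trans (sym (tgt-flip m)) (trans (chain-end s c d (trans e (sym (Occ.at o)))) (tgt-flip (Occ.m o))))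
    ; inQ₀ = subst (λ v → All Internal (v ∷ map tgt s)) (Occ.at o) (internal s d)
    }
    where
    d : Chain (Occ.l o) (s ++ Occ.m o ∷ [])
    d = occ-context (is-walk ω) o

  occurs-inner : ∀ {ω x l σ m y} → Occurs ω x l σ m y → Inner σ
  occurs-inner {ω} {x} {l} {word u s v} {m} o = l , m , sym (Occurs.starts o) ,
    chain-cut s (walk-chain x (subst IsWalk (Occurs.factors o) (is-walk ω))) , sym (Occurs.ends o)

  sub-either : ∀ {b ω σ} → Sub b ω σ → Inner σ × Either b (lettersʷ ω) σ
  sub-either (τ , inj₁ refl , x , y , l , m , o , i , j) = occurs-inner o , inj₁ (occurs-occᵂ o i j)
  sub-either {ω = ω} (τ , inj₂ refl , x , y , l , m , o , i , j) =
    inner-inv (occurs-inner o) , inj₂ (occᵂ-inv (is-walk ω) (occurs-inner o) (occurs-occᵂ o i j))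

  either-sub : ∀ {b ω σ} → Inner σ → Either b (lettersʷ ω) σ → Sub b ω σ
  either-sub {σ = σ} i (inj₁ o) = σ , inj₁ refl , _ , _ , _ , _ , occᵂ-occurs i o , Occ.signˡ o , Occ.signʳ o
  either-sub {ω = ω} {σ} i (inj₂ o) = σ ⁻¹ , inj₂ (⁻¹-involutive σ) , _ , _ , _ , _ , occᵂ-occurs (inner-inv i) o′ , Occ.signˡ o′ , Occ.signʳ o′
    where o′ = occᵂ-inv⁻ (is-walk ω) i o

  negative : ∀ {l} → pos l ≡ false → ∃ λ α → l ≡ α ⁻
  negative {α ⁻} _ = α , refl

  positive : ∀ {l} → pos l ≡ true → ∃ λ α → l ≡ α ⁺
  positive {α ⁺} _ = α , refl

  top-sub⁺ : ∀ {ω σ} → TopSubstring ω σ → Sub false ω σ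
  top-sub⁺ (τ , e , x , y , α , β , o) = τ , e , x , y , _ , _ , o , refl , refl

  top-sub⁻ : ∀ {ω σ} → Sub false ω σ → TopSubstring ω σ
  top-sub⁻ (τ , e , x , y , l , m , o , i , j) with negative {l} i | positive {m} j
  ... | α , refl | β , refl = τ , e , x , y , α , β , o

  bottom-sub⁺ : ∀ {ω σ} → BottomSubstring ω σ → Sub true ω σ
  bottom-sub⁺ (τ , e , x , y , α , β , o) = τ , e , x , y , _ , _ , o , refl , refl

  bottom-sub⁻ : ∀ {ω σ} → Sub true ω σ → BottomSubstring ω σ
  bottom-sub⁻ (τ , e , x , y , l , m , o , i , j) with positive {l} i | negative {m} j
  ... | α , refl | β , refl = τ , e , x , y , α , β , o

  kisses⁻ : ∀ {ω ω′} → Kisses ω ω′ → ∃ λ σ → Inner σ × Either false (lettersʷ ω) σ × Either true (lettersʷ ω′) σ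
  kisses⁻ (σ , a , b) = let (i , o) = sub-either (top-sub⁺ a) in σ , i , o , proj₂ (sub-either (bottom-sub⁺ b))

  kisses⁺ : ∀ {ω ω′ σ} → Inner σ → Either false (lettersʷ ω) σ → Either true (lettersʷ ω′) σ → Kisses ω ω′
  kisses⁺ {ω} {ω′} {σ} i a b = σ , top-sub⁻ {ω} (either-sub i a) , bottom-sub⁻ {ω′} (either-sub i b)

  data Signs (w : List Letter) : Set where
    up   : ∀ π → w ≡ map _⁺ π → Signs w
    down : ∀ π → w ≡ map _⁻ π → Signs w
    bend : ∀ {b v s} → Occ b w v s → Signs w

  -- Consecutive letters of opposite sign enclose an occurrence of length zero; without such a pair
  -- the word is a path or the inverse of one.
  signs : ∀ w → Signs w
  signs [] = up [] refl
  signs (l ∷ w) with signs w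
  signs (l ∷ w) | bend (occ x y refl e i j) = bend (occ (l ∷ x) y refl e i j)
  signs (α ⁺ ∷ w) | up π refl = up (α ∷ π) refl
  signs (α ⁻ ∷ w) | down π refl = down (α ∷ π) refl
  signs (α ⁻ ∷ w) | up [] refl = down (α ∷ []) refl
  signs (α ⁺ ∷ w) | down [] refl = up (α ∷ []) refl
  signs (α ⁻ ∷ w) | up (β ∷ π) refl = bend (occ {s = []} [] (map _⁺ π) refl refl refl refl)
  signs (α ⁺ ∷ w) | down (β ∷ π) refl = bend (occ {s = []} [] (map _⁻ π) refl refl refl refl)

  inv-up : ∀ π → map _⁻ π ≡ inv (map _⁺ (reverse π))
  inv-up π = trans (cong (map _⁻) (sym (reverse-involutive π)))
    (trans (reverse-map _⁻ (reverse π)) (cong reverse (map-∘ (reverse π))))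

  up-occ : ∀ {b v s} π → ¬ Occ b (map _⁺ π) v s
  up-occ {b} π (occ x {l} {m} y e _ i j) = contra (signs-of π x e) (tail π x e)
    where
    signs-of : ∀ π x {l y} → map _⁺ π ≡ x ++ l ∷ y → pos l ≡ true
    signs-of (_ ∷ π) [] refl = refl
    signs-of (_ ∷ π) (_ ∷ x) e = signs-of π x (proj₂ (∷-injective e))
    tail : ∀ π x {l s m y} → map _⁺ π ≡ x ++ l ∷ s ++ m ∷ y → pos m ≡ true
    tail π x {l} {s} e = signs-of π (x ++ l ∷ s) (trans e (sym (assoc∷ x s)))
    contra : pos l ≡ true → pos m ≡ true → ⊥
    contra p q = b≢notb (trans (trans (sym i) p) (trans (sym q) j))

  straight-occ : ∀ {ω b v s} → Straight ω → ¬ Occ b (lettersʷ ω) v s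
  straight-occ {b = b} {v} {s} (π , inj₁ e) o = up-occ π (subst (λ w → Occ b w v s) e o)
  straight-occ {ω} {b} {v} {s} (π , inj₂ e) o = up-occ π (subst (λ w → Occ b w _ (inv s))
    (trans (cong inv e) (inv-inv (map _⁺ π))) (occ-inv (is-walk ω) o (Occ.at o) (occ-context (is-walk ω) o)))

  straight-or-bends : ∀ ω → Straight ω ⊎ ∃ λ b → ∃₂ λ v s → Occ b (lettersʷ ω) v s
  straight-or-bends ω with signs (lettersʷ ω)
  ... | up π e = inj₁ (π , inj₁ e)
  ... | down π e = inj₁ (reverse π , inj₂ (trans e (inv-up π)))
  ... | bend o = inj₂ (_ , _ , _ , o)

  bends : ∀ {ω} → Bending ω → ∃ λ b → ∃₂ λ v s → Occ b (lettersʷ ω) v s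
  bends {ω} h with straight-or-bends ω
  ... | inj₁ s = ⊥-elim (h s)
  ... | inj₂ o = o

-- Facets and their torsion classes.

module Facets (Q : GentleBoundQuiver) (B : Blossoming Q) (finite : Finite (NonKissing.reducedFaceSetoid Q B)) where
  open Walks Q B

  faces : List ReducedFace
  faces = proj₁ finite

  wordsOf : List Walk → List (List Letter)
  wordsOf = map lettersʷ

  wordsOf-walks : ∀ F → All IsWalk (wordsOf F)
  wordsOf-walks F = All.map⁺ (All.universal is-walk F)

  W : List (List Letter)
  W = concatMap (λ R → wordsOf (proj₁ R)) faces

  W-walks : All IsWalk W
  W-walks = All.concat⁺ (All.map⁺ (All.universal (λ R → wordsOf-walks (proj₁ R)) faces))

  member-letters : ∀ {F ω} → ω ∈ F → Member (wordsOf F) (lettersʷ ω)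
  member-letters {F} {ω} i = Any.map⁺ (Any.map (λ {ω′} e → conv ω′ (≈-letters {ω} {ω′} e)) i)
    where
    conv : ∀ ω′ → lettersʷ ω ≡ lettersʷ ω′ ⊎ inv (lettersʷ ω) ≡ lettersʷ ω′ → lettersʷ ω′ ≡ lettersʷ ω ⊎ inv (lettersʷ ω′) ≡ lettersʷ ω
    conv ω′ (inj₁ e) = inj₁ (sym e)
    conv ω′ (inj₂ e) = inj₂ (trans (cong inv (sym e)) (inv-inv (lettersʷ ω)))

  letters-member : ∀ {F ω} → Member (wordsOf F) (lettersʷ ω) → ω ∈ F
  letters-member {F} {ω} k = Any.map (λ {ω′} e → letters-≈ ω ω′ (conv ω′ e)) (Any.map⁻ k)
    where
    conv : ∀ ω′ → lettersʷ ω′ ≡ lettersʷ ω ⊎ inv (lettersʷ ω′) ≡ lettersʷ ω → lettersʷ ω ≡ lettersʷ ω′ ⊎ inv (lettersʷ ω) ≡ lettersʷ ω′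
    conv ω′ (inj₁ e) = inj₁ (sym e)
    conv ω′ (inj₂ e) = inj₂ (trans (cong inv (sym e)) (inv-inv (lettersʷ ω′)))

  member-elim : ∀ {F w} → Member (wordsOf F) w → ∃ λ ω → ω ∈ F × (lettersʷ ω ≡ w ⊎ inv (lettersʷ ω) ≡ w)
  member-elim {F} k with find (Any.map⁻ k)
  ... | ω , i , e = ω , Any.map (λ { refl → inj₁ refl }) i , e

  member-⊆ : ∀ {F F′ w} → F ⊆ F′ → Member (wordsOf F) w → Member (wordsOf F′) w
  member-⊆ {F} {F′} a k with member-elim {F} k
  ... | ω , i , inj₁ refl = member-letters {F′} {ω} (a {ω} i)
  ... | ω , i , inj₂ refl = member-inv (member-letters {F′} {ω} (a {ω} i))

  member-W : ∀ {R w} → R ∈ˡ faces → Member (wordsOf (proj₁ R)) w → Member W w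
  member-W i k with find k
  ... | u , j , e = lose (∈-concatMap⁺ (λ R → wordsOf (proj₁ R)) (lose i j)) e

  occ-≈ : ∀ {b v s} ω {ω₁} → ω₁ ≈ʷ ω → Occ b (lettersʷ ω) v s → ∃₂ λ v s → Occ b (lettersʷ ω₁) v s
  occ-≈ {b} {v} {s} ω {ω₁} e o with ≈-letters {ω₁} {ω} e
  ... | inj₁ e′ = v , s , subst (λ w → Occ b w v s) (sym e′) o
  ... | inj₂ e′ = _ , _ , subst (λ w → Occ b w _ (inv s)) (trans (cong inv (sym e′)) (inv-inv (lettersʷ ω₁)))
                  (occ-inv (is-walk ω) o (Occ.at o) (occ-context (is-walk ω) o))

  occ-bending : ∀ {b v s ω} → Occ b (lettersʷ ω) v s → Bending ω
  occ-bending {ω = ω} o st = straight-occ {ω} st o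

  bending-≈ : ∀ {ω ω₁} → ω₁ ≈ʷ ω → Bending ω → Bending ω₁
  bending-≈ {ω} {ω₁} e h with bends {ω} h
  ... | b , v , s , o = occ-bending {ω = ω₁} (proj₂ (proj₂ (occ-≈ ω {ω₁} e o)))

  either-occIn : ∀ {b F ω σ} → ω ∈ F → Either b (lettersʷ ω) σ → OccIn b (wordsOf F) (source σ) (letters σ)
  either-occIn {ω = ω} i (inj₁ o) = lettersʷ ω , member-letters {ω = ω} i , o
  either-occIn {ω = ω} i (inj₂ o) = inv (lettersʷ ω) , member-inv (member-letters {ω = ω} i) , o

  occIn-either : ∀ {b F σ} → OccIn b (wordsOf F) (source σ) (letters σ) → ∃ λ ω → ω ∈ F × Either b (lettersʷ ω) σ
  occIn-either {F = F} (w , k , o) with member-elim {F} k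
  ... | ω , i , inj₁ refl = ω , i , inj₁ o
  ... | ω , i , inj₂ refl = ω , i , inj₂ o

  -- A bending walk that does not kiss itself is a reduced face on its own, so the enumeration of
  -- faces contains it.
  complete : ∀ {b w v s} → IsWalk w → Occ b w v s → C.NonKissing (w ∷ []) → Member W w
  complete {b} {w} {v} {s} h o nk with find (proj₂ finite ((ω ∷ []) , face , (λ {ω₁} → bending {ω₁})))
    where
    ω = toWalk h
    o′ : Occ b (lettersʷ ω) v s
    o′ = subst (λ w → Occ b w v s) (sym (letters-toWalk h)) o
    nk′ : C.NonKissing (wordsOf (ω ∷ []))
    nk′ = subst (λ w → C.NonKissing (w ∷ [])) (sym (letters-toWalk h)) nk
    face : IsFace (ω ∷ [])
    face {ω₁} {ω₂} i j k with kisses⁻ {ω₁} {ω₂} k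
    ... | σ , _ , a , c = nk′ (either-occIn {ω = ω₂} {σ} j c) (either-occIn {ω = ω₁} {σ} i a)
    bending : ∀ {ω₁} → ω₁ ∈ (ω ∷ []) → Bending ω₁
    bending {ω₁} (here e) = bending-≈ {ω} {ω₁} e (occ-bending {ω = ω} o′)
  ... | R , i , (a , _) = member-W {R} i
    (subst (Member (wordsOf (proj₁ R))) (letters-toWalk h) (member-letters {ω = toWalk h} (a {toWalk h} (here (inj₁ refl)))))

  W-bending : ∀ {ω} → Member W (lettersʷ ω) → Bending ω
  W-bending {ω} k with find k
  ... | u , i , e with find (∈-concatMap⁻ (λ (R : ReducedFace) → wordsOf (proj₁ R)) {xs = faces} i)
  ... | (R , _ , bending) , _ , j = bending {ω} (letters-member {R} {ω} (lose j e))

  open Covering W W-walks complete public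
  open Finite W W-walks complete public

  module TF (F : List Walk) = Torsion (wordsOf F) (wordsOf-walks F)

  torsionᶠ : List Walk → Class
  torsionᶠ F = TF.torsion F

  compatible-≈ : ∀ {T ω ω₁} → Closed T → ω₁ ≈ʷ ω → Compatible T (lettersʷ ω) → Compatible T (lettersʷ ω₁)
  compatible-≈ {T} {ω} {ω₁} closed e c with ≈-letters {ω₁} {ω} e
  ... | inj₁ e′ = subst (Compatible T) (sym e′) c
  ... | inj₂ e′ = subst (Compatible T) (trans (cong inv (sym e′)) (inv-inv (lettersʷ ω₁))) (compatible-inv closed (is-walk ω) c)

  either-value : ∀ {T b ω σ} → Closed T → Compatible T (lettersʷ ω) → Either b (lettersʷ ω) σ → T (source σ) (letters σ) ≡ not b
  either-value closed c (inj₁ o) = c o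
  either-value {ω = ω} closed c (inj₂ o) = compatible-inv closed (is-walk ω) c o

  compatible-nonkissing : ∀ {T ω ω′} → Closed T → Compatible T (lettersʷ ω) → Compatible T (lettersʷ ω′) → ¬ Kisses ω ω′
  compatible-nonkissing {ω = ω} {ω′} closed c c′ k with kisses⁻ {ω} {ω′} k
  ... | σ , _ , a , b = t≢f (either-value {ω = ω} {σ} closed c a) (either-value {ω = ω′} {σ} closed c′ b)

  occ-kisses : ∀ {ω ω′ v s} → Occ false (lettersʷ ω) v s → Occ true (lettersʷ ω′) v s → Kisses ω ω′
  occ-kisses {ω} {ω′} {v} {s} o o′ = kisses⁺ {ω} {ω′} {word v s (src (Occ.m o))} (occᵂ-inner (is-walk ω) o) (inj₁ o) (inj₁ o′)

  -- Strings at the bottom of a walk of F are excluded from the class by definition. A quotient of a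
  -- top substring is again a top substring, so its occurrence at the bottom of a walk of F would be
  -- a kiss.
  face-compatible : ∀ {F ω} → IsFace F → ω ∈ F → Compatible (torsionᶠ F) (lettersʷ ω)
  face-compatible {F} {ω} face i {true} {v} {s} o =
    ¬-not λ t → TF.torsion-avoids F t whole (lettersʷ ω , member-letters {ω = ω} i , o)
  face-compatible {F} {ω} face i {false} {v} {s} o = TF.torsion-intro F avoid
    where
    avoid : ∀ {v′ q} → Part true v s v′ q → ¬ OccIn true (wordsOf F) v′ q
    avoid {v′} {q} P O with occ-part o P
    ... | o′ with occIn-either {F = F} {word v′ q (src (Occ.m o′))} O
    ... | ω₂ , j , e = face {ω} {ω₂} i j (kisses⁺ {ω} {ω₂} {word v′ q (src (Occ.m o′))} (occᵂ-inner (is-walk ω) o′) (inj₁ o′) e)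

  -- Adding ω to F leaves a face, since all walks are compatible with one torsion class; maximality
  -- of F does the rest.
  facet-member : ∀ (F : Facet) {ω} → Bending ω → Compatible (torsionᶠ (proj₁ F)) (lettersʷ ω) → ω ∈ proj₁ F
  facet-member (F , (face , bending) , max) {ω} h c =
    max (ω ∷ F) ((λ {ω₁} {ω₂} i j → compatible-nonkissing {ω = ω₁} {ω₂} (TF.torsion-closed F) (comp ω₁ i) (comp ω₂ j)) ,
                 (λ {ω₁} i → bent ω₁ i)) (λ {ω₁} → there) {ω} (here (inj₁ refl))
    where
    comp : ∀ ω₁ → ω₁ ∈ (ω ∷ F) → Compatible (torsionᶠ F) (lettersʷ ω₁)
    comp ω₁ (here e) = compatible-≈ {ω = ω} {ω₁} (TF.torsion-closed F) e c
    comp ω₁ (there i) = face-compatible {F} {ω₁} (λ {ω₁} {ω₂} → face {ω₁} {ω₂}) i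
    bent : ∀ ω₁ → ω₁ ∈ (ω ∷ F) → Bending ω₁
    bent ω₁ (here e) = bending-≈ {ω} {ω₁} e h
    bent ω₁ (there i) = bending {ω₁} i

  torsionᶠ-⊆ : ∀ {F F′} → F ⊆ F′ → torsionᶠ F′ ⊆ᵀ torsionᶠ F
  torsionᶠ-⊆ {F} {F′} a s c t = TF.torsion-intro F λ P (w , k , o) → TF.torsion-avoids F′ t P (w , member-⊆ {F} {F′} (λ {ω} → a {ω}) k , o)

  toWalks : ∀ ws → All IsWalk ws → List Walk
  toWalks [] [] = []
  toWalks (w ∷ ws) (h ∷ hs) = toWalk h ∷ toWalks ws hs

  wordsOf-toWalks : ∀ ws hs → wordsOf (toWalks ws hs) ≡ ws
  wordsOf-toWalks [] [] = refl
  wordsOf-toWalks (w ∷ ws) (h ∷ hs) = cong₂ _∷_ (letters-toWalk h) (wordsOf-toWalks ws hs)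

  module FacetOf {T : Class} (closed : Closed T) where

    opaque
      list : List Walk
      list = toWalks (walksOf T) (walksOf-walks T)

      list-words : wordsOf list ≡ walksOf T
      list-words = wordsOf-toWalks (walksOf T) (walksOf-walks T)

    ∈-list⁻ : ∀ {ω} → ω ∈ list → Member (walksOf T) (lettersʷ ω)
    ∈-list⁻ {ω} i = subst (λ ws → Member ws (lettersʷ ω)) list-words (member-letters {list} {ω} i)

    ∈-list⁺ : ∀ {ω b v s} → Compatible T (lettersʷ ω) → Occ b (lettersʷ ω) v s → ω ∈ list
    ∈-list⁺ {ω} c o = letters-member {list} {ω}
      (subst (λ ws → Member ws (lettersʷ ω)) (sym list-words) (member-walksOf closed (is-walk ω) c o))

    compatible-list : ∀ {ω} → ω ∈ list → Compatible T (lettersʷ ω)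
    compatible-list {ω} i = walksOf-compatible closed (∈-list⁻ {ω} i)

    bending-list : ∀ {ω} → ω ∈ list → Bending ω
    bending-list {ω} i with find (∈-list⁻ {ω} i)
    ... | u , j , e = W-bending {ω} (lose (proj₁ (∈-filter⁻ (compatible? T) {xs = W} j)) e)

    of-word : ∀ {b w v s} → IsWalk w → Compatible T w → Occ b w v s →
              ∃ λ ω → ω ∈ list × lettersʷ ω ≡ w
    of-word {b} {w} {v} {s} h c o = toWalk h ,
      ∈-list⁺ {toWalk h} (subst (Compatible T) (sym (letters-toWalk h)) c) (subst (λ w → Occ b w v s) (sym (letters-toWalk h)) o) ,
      letters-toWalk h

    -- If a walk of G had a bottom substring in T or a top substring outside T, some greedy walk of
    -- T, which belongs to `list` and hence to G, would kiss it or be kissed by it, respectively.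
    maximal : ∀ G → IsReducedFace G → list ⊆ G → G ⊆ list
    maximal G (face , bending) a {ω} i with bends {ω} (bending {ω} i)
    ... | b , v , s , o = ∈-list⁺ {ω} (λ {b} {v} {s} → comp {b} {v} {s}) o
      where
      kissed : ∀ {v s v′ q w′} → Occ true (lettersʷ ω) v s → Part false v s v′ q → IsWalk w′ → Compatible T w′ → Occ false w′ v′ q → ⊥
      kissed {v′ = v′} {q} o P h c o′ = let (ω′ , j , e) = of-word h c o′ in
        face {ω′} {ω} (a {ω′} j) i (occ-kisses {ω′} {ω} (subst (λ w → Occ false w v′ q) (sym e) o′) (occ-part o P))
      kissing : ∀ {v s v′ q w′} → Occ false (lettersʷ ω) v s → Part true v s v′ q → IsWalk w′ → Compatible T w′ → Occ true w′ v′ q → ⊥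
      kissing {v′ = v′} {q} o P h c o′ = let (ω′ , j , e) = of-word h c o′ in
        face {ω} {ω′} i (a {ω′} j) (occ-kisses {ω} {ω′} (occ-part o P) (subst (λ w → Occ true w v′ q) (sym e) o′))
      comp : Compatible T (lettersʷ ω)
      comp {true} {s = s} o@(occ _ _ _ refl _ _) = ¬-not λ t →
        let (_ , _ , P , _ , _ , h , c , o′) = top-sub closed (all-good closed) s (occ-context (is-walk ω) o) t in kissed o P h c o′
      comp {false} {s = s} o@(occ _ _ _ refl _ _) = ¬-not λ f →
        let (_ , _ , P , _ , h , c , o′) = bottom-quotient closed (all-good closed) s (occ-context (is-walk ω) o) f in kissing o P h c o′

    facet : Facet
    facet = list , ((λ {ω} {ω′} i j → compatible-nonkissing {ω = ω} {ω′} closed (compatible-list {ω} i) (compatible-list {ω′} j)) ,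
                    (λ {ω} → bending-list {ω})) , λ G g a {ω} → maximal G g (λ {ω} → a {ω}) {ω}

    facet-torsion : torsionᶠ list ≗ T
    facet-torsion = ≗-trans {torsionᶠ list} {WalksOf.torsion T} {T} (λ s c → bool-ext to from) (≗-sym {T} {WalksOf.torsion T} (torsion-walksOf closed))
      where
      to : ∀ {v s} → torsionᶠ list v s ≡ true → WalksOf.torsion T v s ≡ true
      to {v} {s} t = WalksOf.torsion-intro T λ {v′} {q} P O → TF.torsion-avoids list t P (subst (λ ws → OccIn true ws v′ q) (sym list-words) O)
      from : ∀ {v s} → WalksOf.torsion T v s ≡ true → torsionᶠ list v s ≡ true
      from {v} {s} t = TF.torsion-intro list λ {v′} {q} P O → WalksOf.torsion-avoids T t P (subst (λ ws → OccIn true ws v′ q) list-words O)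

  facetClass : Facet → Class
  facetClass F = torsionᶠ (proj₁ F)

  facetClass-closed : ∀ F → Closed (facetClass F)
  facetClass-closed F = TF.torsion-closed (proj₁ F)

  facet-compatible : ∀ (F : Facet) {ω} → ω ∈ proj₁ F → Compatible (facetClass F) (lettersʷ ω)
  facet-compatible (F , (face , _) , _) {ω} i = face-compatible {F} {ω} (λ {ω₁} {ω₂} → face {ω₁} {ω₂}) i

  facet-bending : ∀ (F : Facet) {ω} → ω ∈ proj₁ F → Bending ω
  facet-bending (F , (_ , bending) , _) {ω} = bending {ω}

  ≋⇒≗ : ∀ {F G : Facet} → proj₁ F ≋ proj₁ G → facetClass F ≗ facetClass G
  ≋⇒≗ {F} {G} (a , b) = ⊆-antisym {facetClass F} {facetClass G}
    (torsionᶠ-⊆ {proj₁ G} {proj₁ F} (λ {ω} → b {ω})) (torsionᶠ-⊆ {proj₁ F} {proj₁ G} (λ {ω} → a {ω}))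

  ≗⇒≋ : ∀ {F G : Facet} → facetClass F ≗ facetClass G → proj₁ F ≋ proj₁ G
  ≗⇒≋ {F} {G} e = (λ {ω} → half F G e {ω}) , (λ {ω} → half G F (≗-sym {facetClass F} {facetClass G} e) {ω})
    where
    half : ∀ (F G : Facet) → facetClass F ≗ facetClass G → proj₁ F ⊆ proj₁ G
    half F G e {ω} i = facet-member G {ω} (facet-bending F {ω} i)
      (compatible-≗ {facetClass F} {facetClass G} e (is-walk ω) (facet-compatible F {ω} i))

  open FacetLattice facetSetoid facetClass facetClass-closed FacetOf.facet FacetOf.facet-torsion
    (λ {F} {G} → ≋⇒≗ {F} {G}) (λ {F} {G} → ≗⇒≋ {F} {G}) public

  completion : ReducedFace → Facet
  completion R = FacetOf.facet (TF.torsion-closed (proj₁ R))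

  -- The given list consists of faces, so each is first completed to a facet. A listed face with the
  -- same walks as a facet F has the class of F, and its completion is F.
  facets-finite : Finite facetSetoid
  facets-finite = map completion faces , λ F → Any.map⁺ (Any.map (λ {R} → here-completed F R) (proj₂ finite (proj₁ F , proj₁ (proj₂ F))))
    where
    here-completed : ∀ (F : Facet) (R : ReducedFace) → proj₁ F ≋ proj₁ R → proj₁ F ≋ proj₁ (completion R)
    here-completed F R (a , b) = ≗⇒≋ {F} {completion R}
      (≗-trans {facetClass F} {torsionᶠ (proj₁ R)} {facetClass (completion R)}
        (⊆-antisym {facetClass F} {torsionᶠ (proj₁ R)} (torsionᶠ-⊆ {proj₁ R} {proj₁ F} (λ {ω} → b {ω})) (torsionᶠ-⊆ {proj₁ F} {proj₁ R} (λ {ω} → a {ω})))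
        (≗-sym {facetClass (completion R)} {torsionᶠ (proj₁ R)} (FacetOf.facet-torsion (TF.torsion-closed (proj₁ R)))))

-- Distinguished arrows, frames and flips of facets.

module Flips (Q : GentleBoundQuiver) (B : Blossoming Q) (finite : Finite (NonKissing.reducedFaceSetoid Q B)) where
  open Walks Q B
  open Facets Q B finite

  module _ (F : Facet) where
    private
      T = facetClass F
      closed = facetClass-closed F

    withStraight-compatible : ∀ {ω} → withStraight F ω → Compatible T (lettersʷ ω)
    withStraight-compatible {ω} (inj₁ i) = facet-compatible F {ω} i
    withStraight-compatible {ω} (inj₂ s) o = ⊥-elim (straight-occ {ω} s o)

    compatible-withStraight : ∀ {ω} → Compatible T (lettersʷ ω) → withStraight F ω
    compatible-withStraight {ω} c with straight-or-bends ω
    ... | inj₁ s = inj₂ s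
    ... | inj₂ (b , v , s , o) = inj₁ (facet-member F {ω} (occ-bending {ω = ω} o) c)

    greedy-separateˡ : ∀ {α x y x′ y′} → IsWalk (x ++ α ⁺ ∷ y) → Compatible T (x ++ α ⁺ ∷ y) →
      IsWalk (x′ ++ α ⁺ ∷ y′) → C.Distinguished T x′ (α ⁺) y′ → ¬ Separateˡ x′ x
    greedy-separateˡ {α} {y = y} wk c wk′ (g , _) (d , β , γ , r , r′ , refl , refl) =
      t≢f (c o) (trans (cong (λ v → T v d) (≈-tgt (chain-≈ d cγ cβ))) (greedyˡ closed r d g refl cβ))
      where
      cβ : Chain (β ⁺) (d ++ α ⁺ ∷ [])
      cβ = chain-cut d (walk-chain r (subst IsWalk (assoc∷ r d) wk′))
      cγ : Chain (γ ⁻) (d ++ α ⁺ ∷ [])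
      cγ = chain-cut d (walk-chain r′ (subst IsWalk (assoc∷ r′ d) wk))
      o : Occ false ((r′ ++ γ ⁻ ∷ d) ++ α ⁺ ∷ y) (tgt (γ ⁻)) d
      o = occ r′ y (assoc∷ r′ d) refl refl refl

    greedy-separateʳ : ∀ {α x y y′} → Compatible T (x ++ α ⁺ ∷ y) → Greedy T (tgt (α ⁺)) y′ → ¬ Separateʳ y′ y
    greedy-separateʳ {α} {x} c g (d , β , γ , r , r′ , refl , refl) =
      t≢f (turn g d r refl) (c (occ x r′ refl refl refl refl))

    -- The greedy walk through α belongs to the facet, straight walks included, so the maximum is at
    -- least as large. Were it strictly larger, the separation would exhibit a top substring outside
    -- T or a bottom substring in T.
    maximum⁺ : ∀ {α x y} → IsWalk (x ++ α ⁺ ∷ y) → Compatible T (x ++ α ⁺ ∷ y) →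
               IsMaximum F α (x , y) → C.Distinguished T x (α ⁺) y
    maximum⁺ {α} {x} {y} wk c max = let (x′ , y′ , wk′ , d) = greedy-walk closed (all-good closed) (α ⁺) in
      compare-with wk′ d (max (toWalk wk′) (compatible-withStraight {toWalk wk′}
        (subst (Compatible T) (sym (letters-toWalk wk′)) (distinguished-compatible closed x′ y′ wk′ d))) x′ y′ (letters-toWalk wk′))
      where
      compare-with : ∀ {x′ y′} → IsWalk (x′ ++ α ⁺ ∷ y′) → C.Distinguished T x′ (α ⁺) y′ →
        (x′ , y′) ≡ (x , y) ⊎ (x′ , y′) ≺ (x , y) → C.Distinguished T x (α ⁺) y
      compare-with wk′ d (inj₁ refl) = d
      compare-with wk′ d (inj₂ (inj₁ (s , _))) = ⊥-elim (greedy-separateˡ wk c wk′ d s)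
      compare-with wk′ d (inj₂ (inj₂ (inj₁ (_ , s)))) = ⊥-elim (greedy-separateʳ {α} {x} c (proj₂ d) s)
      compare-with wk′ d (inj₂ (inj₂ (inj₂ (s , _)))) = ⊥-elim (greedy-separateˡ wk c wk′ d s)

    separateʳ-greedy : ∀ {α x y y′} → Compatible T (x ++ α ⁺ ∷ y) → Greedy T (tgt (α ⁺)) y′ → Fork y y′ → Separateʳ y y′
    separateʳ-greedy {α} {x} c g (fork d {m} {s} {m′} {s′} refl refl e) = at m m′ e c g
      where
      at : ∀ m m′ → pos m ≡ not (pos m′) → Compatible T (x ++ α ⁺ ∷ d ++ m ∷ s) → Greedy T (tgt (α ⁺)) (d ++ m′ ∷ s′) → Separateʳ (d ++ m ∷ s) (d ++ m′ ∷ s′)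
      at (β ⁺) (γ ⁻) _ _ _ = d , β , γ , s , s′ , refl , refl
      at (γ ⁻) (β ⁺) _ c g = t≢f (turn g d s′ refl) (c (occ x s refl refl refl refl))
      at (_ ⁺) (_ ⁺) () _ _
      at (_ ⁻) (_ ⁻) () _ _

    separateˡ-greedy : ∀ {α x y x′} → IsWalk (x ++ α ⁺ ∷ y) → Compatible T (x ++ α ⁺ ∷ y) →
      Greedy T (tgt (α ⁻)) (inv x′) → Fork (inv x) (inv x′) → Separateˡ x x′
    separateˡ-greedy {α} {x} {y} {x′} wk c g (fork d {m} {s} {m′} {s′} e e′ f) = at m m′ f (uncut e) (uncut e′) (turn g d s′ e′)
      where
      at : ∀ m m′ → pos m ≡ not (pos m′) → x ≡ inv s ++ flip m ∷ inv d → x′ ≡ inv s′ ++ flip m′ ∷ inv d →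
           T (tgt (α ⁻)) d ≡ pos m′ → Separateˡ x x′
      at (β ⁻) (γ ⁺) _ p q _ = inv d , β , γ , inv s , inv s′ , p , q
      at (γ ⁺) (β ⁻) _ refl q h = t≢f (trans (closed-inv) (c o)) h
        where
        o : Occ false ((inv s ++ γ ⁻ ∷ inv d) ++ α ⁺ ∷ y) (tgt (γ ⁻)) (inv d)
        o = occ (inv s) y (assoc∷ (inv s) (inv d)) refl refl refl
        closed-inv : T (tgt (α ⁻)) d ≡ T (tgt (γ ⁻)) (inv d)
        closed-inv = trans (cong (T (tgt (α ⁻))) (sym (inv-inv d)))
          (sym (Closed.inversion closed (inv d) (occ-context wk o)))
      at (_ ⁺) (_ ⁺) () _ _ _
      at (_ ⁻) (_ ⁻) () _ _ _

    -- A compatible walk can leave the greedy one only by an arrow read forwards. Otherwise the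
    -- common part between α and the fork would be a bottom substring in T, to the right of α, or a
    -- top substring outside T, to its left.
    maximum⁻ : ∀ {α x y} → IsWalk (x ++ α ⁺ ∷ y) → C.Distinguished T x (α ⁺) y → IsMaximum F α (x , y)
    maximum⁻ {α} {x} {y} wk (g , g′) ω st x′ y′ e =
      combine (ray-fork (inv x′) (inv x) (proj₁ (mark x′ wk′)) (proj₁ (mark x wk)))
              (ray-fork y′ y (proj₂ (mark x′ wk′)) (proj₂ (mark x wk)))
      where
      wk′ : IsWalk (x′ ++ α ⁺ ∷ y′)
      wk′ = subst IsWalk e (is-walk ω)
      c : Compatible T (x′ ++ α ⁺ ∷ y′)
      c = subst (Compatible T) e (withStraight-compatible {ω} st)
      combine : inv x′ ≡ inv x ⊎ Fork (inv x′) (inv x) → y′ ≡ y ⊎ Fork y′ y → (x′ , y′) ≡ (x , y) ⊎ (x′ , y′) ≺ (x , y)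
      combine (inj₁ p) (inj₁ q) = inj₁ (cong₂ _,_ (inv-inj p) q)
      combine (inj₂ p) (inj₁ q) = inj₂ (inj₁ (separateˡ-greedy wk′ c g p , q))
      combine (inj₁ p) (inj₂ q) = inj₂ (inj₂ (inj₁ (inv-inj p , separateʳ-greedy {x = x′} c g′ q)))
      combine (inj₂ p) (inj₂ q) = inj₂ (inj₂ (inj₂ (separateˡ-greedy wk′ c g p , separateʳ-greedy {x = x′} c g′ q)))

    distinguished⁺ : ∀ x l {y} → IsWalk (x ++ l ∷ y) → Compatible T (x ++ l ∷ y) →
                     Distinguished F x l y → C.Distinguished T x l y
    distinguished⁺ x (α ⁺) wk c max = maximum⁺ wk c max
    distinguished⁺ x (α ⁻) {y} wk c max =
      let (g , g′) = maximum⁺ {α} {inv y} {inv x} (subst IsWalk (inv-cut x y) (walk-inv wk))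
            (subst (Compatible T) (inv-cut x y) (compatible-inv closed wk c)) max
      in g′ , subst (Greedy T (tgt (α ⁻))) (inv-inv y) g

    distinguished⁻ : ∀ x l {y} → IsWalk (x ++ l ∷ y) → C.Distinguished T x l y → Distinguished F x l y
    distinguished⁻ x (α ⁺) wk d = maximum⁻ wk d
    distinguished⁻ x (α ⁻) {y} wk (g , g′) = maximum⁻ {α} {inv y} {inv x} (subst IsWalk (inv-cut x y) (walk-inv wk))
      (subst (Greedy T (tgt (α ⁻))) (sym (inv-inv y)) g′ , g)

    stringOf : ∀ {b} → Frame b T → Word
    stringOf f = word (tgt (Frame.α f)) (Frame.σ f) (src (Frame.β f))

    frame-distinguished : ∀ {b} (f : Frame b T) ω → lettersʷ ω ≡ Frame.word f → ∀ {σ} → stringOf f ≈ σ → DistinguishedString F ω σ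
    frame-distinguished f ω e {σ} i = stringOf f , i , x , y , α , β ,
      record { factors = e ; starts = refl ; ends = refl ; inQ₀ = internal (Frame.σ f) chain } ,
      distinguished⁻ x α (Frame.walk f) distˡ ,
      distinguished⁻ (x ++ α ∷ Frame.σ f) β (subst IsWalk (sym (assoc∷ x (Frame.σ f))) (Frame.walk f)) distʳ
      where open Frame f hiding (σ; walk)

    distinguished-frame : ∀ {ω σ} → ω ∈ proj₁ F → DistinguishedString F ω σ →
      ∃ λ b → ∃ λ (f : Frame b T) → lettersʷ ω ≡ Frame.word f × stringOf f ≈ σ
    distinguished-frame {ω} i (τ , τ≈σ , x , y , l , m , o , d , d′) = pos l , f , Occurs.factors o ,
      subst (_≈ _) (cong₂ (λ u v → word u (letters τ) v) (Occurs.starts o) (Occurs.ends o)) τ≈σ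
      where
      wk : IsWalk (x ++ l ∷ letters τ ++ m ∷ y)
      wk = subst IsWalk (Occurs.factors o) (is-walk ω)
      c : Compatible T (x ++ l ∷ letters τ ++ m ∷ y)
      c = subst (Compatible T) (Occurs.factors o) (facet-compatible F {ω} i)
      e : x ++ l ∷ letters τ ++ m ∷ y ≡ (x ++ l ∷ letters τ) ++ m ∷ y
      e = sym (assoc∷ x (letters τ))
      g : C.Distinguished T x l (letters τ ++ m ∷ y)
      g = distinguished⁺ x l wk c d
      g′ : C.Distinguished T (x ++ l ∷ letters τ) m y
      g′ = distinguished⁺ (x ++ l ∷ letters τ) m (subst IsWalk e wk) (subst (Compatible T) e c) d′
      f : Frame (pos l) T
      f = record { x = x ; α = l ; σ = letters τ ; β = m ; y = y ; walk = wk ; signˡ = refl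
        -- Two distinguished letters of equal sign would stand at the same place.
        ; signʳ = ¬-not λ h → ℕ.<-irrefl (cong length (distinguished-unique closed wk x _ _ y refl e g g′ (sym h))) (cut-<ˡ x)
        ; distˡ = g ; distʳ = g′ }

    frame-inner : ∀ {b} (f : Frame b T) → Inner (stringOf f)
    frame-inner f = Frame.α f , Frame.β f , refl , Frame.chain f , refl

    value-≈ : ∀ {σ τ} → Inner σ → σ ≈ τ → T (source σ) (letters σ) ≡ T (source τ) (letters τ)
    value-≈ _ (inj₁ refl) = refl
    value-≈ {word u s v} (l , m , refl , c , e) (inj₂ refl) =
      trans (Closed.inversion closed s c) (cong (λ v → T v (inv s)) (trans (tgt-flip m) e))

    frame-value : ∀ {b} (f : Frame b T) → T (source (stringOf f)) (letters (stringOf f)) ≡ not b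
    frame-value f = Frame.compatible f closed (Frame.occurrence f)

    sub-value : ∀ {b ω σ} → ω ∈ proj₁ F → Sub b ω σ → T (source σ) (letters σ) ≡ not b
    sub-value {ω = ω} {σ} i s = either-value {ω = ω} {σ} closed (facet-compatible F {ω} i) (proj₂ (sub-either s))

    -- T contains the distinguished string of a top frame and not that of a bottom frame, so the way
    -- σ lies in ω determines the sign of the frame.
    signed-frame : ∀ {b ω σ} → ω ∈ proj₁ F → DistinguishedString F ω σ → Sub b ω σ →
      ∃ λ (f : Frame b T) → lettersʷ ω ≡ Frame.word f × stringOf f ≈ σ
    signed-frame {b} {ω} {σ} i d s with distinguished-frame {ω} i d
    ... | b′ , f , e , h with b′ Bool.≟ b
    ... | yes refl = f , e , h
    ... | no b′≢b = b≢notb (trans (sym (frame-value f)) (trans (value-≈ (frame-inner f) h)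
          (trans (sub-value {ω = ω} {σ} i s) (trans (sym (¬-not b′≢b)) (sym (not-involutive b′))))))

  frame-walk : ∀ {b} (F : Facet) (f : Frame b (facetClass F)) → ∃ λ ω → lettersʷ ω ≡ Frame.word f × ω ∈ proj₁ F
  frame-walk {b} F f = toWalk wk , letters-toWalk wk ,
    facet-member F {toWalk wk} (occ-bending {ω = toWalk wk} (subst (λ w → Occᵂ b w (stringOf F f)) (sym (letters-toWalk wk)) (Frame.occurrence f)))
      (subst (Compatible (facetClass F)) (sym (letters-toWalk wk)) (Frame.compatible f (facetClass-closed F)))
    where wk = Frame.walk f

  reads-≈ : ∀ {b T} (f : Frame b T) {ω} → lettersʷ ω ≡ Frame.word f → ∀ {μ} → f reads lettersʷ μ → μ ≈ʷ ω
  reads-≈ f {ω} e {μ} (inj₁ h) = letters-≈ μ ω (inj₁ (trans (sym h) (sym e)))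
  reads-≈ f {ω} e {μ} (inj₂ h) = letters-≈ μ ω (inj₂ (trans (cong inv (sym h)) (trans (inv-inv (Frame.word f)) (sym e))))

  ≈-reads : ∀ {b T} (f : Frame b T) {ω} → lettersʷ ω ≡ Frame.word f → ∀ {μ} → μ ≈ʷ ω → f reads lettersʷ μ
  ≈-reads f {ω} e {μ} h with ≈-letters {μ} {ω} h
  ... | inj₁ p = inj₁ (trans (sym e) (sym p))
  ... | inj₂ p = inj₂ (trans (cong inv (trans (sym e) (sym p))) (inv-inv (lettersʷ μ)))

  flip-is-flip : ∀ {F G} → F ⟶ G → IsFlip (facetClass F) (facetClass G)
  flip-is-flip {F} {G} (ω , ω′ , i , i′ , _ , same-rest , σ , d , d′ , top , bottom)
    with signed-frame F {false} {ω} {σ} i d (top-sub⁺ {ω} top) | signed-frame G {true} {ω′} {σ} i′ d′ (bottom-sub⁺ {ω′} bottom)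
  ... | f , e , h | g , e′ , h′ = record
    { f = f ; g = g
    ; shared = hits (≈-transʷ h h′)
    ; to = λ wk o c ¬r → moved wk o c ¬r
    ; from = λ wk o c ¬r → moved⁻ wk o c ¬r
    }
    where
    ≈-transʷ : stringOf F f ≈ σ → stringOf G g ≈ σ → stringOf F f ≈ stringOf G g
    ≈-transʷ a b = IsEquivalence.trans ≈-isEquivalence a (IsEquivalence.sym ≈-isEquivalence b)
    hits : stringOf F f ≈ stringOf G g → Hits f (tgt (Frame.α g)) (Frame.σ g)
    hits (inj₁ p) = inj₁ (cong source p , cong letters p)
    hits (inj₂ p) = inj₂ (trans (tgt-flip (Frame.β f)) (cong source p) , cong letters p)
    moved : ∀ {b w v s} → IsWalk w → Occ b w v s → Compatible (facetClass F) w → ¬ (f reads w) → Compatible (facetClass G) w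
    moved {b} {w} {v} {s} wk o c ¬r = subst (Compatible (facetClass G)) (letters-toWalk wk)
      (facet-compatible G {μ} (proj₁ (Equivalence.to (same-rest μ)
        (facet-member F {μ} (occ-bending {ω = μ} (subst (λ w → Occ b w v s) (sym (letters-toWalk wk)) o))
          (subst (Compatible (facetClass F)) (sym (letters-toWalk wk)) c) ,
         λ q → ¬r (subst (f reads_) (letters-toWalk wk) (≈-reads f {ω} e {μ} q))))))
      where μ = toWalk wk
    moved⁻ : ∀ {b w v s} → IsWalk w → Occ b w v s → Compatible (facetClass G) w → ¬ (g reads w) → Compatible (facetClass F) w
    moved⁻ {b} {w} {v} {s} wk o c ¬r = subst (Compatible (facetClass F)) (letters-toWalk wk)
      (facet-compatible F {μ} (proj₁ (Equivalence.from (same-rest μ)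
        (facet-member G {μ} (occ-bending {ω = μ} (subst (λ w → Occ b w v s) (sym (letters-toWalk wk)) o))
          (subst (Compatible (facetClass G)) (sym (letters-toWalk wk)) c) ,
         λ q → ¬r (subst (g reads_) (letters-toWalk wk) (≈-reads g {ω′} e′ {μ} q))))))
      where μ = toWalk wk

  is-flip-flip : ∀ {F G} → IsFlip (facetClass F) (facetClass G) → F ⟶ G
  is-flip-flip {F} {G} φ = ω , ω′ , ω∈ , ω′∈ , (λ h → not-both ω ω∈ h) ,
    (λ μ → mk⇔
      (λ (i , h) → facet-member G {μ} (facet-bending F {μ} i)
          (to (is-walk μ) (proj₂ (proj₂ (proj₂ (bends {μ} (facet-bending F {μ} i))))) (facet-compatible F {μ} i) (λ r → h (reads-≈ f {ω} e {μ} r))) ,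
        not-both μ i)
      (λ (i , h) → facet-member F {μ} (facet-bending G {μ} i)
          (from (is-walk μ) (proj₂ (proj₂ (proj₂ (bends {μ} (facet-bending G {μ} i))))) (facet-compatible G {μ} i) (λ r → h (reads-≈ g {ω′} e′ {μ} r))) ,
        not-both⁻ μ i)) ,
    σ , frame-distinguished F f ω e {σ} (inj₁ refl) , frame-distinguished G g ω′ e′ {σ} g≈f ,
    top-sub⁻ {ω} {σ} (either-sub (frame-inner F f) (inj₁ f-occ)) ,
    bottom-sub⁻ {ω′} {σ} (stringOf G g , g≈f , proj₂ (proj₂ (g-sub)))
    where
    open IsFlip φ
    ω = proj₁ (frame-walk F f)
    e = proj₁ (proj₂ (frame-walk F f))
    ω∈ = proj₂ (proj₂ (frame-walk F f))
    ω′ = proj₁ (frame-walk G g)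
    e′ = proj₁ (proj₂ (frame-walk G g))
    ω′∈ = proj₂ (proj₂ (frame-walk G g))
    σ = stringOf F f
    f-occ : Occᵂ false (lettersʷ ω) σ
    f-occ = subst (λ w → Occᵂ false w σ) (sym e) (Frame.occurrence f)
    g-occ : Occᵂ true (lettersʷ ω′) (stringOf G g)
    g-occ = subst (λ w → Occᵂ true w (stringOf G g)) (sym e′) (Frame.occurrence g)
    g-sub : ∃ λ τ → τ ≈ stringOf G g × ∃₂ λ x y → ∃₂ λ l m → Occurs ω′ x l (stringOf G g) m y × pos l ≡ true × pos m ≡ false
    g-sub = stringOf G g , inj₁ refl , _ , _ , _ , _ , occᵂ-occurs (frame-inner G g) g-occ , Occ.signˡ g-occ , Occ.signʳ g-occ
    g≈f : stringOf G g ≈ σ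
    g≈f = aligned shared
      where
      aligned : Hits f (tgt (Frame.α g)) (Frame.σ g) → stringOf G g ≈ σ
      aligned (inj₁ (p , q)) = inj₁ (same-word (sym p) (sym q))
        where
        same-word : tgt (Frame.α g) ≡ tgt (Frame.α f) → Frame.σ g ≡ Frame.σ f → stringOf G g ≡ stringOf F f
        same-word p q = cong₂ (λ (u , s) v → word u s v) (cong₂ _,_ p q)
          (trans (sym (tgt-flip (Frame.β g))) (trans (chain-end (Frame.σ f) (subst (λ s → Chain (Frame.α g) (s ++ Frame.β g ∷ [])) q (Frame.chain g)) (Frame.chain f) p) (tgt-flip (Frame.β f))))
      aligned (inj₂ (p , q)) = inj₂ (trans (cong _⁻¹ flipped-word) (⁻¹-involutive σ))
        where
        flipped-word : stringOf G g ≡ σ ⁻¹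
        flipped-word = cong₂ (λ (u , s) v → word u s v) (cong₂ _,_ (trans (sym p) (tgt-flip (Frame.β f))) (sym q))
          (trans (sym (tgt-flip (Frame.β g)))
            (trans (chain-end (inv (Frame.σ f)) (subst (λ s → Chain (Frame.α g) (s ++ Frame.β g ∷ [])) (sym q) (Frame.chain g)) (Frame.chain (rev f)) (sym p))
              (cong tgt (flip-involutive (Frame.α f)))))
    f-holds : facetClass F (source (stringOf G g)) (letters (stringOf G g)) ≡ true
    f-holds = trans (value-≈ F (frame-inner G g) g≈f) (frame-value F f)
    g-fails : facetClass G (source σ) (letters σ) ≡ false
    g-fails = trans (sym (value-≈ G (frame-inner G g) g≈f)) (frame-value G g)
    -- σ lies in the class of F and is at the bottom of ω′, so ω′ is not compatible with that class.
    not-both : ∀ μ → μ ∈ proj₁ F → ¬ (μ ≈ʷ ω′)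
    not-both μ i h = t≢f f-holds (compatible-≈ {ω = μ} {ω′} (facetClass-closed F) (IsEquivalence.sym ≈-isEquivalence h) (facet-compatible F {μ} i) g-occ)
    not-both⁻ : ∀ μ → μ ∈ proj₁ G → ¬ (μ ≈ʷ ω)
    not-both⁻ μ i h = t≢f (compatible-≈ {ω = μ} {ω} (facetClass-closed G) (IsEquivalence.sym ≈-isEquivalence h) (facet-compatible G {μ} i) f-occ) g-fails

theorem5p10 : (Q : GentleBoundQuiver) (B : Blossoming Q) →
    let open NonKissing Q B in
    Finite reducedFaceSetoid →
    Σ[ L ∈ LatticeOn facetSetoid ]
    (IsHasseDiagramOf _⟶_ L × CongruenceUniform (LatticeOn.lattice L))
theorem5p10 Q B finite = latticeOn ,
  (λ F G → mk⇔ (λ h → flip-covers {F} {G} (flip-is-flip {F} {G} h)) (λ h → is-flip-flip {F} {G} (covers-flip {F} {G} h))) ,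
  uniform facets-finite
  where
  open Facets Q B finite
  open Flips Q B finite
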